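{- Every cactus graph satisfies the substructure property.
   Context: All graphs are finite, simple and undirected. A cactus is a connected graph in which any two simple cycles have at most one vertex in common. The eternal vertex cover game on a graph $G$ with $k$ guards: the defender first places $k$ guards on vertices of $G$ (a configuration); then in each round the attacker chooses an edge $uv$ and the defender reconfigures: all guards move simultaneously, each guard either staying or moving to an adjacent vertex, and at least one guard must move along the attacked edge from one endpoint to the other. Two versions are considered: any number of guards per vertex allowed, or at most one guard per vertex in every configuration; the claim holds for each version (all quantities taken within that version). A defense strategy with $k$ guards defends every infinite sequence of attacks; a configuration occurring in some defense strategy (i.e. belonging to an eternal vertex cover class: a nonempty set of configurations closed under defending any attacked edge by a valid reconfiguration) is an eternal vertex cover of $G$; guards on a vertex set are counted with multiplicity. $\operatorname{evc}(G)$ is the minimum number of guards admitting a defense strategy. For $x\in V(G)$, $\operatorname{evc}_x(G)$ is the minimum $k$ such that there is a defense strategy with $k$ guards in which $x$ is occupied in every configuration. $G_x^+$ denotes the graph obtained from $G$ by adding one new vertex adjacent only to $x$. If $x$ is a cut vertex of a connected graph $G'$ and $H$ is a component of $G'-x$, the induced subgraph of $G'$ on $V(H)\cup\{x\}$ is an $x$-component of $G'$, and $G'$ is called an $x$-extension of that subgraph. A graph $G$ satisfies the substructure property if for every non-cut vertex $x$ of $G$ and every $x$-extension $G'$ of $G$: if $\operatorname{evc}(G_x^+)\le \operatorname{evc}_x(G)$ then every eternal vertex cover of $G'$ has at least $\operatorname{evc}_x(G)-1$ guards on $V(G)$, and if $\operatorname{evc}(G_x^+)>\operatorname{evc}_x(G)$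 then every eternal vertex cover of $G'$ has at least $\operatorname{evc}_x(G)$ guards on $V(G)$. -}

module Defs where

open import Data.Nat using (ℕ; zero; suc; _+_; _≤_; _<_; _∸_)
open import Data.Fin using (Fin; zero; suc; inject₁; fromℕ; _≟_)
open import Data.Bool using (Bool; true; false; T)
open import Data.Product using (Σ; ∃; _×_; _,_)
open import Data.Sum using (_⊎_)
open import Data.Unit using (⊤)
open import Relation.Nullary using (¬_)
open import Relation.Nullary.Decidable using (⌊_⌋)
open import Relation.Binary.PropositionalEquality using (_≡_; _≢_; refl)
open import Function using (_∘_; _⇔_)
open import Level using (Level) renaming (suc to lsuc; zero to lzero)

record Graph (n : ℕ) : Set where
  field
    adj    : Fin n → Fin n → Bool
    sym    : ∀ u v → adj u v ≡ adj v u
    irrefl : ∀ u → adj u u ≡ false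

open Graph public

Adj : ∀ {n} → Graph n → Fin n → Fin n → Set
Adj G u v = T (adj G u v)

data Reach {n : ℕ} (G : Graph n) (P : Fin n → Set) : Fin n → Fin n → Set where
  here : ∀ {u} → P u → Reach G P u u
  step : ∀ {u w v} → Reach G P u w → Adj G w v → P v → Reach G P u v

Connected : ∀ {n} → Graph n → Set
Connected G = ∀ u v → Reach G (λ _ → ⊤) u v

-- x is a cut vertex (of a connected graph): G - x is disconnected, i.e.
-- two vertices other than x are not joined by any path avoiding x.
CutVertex : ∀ {n} → Graph n → Fin n → Set
CutVertex G x = Σ _ λ u → Σ _ λ v →
  u ≢ x × v ≢ x × ¬ Reach G (λ z → z ≢ x) u v

record Cycle {n : ℕ} (G : Graph n) : Set where
  field
    len   : ℕ
    vtx   : Fin (suc (suc (suc len))) → Fin n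
    inj   : ∀ i j → vtx i ≡ vtx j → i ≡ j
    edges : ∀ (i : Fin (suc (suc len))) → Adj G (vtx (inject₁ i)) (vtx (suc i))
    close : Adj G (vtx (fromℕ (suc (suc len)))) (vtx zero)

open Cycle public

SameEdge : ∀ {n} → Fin n → Fin n → Fin n → Fin n → Set
SameEdge a b p q = (a ≡ p × b ≡ q) ⊎ (a ≡ q × b ≡ p)

CycleEdge : ∀ {n} {G : Graph n} → Cycle G → Fin n → Fin n → Set
CycleEdge c a b =
  (Σ (Fin (suc (suc (len c)))) λ i → SameEdge a b (vtx c (inject₁ i)) (vtx c (suc i)))
  ⊎ SameEdge a b (vtx c (fromℕ (suc (suc (len c))))) (vtx c zero)

-- two cycles are the same subgraph iff they have the same edge set
SameCycle : ∀ {n} {G : Graph n} → Cycle G → Cycle G → Set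
SameCycle c d = ∀ a b → (CycleEdge c a b ⇔ CycleEdge d a b)

AtMostOneCommon : ∀ {n} {G : Graph n} → Cycle G → Cycle G → Set
AtMostOneCommon c d = ∀ i j i' j' →
  vtx c i ≡ vtx d j → vtx c i' ≡ vtx d j' → vtx c i ≡ vtx c i'

Cactus : ∀ {n} → Graph n → Set
Cactus G = Connected G × (∀ (c d : Cycle G) → ¬ SameCycle c d → AtMostOneCommon c d)

plusAdj : ∀ {n} → Graph n → Fin n → Fin (suc n) → Fin (suc n) → Bool
plusAdj G x zero    zero    = false
plusAdj G x zero    (suc v) = ⌊ v ≟ x ⌋
plusAdj G x (suc u) zero    = ⌊ u ≟ x ⌋
plusAdj G x (suc u) (suc v) = adj G u v

plusSym : ∀ {n} (G : Graph n) x u v → plusAdj G x u v ≡ plusAdj G x v u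
plusSym G x zero    zero    = refl
plusSym G x zero    (suc v) = refl
plusSym G x (suc u) zero    = refl
plusSym G x (suc u) (suc v) = sym G u v

plusIrrefl : ∀ {n} (G : Graph n) x u → plusAdj G x u u ≡ false
plusIrrefl G x zero    = refl
plusIrrefl G x (suc u) = irrefl G u

plus : ∀ {n} → Graph n → Fin n → Graph (suc n)
plus G x = record { adj = plusAdj G x ; sym = plusSym G x ; irrefl = plusIrrefl G x }

∑ : ∀ {n} → (Fin n → ℕ) → ℕ
∑ {zero}  f = 0
∑ {suc n} f = f zero + ∑ (f ∘ suc)

data Version : Set where
  multi  : Version
  single : Version

-- a configuration: number of guards on each vertex
Config : ℕ → Set
Config n = Fin n → ℕ

ValidConfig : ∀ {n} → Version → Config n → Set
ValidConfig multi  C = ⊤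
ValidConfig single C = ∀ v → C v ≤ 1

-- A reconfiguration from C to C' defending the attacked edge uv:
-- f a b guards move from a to b (staying if a = b); guards only stay or
-- move along edges; at least one guard traverses the edge uv.
Move : ∀ {n} → Graph n → Config n → Config n → Fin n → Fin n → Set
Move {n} G C C' u v = Σ (Fin n → Fin n → ℕ) λ f →
    (∀ a b → 1 ≤ f a b → a ≡ b ⊎ Adj G a b)
  × (∀ a → ∑ (f a) ≡ C a)
  × (∀ b → ∑ (λ a → f a b) ≡ C' b)
  × (1 ≤ f u v ⊎ 1 ≤ f v u)

IsEVCClass : ∀ {n} → Version → Graph n → (Config n → Set) → Set
IsEVCClass {n} V G Cls =
    (Σ (Config n) Cls)
  × (∀ C → Cls C → ValidConfig V C)
  × (∀ C → Cls C → ∀ u v → Adj G u v → Σ (Config n) λ C' → Cls C' × Move G C C' u v)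

DefenseWith : ∀ {n} → Version → Graph n → ℕ → Set₁
DefenseWith {n} V G k = Σ (Config n → Set) λ Cls →
  IsEVCClass V G Cls × (∀ C → Cls C → ∑ C ≡ k)

DefenseWithAt : ∀ {n} → Version → Graph n → Fin n → ℕ → Set₁
DefenseWithAt {n} V G x k = Σ (Config n → Set) λ Cls →
  IsEVCClass V G Cls × (∀ C → Cls C → ∑ C ≡ k) × (∀ C → Cls C → 1 ≤ C x)

IsEvc : ∀ {n} → Version → Graph n → ℕ → Set₁
IsEvc V G k = DefenseWith V G k × (∀ k' → DefenseWith V G k' → k ≤ k')

IsEvcAt : ∀ {n} → Version → Graph n → Fin n → ℕ → Set₁
IsEvcAt V G x k = DefenseWithAt V G x k × (∀ k' → DefenseWithAt V G x k' → k ≤ k')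

EternalVC : ∀ {n} → Version → Graph n → Config n → Set₁
EternalVC {n} V G C = Σ (Config n → Set) λ Cls → IsEVCClass V G Cls × Cls C

-- G' (connected) is an x-extension of G via the embedding φ : V(G) → V(G'):
-- φ is an isomorphism of G onto the induced subgraph G'[V(H) ∪ {φ x}],
-- where φ x is a cut vertex of G' and H is a component of G' - φ x,
-- namely V(H) = φ(V(G)) ∖ {φ x}.
IsXExtension : ∀ {n m} → Graph n → Fin n → Graph m → (Fin n → Fin m) → Set
IsXExtension {n} {m} G x G' φ =
    (∀ u v → φ u ≡ φ v → u ≡ v)
  × (∀ u v → adj G' (φ u) (φ v) ≡ adj G u v)
  × Connected G'
  × CutVertex G' (φ x)
  × (Σ (Fin m) S)
  × (∀ w₁ w₂ → S w₁ → (S w₂ ⇔ Reach G' (λ z → z ≢ φ x) w₁ w₂))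
  where
    S : Fin m → Set
    S w = (Σ (Fin n) λ v → φ v ≡ w) × w ≢ φ x

SubstructureProperty : ∀ {n} → Version → Graph n → Set₁
SubstructureProperty {n} V G =
  ∀ (x : Fin n) → ¬ CutVertex G x →
  ∀ (m : ℕ) (G' : Graph m) (φ : Fin n → Fin m) → IsXExtension G x G' φ →
  ∀ (a b : ℕ) → IsEvc V (plus G x) a → IsEvcAt V G x b →
    (a ≤ b → ∀ C' → EternalVC V G' C' → b ∸ 1 ≤ ∑ (C' ∘ φ))
  × (b < a → ∀ C' → EternalVC V G' C' → b ≤ ∑ (C' ∘ φ))

-- The guards needed on a part K of the cactus hanging at a vertex y are computed along the blocks.  On a block
-- through y, call a vertex heavy if a further part hangs at it, and light otherwise.  A heavy vertex whose
-- hanging part needs q guards contributes q + 1, and L light vertices contribute ⌊L / 2⌋; p is the sum.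
--
-- Every configuration of every class has at least p guards on K: otherwise a shortest segment of the block with
-- too few guards starts and ends with empty light vertices, no guard can enter what lies between them, and an
-- attack on the edge leading into it drives a guard out.  For the same reason there are p + 1 guards on K and y.
--
-- Conversely, p guards on K besides one on y defend every attack, if sometimes an additional guard may be drawn
-- through y: heavy vertices stay occupied and the light ones are occupied alternately, so that an attack is
-- answered by moving guards between consecutive light vertices.  If no additional guard is ever drawn, then
-- evcₓ(G) ≤ p + 1; otherwise evcₓ(G) ≤ p + 2, and the additional guard can be kept on the pendant vertex,
-- whence evc(Gₓ⁺) ≤ p + 2.  Both cases imply the two inequalities of the substructure property.
module Submission where

open import Defs
open import Algebra.Properties.CommutativeSemigroup using (interchange)
open import Data.Bool using (Bool; true; false; T; if_then_else_; not; _∧_; _xor_)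
open import Data.Bool.Properties using (not-involutive)
open import Data.Empty using (⊥; ⊥-elim)
open import Data.Fin using (Fin; zero; suc; inject₁; fromℕ; _≟_)
open import Data.Fin.Properties using (any?; suc-injective)
open import Data.List using (List; []; _∷_; _++_; [_]; map; reverse; lookup; length)
open import Data.List.Properties using (map-++; ++-assoc; ++-identityʳ; unfold-reverse; reverse-++; reverse-involutive; ∷-injective; length-++)
open import Data.List.Membership.Propositional using (_∈_; _∉_)
open import Data.List.Membership.Propositional.Properties using (∈-++⁺ˡ; ∈-++⁺ʳ; ∈-++⁻; ∈-∃++; ∈-lookup)
open import Data.List.Relation.Unary.All using (All; []; _∷_)
import Data.List.Relation.Unary.All as All
open import Data.List.Relation.Unary.Any using (here; there)
open import Data.List.Relation.Unary.AllPairs using ([]; _∷_)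
open import Data.List.Relation.Unary.Unique.Propositional using (Unique)
open import Data.List.Relation.Binary.Permutation.Propositional using (_↭_; ↭-sym; prep)
open import Data.List.Relation.Binary.Permutation.Propositional.Properties using (∈-resp-↭; ++-comm; ↭-reverse)
open import Data.Nat using (ℕ; zero; suc; _+_; _∸_; _*_; _≤_; _<_; z≤n; s≤s)
open import Data.Nat.Properties hiding (_≟_; suc-injective)
open import Data.Product using (Σ; ∃; _×_; _,_; proj₁; proj₂)
open import Data.Sum using (_⊎_; inj₁; inj₂; [_,_]′)
open import Data.Unit using (⊤; tt)
open import Function using (_∘_; id; case_of_; Equivalence)
open import Relation.Nullary using (¬_; Dec; yes; no; contradiction)
open import Relation.Nullary.Decidable using (⌊_⌋; toWitness; fromWitness; decidable-stable)
import Relation.Binary.PropositionalEquality as ≡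
open import Relation.Binary.PropositionalEquality
  using (_≡_; _≢_; refl; trans; cong; cong₂; subst; module ≡-Reasoning) renaming (sym to ≡sym)

-- `Solved` carries one number `p` together with both the lower bound and the strategy, since both
-- follow the same recursion. The lower bound sees the class of `G'` only through its restriction to
-- `G`, where guards may appear or vanish at `x`; hence `escape` is applied to regions without `x`.
-- It concerns all configurations of the class at once, because an attack on one leads to another.
--
-- Parity is the obstacle to the strategy. Light vertices are paired along the block, one guard per
-- pair. If one of them remains unpaired, shifting the pairs may take an additional guard from
-- elsewhere, and so may an attack inside a hanging part. State `B` records where that guard is;
-- parts at a common vertex share one. At most one guard stands on each vertex, so the strategies
-- serve both versions.
--
-- Whether the additional guard can ever be drawn is not decided; the inequalities are decidable, so
-- a double negation suffices. They follow by counting: `G` holds at least p + 1 guards, so evcₓ(G)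
-- ≤ p + 2 gives the first one, and evcₓ(G) < evc(Gₓ⁺) ≤ p + 2 gives evcₓ(G) ≤ p + 1.

zero-or-positive : ∀ k → k ≡ 0 ⊎ 1 ≤ k
zero-or-positive zero = inj₁ refl
zero-or-positive (suc k) = inj₂ (s≤s z≤n)

-- Sums over finite sets

δ : ∀ {n} → Fin n → Fin n → ℕ
δ u v = if ⌊ u ≟ v ⌋ then 1 else 0

δ-refl : ∀ {n} (u : Fin n) → δ u u ≡ 1
δ-refl u with u ≟ u
... | yes _ = refl
... | no u≢u = contradiction refl u≢u

δ-≢ : ∀ {n} {u v : Fin n} → u ≢ v → δ u v ≡ 0
δ-≢ {u = u} {v} u≢v with u ≟ v
... | yes u≡v = contradiction u≡v u≢v
... | no _ = refl

∑-cong : ∀ {n} {f g : Fin n → ℕ} → (∀ a → f a ≡ g a) → ∑ f ≡ ∑ g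
∑-cong {zero} eq = refl
∑-cong {suc n} eq = cong₂ _+_ (eq zero) (∑-cong (eq ∘ suc))

∑-mono : ∀ {n} {f g : Fin n → ℕ} → (∀ a → f a ≤ g a) → ∑ f ≤ ∑ g
∑-mono {zero} le = z≤n
∑-mono {suc n} le = +-mono-≤ (le zero) (∑-mono (le ∘ suc))

∑-zero : ∀ n → ∑ {n} (λ _ → 0) ≡ 0
∑-zero zero = refl
∑-zero (suc n) = ∑-zero n

∑-+ : ∀ {n} (f g : Fin n → ℕ) → ∑ (λ a → f a + g a) ≡ ∑ f + ∑ g
∑-+ {zero} f g = refl
∑-+ {suc n} f g = trans (cong (f zero + g zero +_) (∑-+ (f ∘ suc) (g ∘ suc)))
  (interchange +-commutativeSemigroup (f zero) (g zero) _ _)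

∑-swap : ∀ {m n} (f : Fin m → Fin n → ℕ) → ∑ (λ a → ∑ (f a)) ≡ ∑ (λ b → ∑ (λ a → f a b))
∑-swap {zero} {n} f = ≡sym (∑-zero n)
∑-swap {suc m} f = trans (cong (∑ (f zero) +_) (∑-swap (f ∘ suc))) (≡sym (∑-+ (f zero) _))

∑-supported : ∀ {n} (u : Fin n) {f : Fin n → ℕ} → (∀ v → v ≢ u → f v ≡ 0) → ∑ f ≡ f u
∑-supported {suc n} zero {f} eq = trans (cong (f zero +_)
  (trans (∑-cong (λ v → eq (suc v) λ ())) (∑-zero n))) (+-identityʳ _)
∑-supported (suc u) {f} eq = cong₂ _+_ (eq zero λ ())
  (∑-supported u (λ v v≢u → eq (suc v) (v≢u ∘ suc-injective)))

term≤∑ : ∀ {n} (f : Fin n → ℕ) u → f u ≤ ∑ f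
term≤∑ f zero = m≤m+n _ _
term≤∑ f (suc u) = ≤-trans (term≤∑ (f ∘ suc) u) (m≤n+m _ _)

∑-δ : ∀ {n} (u : Fin n) → ∑ (δ u) ≡ 1
∑-δ u = trans (∑-supported u (λ v v≢u → δ-≢ (v≢u ∘ ≡sym))) (δ-refl u)

∑-* : ∀ {n} (g : Fin n → ℕ) c → ∑ (λ v → g v * c) ≡ ∑ g * c
∑-* {zero} g c = refl
∑-* {suc n} g c = trans (cong (g zero * c +_) (∑-* (g ∘ suc) c)) (≡sym (*-distribʳ-+ c (g zero) _))

module _ {n m} (φ : Fin n → Fin m) (φ-inj : ∀ u v → φ u ≡ φ v → u ≡ v) (f : Fin m → ℕ) where

  private
    -- The number of preimages of `w`, at most 1 by injectivity; it turns a sum over `Fin n` into a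
    -- weighted sum over `Fin m`.
    ind : Fin m → ℕ
    ind w = ∑ (λ v → δ (φ v) w)

    ind-image : ∀ v → ind (φ v) ≡ 1
    ind-image v = trans
      (∑-supported v (λ u u≢v → δ-≢ (u≢v ∘ φ-inj u v))) (δ-refl (φ v))

    ind≤1 : ∀ w → ind w ≤ 1
    ind≤1 w with any? (λ v → φ v ≟ w)
    ... | yes (v , refl) = ≤-reflexive (ind-image v)
    ... | no ∄v = ≤-trans (≤-reflexive (trans (∑-cong (λ v → δ-≢ (λ e → ∄v (v , e)))) (∑-zero n))) z≤n

    ∑-image : ∑ (λ v → f (φ v)) ≡ ∑ (λ w → ind w * f w)
    ∑-image = trans (∑-cong λ v → ≡sym (trans
        (∑-supported (φ v) (λ w w≢ → cong (_* f w) (δ-≢ (w≢ ∘ ≡sym))))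
        (trans (cong (_* f (φ v)) (δ-refl (φ v))) (*-identityˡ _))))
      (trans (∑-swap (λ v w → δ (φ v) w * f w)) (∑-cong λ w → ∑-* (λ v → δ (φ v) w) (f w)))

  ∑-inj-≤ : ∑ (λ v → f (φ v)) ≤ ∑ f
  ∑-inj-≤ = ≤-trans (≤-reflexive ∑-image)
    (∑-mono λ w → ≤-trans (*-monoˡ-≤ (f w) (ind≤1 w)) (≤-reflexive (*-identityˡ _)))

  ∑-inj-≡ : (∀ w → 1 ≤ f w → ∃ λ v → φ v ≡ w) → ∑ (λ v → f (φ v)) ≡ ∑ f
  ∑-inj-≡ onto = trans ∑-image (∑-cong pointwise)
    where
    pointwise : ∀ w → ind w * f w ≡ f w
    pointwise w with f w in eq
    ... | zero = *-zeroʳ (ind w)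
    ... | suc k with onto w (subst (1 ≤_) (≡sym eq) (s≤s z≤n))
    ...   | v , refl = trans (cong (_* suc k) (ind-image v)) (*-identityˡ _)

∑[_]_ : ∀ {n} → (Fin n → Bool) → (Fin n → ℕ) → ℕ
∑[ K ] f = ∑ (λ a → if K a then f a else 0)

∑[]-mono : ∀ {n} (K : Fin n → Bool) {f g : Fin n → ℕ} → (∀ a → T (K a) → f a ≤ g a) → ∑[ K ] f ≤ ∑[ K ] g
∑[]-mono K {f} {g} le = ∑-mono pointwise
  where
  pointwise : ∀ a → (if K a then f a else 0) ≤ (if K a then g a else 0)
  pointwise a with K a in eq
  ... | true = le a (subst T (≡sym eq) tt)
  ... | false = z≤n

∑[]-cong : ∀ {n} (K : Fin n → Bool) {f g : Fin n → ℕ} → (∀ a → T (K a) → f a ≡ g a) → ∑[ K ] f ≡ ∑[ K ] g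
∑[]-cong K eq = ≤-antisym (∑[]-mono K (λ a Ka → ≤-reflexive (eq a Ka)))
  (∑[]-mono K (λ a Ka → ≤-reflexive (≡sym (eq a Ka))))

∑[]-empty : ∀ {n} (K : Fin n → Bool) (f : Fin n → ℕ) → (∀ a → ¬ T (K a)) → ∑[ K ] f ≡ 0
∑[]-empty {n} K f empty = trans (∑-cong pointwise) (∑-zero n)
  where
  pointwise : ∀ a → (if K a then f a else 0) ≡ 0
  pointwise a with K a in eq
  ... | true = contradiction (subst T (≡sym eq) tt) (empty a)
  ... | false = refl

record Split {n} (K K₁ K₂ : Fin n → Bool) : Set where
  field
    into : ∀ a → T (K a) → T (K₁ a) ⊎ T (K₂ a)
    left : ∀ a → T (K₁ a) → T (K a)
    right : ∀ a → T (K₂ a) → T (K a)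
    apart : ∀ a → T (K₁ a) → ¬ T (K₂ a)

∑[]-split : ∀ {n} {K K₁ K₂ : Fin n → Bool} → Split K K₁ K₂ → (f : Fin n → ℕ) →
  ∑[ K ] f ≡ ∑[ K₁ ] f + ∑[ K₂ ] f
∑[]-split {K = K} {K₁} {K₂} s f = trans (∑-cong pointwise) (∑-+ (λ a → if K₁ a then f a else 0) (λ a → if K₂ a then f a else 0))
  where
  open Split s
  pointwise : ∀ a → (if K a then f a else 0) ≡ (if K₁ a then f a else 0) + (if K₂ a then f a else 0)
  pointwise a with K a | K₁ a | K₂ a | into a | left a | right a | apart a
  ... | _     | true  | true  | _ | _ | _ | d = contradiction tt (d tt)
  ... | true  | true  | false | _ | _ | _ | _ = ≡sym (+-identityʳ _)
  ... | false | true  | false | _ | l | _ | _ = ⊥-elim (l tt)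
  ... | true  | false | true  | _ | _ | _ | _ = refl
  ... | false | false | true  | _ | _ | r | _ = ⊥-elim (r tt)
  ... | true  | false | false | i | _ | _ | _ = [ (λ ()) , (λ ()) ]′ (i tt)
  ... | false | false | false | _ | _ | _ | _ = refl

∑[]-point : ∀ {n} {K : Fin n → Bool} {z : Fin n} → T (K z) → (∀ a → T (K a) → a ≡ z) →
  (f : Fin n → ℕ) → ∑[ K ] f ≡ f z
∑[]-point {K = K} {z} Kz only f = trans (∑-supported z off) on
  where
  off : ∀ v → v ≢ z → (if K v then f v else 0) ≡ 0
  off v v≢z with K v | only v
  ... | true  | o = contradiction (o tt) v≢z
  ... | false | _ = refl
  on : (if K z then f z else 0) ≡ f z
  on with K z
  ... | true = refl
  ... | false = ⊥-elim Kz

-- Lists as paths and as closed walks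

module Sequences where

  private variable
    A : Set
    u v w : A
    xs ys zs : List A

  data Consec {A : Set} : List A → A → A → Set where
    here : Consec (u ∷ v ∷ xs) u v
    there : Consec xs u v → Consec (w ∷ xs) u v

  Consec-++ˡ : Consec xs u v → Consec (xs ++ ys) u v
  Consec-++ˡ here = here
  Consec-++ˡ (there c) = there (Consec-++ˡ c)

  Consec-++ʳ : ∀ (xs : List A) → Consec ys u v → Consec (xs ++ ys) u v
  Consec-++ʳ [] c = c
  Consec-++ʳ (x ∷ xs) c = there (Consec-++ʳ xs c)

  Consec-split : ∀ (xs : List A) → Consec (xs ++ w ∷ ys) u v →
    Consec (xs ++ [ w ]) u v ⊎ Consec (w ∷ ys) u v
  Consec-split [] c = inj₂ c
  Consec-split (x ∷ []) here = inj₁ here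
  Consec-split (x ∷ x' ∷ xs) here = inj₁ here
  Consec-split (x ∷ xs) (there c) with Consec-split xs c
  ... | inj₁ c' = inj₁ (there c')
  ... | inj₂ c' = inj₂ c'

  Consec-∈ : Consec {A} xs u v → u ∈ xs × v ∈ xs
  Consec-∈ here = here refl , there (here refl)
  Consec-∈ (there c) = there (proj₁ (Consec-∈ c)) , there (proj₂ (Consec-∈ c))

  Consec-snoc : ∀ (xs : List A) → Consec (xs ++ u ∷ [ v ]) u v
  Consec-snoc xs = Consec-++ʳ xs here

  Consec-reverse : Consec {A} xs u v → Consec (reverse xs) v u
  Consec-reverse {xs = u ∷ v ∷ xs} here
    rewrite unfold-reverse u (v ∷ xs) | unfold-reverse v xs | ++-assoc (reverse xs) [ v ] [ u ]
    = Consec-snoc (reverse xs)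
  Consec-reverse {xs = w ∷ xs} (there c) rewrite unfold-reverse w xs = Consec-++ˡ (Consec-reverse c)

  Consec-drop : ∀ (xs : List A) → u ∉ xs → Consec (xs ++ ys) u v → Consec ys u v
  Consec-drop [] u∉ c = c
  Consec-drop (x ∷ []) u∉ here = contradiction (here refl) u∉
  Consec-drop (x ∷ x' ∷ xs) u∉ here = contradiction (here refl) u∉
  Consec-drop (x ∷ xs) u∉ (there c) = Consec-drop xs (u∉ ∘ there) c

  Consec-after : ∀ (xs : List A) → u ∉ w ∷ ys → Consec (xs ++ w ∷ ys) u v → v ∈ xs ++ [ w ]
  Consec-after [] u∉ c = contradiction (proj₁ (Consec-∈ c)) u∉
  Consec-after (x ∷ []) u∉ here = there (here refl)
  Consec-after (x ∷ x' ∷ xs) u∉ here = there (here refl)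
  Consec-after (x ∷ xs) u∉ (there c) = there (Consec-after xs u∉ c)

  Consec-drop′ : ∀ (xs : List A) → v ∉ xs → v ≢ w → Consec (xs ++ w ∷ ys) u v → Consec (w ∷ ys) u v
  Consec-drop′ [] v∉ v≢w c = c
  Consec-drop′ (x ∷ []) v∉ v≢w here = contradiction refl v≢w
  Consec-drop′ (x ∷ x' ∷ xs) v∉ v≢w here = contradiction (there (here refl)) v∉
  Consec-drop′ (x ∷ xs) v∉ v≢w (there c) = Consec-drop′ xs (v∉ ∘ there) v≢w c

  Consec-before : ∀ {y : A} (xs : List A) → v ∉ y ∷ ys → Consec (w ∷ xs ++ y ∷ ys) u v → u ∈ w ∷ xs
  Consec-before [] v∉ here = contradiction (here refl) v∉
  Consec-before [] v∉ (there c) = contradiction (proj₂ (Consec-∈ c)) v∉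
  Consec-before (x ∷ xs) v∉ here = here refl
  Consec-before (x ∷ xs) v∉ (there c) = there (Consec-before xs v∉ c)

  -- The closed walk through the vertices of xs.
  cl : List A → List A
  cl [] = []
  cl (x ∷ xs) = x ∷ xs ++ [ x ]

  cl-∈ : ∀ {z : A} → z ∈ cl zs → z ∈ zs
  cl-∈ {zs = x ∷ xs} (here e) = here e
  cl-∈ {zs = x ∷ xs} (there z∈) with ∈-++⁻ xs z∈
  ... | inj₁ z∈xs = there z∈xs
  ... | inj₂ (here e) = here e

  Consec-rotate : ∀ (x : A) xs → Consec (cl (x ∷ xs)) u v → Consec (cl (xs ++ [ x ])) u v
  Consec-rotate x [] c = c
  Consec-rotate x (x' ∷ xs) here
    rewrite ++-assoc xs [ x ] [ x' ] = Consec-snoc (x' ∷ xs)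
  Consec-rotate x (x' ∷ xs) (there c) = Consec-++ˡ c

  Consec-unrotate : ∀ (x : A) xs → Consec (cl (xs ++ [ x ])) u v → Consec (cl (x ∷ xs)) u v
  Consec-unrotate x [] c = c
  Consec-unrotate x (x' ∷ xs) c
    with Consec-split (x' ∷ xs) (subst (λ l → Consec (x' ∷ l) _ _) (++-assoc xs [ x ] [ x' ]) c)
  ... | inj₁ c' = there c'
  ... | inj₂ here = here
  ... | inj₂ (there (there ()))

  cl-reverse : ∀ (x : A) xs → reverse (cl (x ∷ xs)) ≡ cl (x ∷ reverse xs)
  cl-reverse x xs = begin
    reverse (x ∷ xs ++ [ x ])        ≡⟨ unfold-reverse x (xs ++ [ x ]) ⟩
    reverse (xs ++ [ x ]) ++ [ x ]   ≡⟨ cong (_++ [ x ]) (reverse-++ xs [ x ]) ⟩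
    x ∷ reverse xs ++ [ x ]          ∎
    where open ≡-Reasoning

  Consec-cl-reverse : ∀ (x : A) xs → Consec (cl (x ∷ xs)) u v → Consec (cl (x ∷ reverse xs)) v u
  Consec-cl-reverse x xs c = subst (λ l → Consec l _ _) (cl-reverse x xs) (Consec-reverse c)

  Unique-++ : ∀ (xs : List A) → Unique (xs ++ ys) → ∀ {z} → z ∈ xs → z ∉ ys
  Unique-++ (x ∷ xs) (x∉ ∷ _) (here refl) z∈ = All.lookup x∉ (∈-++⁺ʳ xs z∈) refl
  Unique-++ (x ∷ xs) (_ ∷ un) (there z∈xs) z∈ = Unique-++ xs un z∈xs z∈

  Unique-++ʳ : ∀ (xs : List A) → Unique (xs ++ ys) → Unique ys
  Unique-++ʳ [] un = un
  Unique-++ʳ (x ∷ xs) (_ ∷ un) = Unique-++ʳ xs un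

  Unique-++ˡ : ∀ (xs : List A) → Unique (xs ++ ys) → Unique xs
  Unique-++ˡ [] un = []
  Unique-++ˡ (x ∷ xs) (x∉ ∷ un) = All.tabulate (λ z∈ → All.lookup x∉ (∈-++⁺ˡ z∈)) ∷ Unique-++ˡ xs un

  Unique-head : ∀ {x : A} → Unique (x ∷ xs) → x ∉ xs
  Unique-head (x∉ ∷ _) x∈ = All.lookup x∉ x∈ refl

  -- In a closed walk, an entry with a successor lies before the repeated last entry; its successor
  -- is the next vertex of the list or the vertex that closes the walk.
  snoc-split : ∀ (xs : List A) {ys x z zs} → xs ++ [ x ] ≡ ys ++ z ∷ w ∷ zs →
    ∃ λ zs' → xs ≡ ys ++ z ∷ zs' × zs' ++ [ x ] ≡ w ∷ zs
  snoc-split [] {[]} ()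
  snoc-split [] {_ ∷ []} ()
  snoc-split [] {_ ∷ _ ∷ _} ()
  snoc-split (x ∷ xs) {[]} eq with ∷-injective eq
  ... | refl , eq' = xs , refl , eq'
  snoc-split (x ∷ xs) {y ∷ ys} eq with ∷-injective eq
  ... | refl , eq' with snoc-split xs eq'
  ...   | zs' , refl , eq'' = zs' , refl , eq''

  Consec-∃++ : Consec {A} xs u v → ∃ λ ys → ∃ λ zs → xs ≡ ys ++ u ∷ v ∷ zs
  Consec-∃++ here = [] , _ , refl
  Consec-∃++ {xs = x ∷ xs} (there c) with Consec-∃++ c
  ... | ys , zs , refl = x ∷ ys , zs , refl

open Sequences

-- Partial reconfigurations as lists of moves

# : ∀ {n} → Fin n → List (Fin n) → ℕ
# a [] = 0
# a (u ∷ us) = δ u a + # a us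

#-++ : ∀ {n} (a : Fin n) us {vs} → # a (us ++ vs) ≡ # a us + # a vs
#-++ a [] = refl
#-++ a (u ∷ us) = trans (cong (δ u a +_) (#-++ a us)) (≡sym (+-assoc (δ u a) _ _))

module Flows {n : ℕ} (G : Graph n) where

  V : Set
  V = Fin n

  Adj-sym : ∀ {u v} → Adj G u v → Adj G v u
  Adj-sym {u} {v} = subst T (Defs.sym G u v)

  Adj-≢ : ∀ {u v} → Adj G u v → u ≢ v
  Adj-≢ {u} uv refl = subst T (irrefl G u) uv

  count : (V × V → V) → List V → List (V × V) → V → ℕ
  count p U F a = # a U + # a (map p F)

  count-++ : ∀ (p : V × V → V) a U (F : List (V × V)) {U' F'} →
    count p (U ++ U') (F ++ F') a ≡ count p U F a + count p U' F' a
  count-++ p a U F {U'} {F'} = begin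
    # a (U ++ U') + # a (map p (F ++ F'))
      ≡⟨ cong₂ _+_ (#-++ a U) (trans (cong (# a) (map-++ p F F')) (#-++ a (map p F))) ⟩
    (# a U + # a U') + (# a (map p F) + # a (map p F'))
      ≡⟨ interchange +-commutativeSemigroup (# a U) (# a U') _ _ ⟩
    (# a U + # a (map p F)) + (# a U' + # a (map p F')) ∎
    where open ≡-Reasoning

  -- A partial reconfiguration of the guards on the region R: guards move along the edges in F,
  -- guards leave the vertices in O and arrive at the vertices in I along edges not yet specified,
  -- the edges in X are defended, and P holds of every configuration that agrees with the outcome on R.
  record Tr (R : V → Set) (C : Config n) (P : Config n → Set) (O I : List V) (X : List (V × V)) : Set where
    field
      F : List (V × V)
      legal : ∀ {u v} → (u , v) ∈ F → Adj G u v
      supp : ∀ a → ¬ R a → count proj₁ O F a ≡ 0 × count proj₂ I F a ≡ 0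
      cap : ∀ a → R a → count proj₁ O F a ≤ C a
      hit : ∀ {u v} → (u , v) ∈ X → (u , v) ∈ F ⊎ (v , u) ∈ F
      tgt : ∀ C' → (∀ a → R a → C' a + count proj₁ O F a ≡ C a + count proj₂ I F a) → P C'
    outs ins : V → ℕ
    outs = count proj₁ O F
    ins = count proj₂ I F

  private variable
    R R' R₁ R₂ : V → Set
    C : Config n
    P P' P₁ P₂ : Config n → Set
    O I O₁ O₂ I₁ I₂ : List V
    X X' X₁ X₂ : List (V × V)
    u v : V

  map-tgt : (∀ C' → P C' → P' C') → Tr R C P O I X → Tr R C P' O I X
  map-tgt f t = record { Tr t ; tgt = λ C' e → f C' (Tr.tgt t C' e) }

  map-region : (∀ a → R a → R' a) → (∀ a → R' a → R a) → Tr R C P O I X → Tr R' C P O I X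
  map-region to from t = record
    { F = F ; legal = legal ; hit = hit
    ; supp = λ a ¬R' → supp a (¬R' ∘ to a)
    ; cap = λ a R'a → cap a (from a R'a)
    ; tgt = λ C' e → tgt C' (λ a Ra → e a (to a Ra)) }
    where open Tr t

  map-hit : (∀ {e} → e ∈ X' → e ∈ X) → Tr R C P O I X → Tr R C P O I X'
  map-hit sub t = record { Tr t ; hit = λ e∈ → Tr.hit t (sub e∈) }

  idle : (∀ C' → (∀ a → R a → C' a ≡ C a) → P C') → Tr R C P [] [] []
  idle p = record
    { F = [] ; legal = λ () ; hit = λ ()
    ; supp = λ _ _ → refl , refl
    ; cap = λ _ _ → z≤n
    ; tgt = λ C' e → p C' (λ a Ra → trans (≡sym (+-identityʳ _)) (trans (e a Ra) (+-identityʳ _))) }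

  _⊎R_ : (V → Set) → (V → Set) → V → Set
  (R₁ ⊎R R₂) a = R₁ a ⊎ R₂ a

  infixr 4 _⊗_
  _⊗_ : (Config n → Set) → (Config n → Set) → Config n → Set
  (P ⊗ Q) C = P C × Q C

  -- By `supp` the traffic of each part vanishes on the region of the other, so the balance equation
  -- of the union restricts to that of either part.
  compose : (∀ a → R₁ a → ¬ R₂ a) → Tr R₁ C P₁ O₁ I₁ X₁ → Tr R₂ C P₂ O₂ I₂ X₂ →
    Tr (R₁ ⊎R R₂) C (P₁ ⊗ P₂) (O₁ ++ O₂) (I₁ ++ I₂) (X₁ ++ X₂)
  compose {R₁} {R₂} {C} {O₁ = O₁} {I₁} {X₁} {O₂ = O₂} {I₂} apart s t = record
    { F = S.F ++ T'.F
    ; legal = λ e∈ → [ S.legal , T'.legal ]′ (∈-++⁻ S.F e∈)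
    ; supp = λ a ¬R → let (so , si) = S.supp a (¬R ∘ inj₁) ; (to , ti) = T'.supp a (¬R ∘ inj₂) in
        trans (os a) (cong₂ _+_ so to) , trans (is a) (cong₂ _+_ si ti)
    ; cap = λ { a (inj₁ Ra) → ≤-trans (≤-reflexive (only₁ (os a) (proj₁ (T'.supp a (apart a Ra))))) (S.cap a Ra)
              ; a (inj₂ Ra) → ≤-trans (≤-reflexive (only₂ (os a) (proj₁ (S.supp a (λ R₁a → apart a R₁a Ra))))) (T'.cap a Ra) }
    ; hit = λ e∈ → [ (λ e∈₁ → [ inj₁ ∘ ∈-++⁺ˡ , inj₂ ∘ ∈-++⁺ˡ ]′ (S.hit e∈₁))
                   , (λ e∈₂ → [ inj₁ ∘ ∈-++⁺ʳ S.F , inj₂ ∘ ∈-++⁺ʳ S.F ]′ (T'.hit e∈₂)) ]′ (∈-++⁻ X₁ e∈)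
    ; tgt = λ C' e →
        S.tgt C' (λ a Ra → trans (cong (C' a +_) (≡sym (only₁ (os a) (proj₁ (T'.supp a (apart a Ra))))))
          (trans (e a (inj₁ Ra)) (cong (C a +_) (only₁ (is a) (proj₂ (T'.supp a (apart a Ra))))))) ,
        T'.tgt C' (λ a Ra → trans (cong (C' a +_) (≡sym (only₂ (os a) (proj₁ (S.supp a (λ R₁a → apart a R₁a Ra))))))
          (trans (e a (inj₂ Ra)) (cong (C a +_) (only₂ (is a) (proj₂ (S.supp a (λ R₁a → apart a R₁a Ra)))))))
    }
    where
    module S = Tr s
    module T' = Tr t
    os : ∀ a → count proj₁ (O₁ ++ O₂) (S.F ++ T'.F) a ≡ S.outs a + T'.outs a
    os a = count-++ proj₁ a O₁ S.F
    is : ∀ a → count proj₂ (I₁ ++ I₂) (S.F ++ T'.F) a ≡ S.ins a + T'.ins a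
    is a = count-++ proj₂ a I₁ S.F
    only₁ : ∀ {h f g : ℕ} → h ≡ f + g → g ≡ 0 → h ≡ f
    only₁ eq refl = trans eq (+-identityʳ _)
    only₂ : ∀ {h f g : ℕ} → h ≡ f + g → f ≡ 0 → h ≡ g
    only₂ eq refl = eq

  -- A guard leaving u and a guard arriving at v become one guard moving along uv.
  absorb : Adj G u v → Tr R C P (u ∷ O) (v ∷ I) X → Tr R C P O I ((u , v) ∷ X)
  absorb {u} {v} {R} {C} {O = O} {I} uv t = record
    { F = (u , v) ∷ F
    ; legal = λ { (here refl) → uv ; (there e∈) → legal e∈ }
    ; supp = λ a ¬R → trans (move u O a proj₁) (proj₁ (supp a ¬R)) , trans (move v I a proj₂) (proj₂ (supp a ¬R))
    ; cap = λ a Ra → ≤-trans (≤-reflexive (move u O a proj₁)) (cap a Ra)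
    ; hit = λ { (here refl) → inj₁ (here refl) ; (there e∈) → [ inj₁ ∘ there , inj₂ ∘ there ]′ (hit e∈) }
    ; tgt = λ C' e → tgt C' (λ a Ra → trans (cong (C' a +_) (≡sym (move u O a proj₁)))
        (trans (e a Ra) (cong (C a +_) (move v I a proj₂)))) }
    where
    open Tr t
    move : ∀ w U a (p : V × V → V) → # a U + (δ w a + # a (map p F)) ≡ count p (w ∷ U) F a
    move w U a p = trans (≡sym (+-assoc (# a U) _ _)) (cong (_+ # a (map p F)) (+-comm (# a U) (δ w a)))

  -- Guards are indistinguishable: two that change places along the attacked edge defend it without
  -- altering the configuration.
  swap : Adj G u v → R u → R v → 1 ≤ C u → 1 ≤ C v →
    (∀ C' → (∀ a → R a → C' a ≡ C a) → P C') → Tr R C P [] [] [ u , v ]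
  swap {u} {v} {R} {C} uv Ru Rv Cu Cv p = record
    { F = (u , v) ∷ (v , u) ∷ []
    ; legal = λ { (here refl) → uv ; (there (here refl)) → Adj-sym uv }
    ; supp = λ a ¬Ra → let u≢a = λ e → ¬Ra (subst R e Ru) ; v≢a = λ e → ¬Ra (subst R e Rv) in
        cong₂ (λ x y → x + (y + 0)) (δ-≢ u≢a) (δ-≢ v≢a) , cong₂ (λ x y → x + (y + 0)) (δ-≢ v≢a) (δ-≢ u≢a)
    ; cap = capacity
    ; hit = λ { (here refl) → inj₁ (here refl) }
    ; tgt = λ C' e → p C' (λ a Ra → +-cancelʳ-≡ (δ v a + (δ u a + 0)) _ _
        (trans (cong (C' a +_) (flip a)) (e a Ra))) }
    where
    flip : ∀ a → δ v a + (δ u a + 0) ≡ δ u a + (δ v a + 0)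
    flip a = trans (≡sym (+-assoc (δ v a) _ 0)) (trans (cong (_+ 0) (+-comm (δ v a) _)) (+-assoc (δ u a) _ 0))
    capacity : ∀ a → R a → δ u a + (δ v a + 0) ≤ C a
    capacity a _ with u ≟ a | v ≟ a
    ... | yes refl | yes refl = contradiction refl (Adj-≢ uv)
    ... | yes refl | no _ = Cu
    ... | no _ | yes refl = Cv
    ... | no _ | no _ = z≤n

  -- An occupied vertex is crossed by replacement: one guard enters while the one standing there
  -- leaves. So in a single round a guard is effectively shifted past any number of occupied
  -- vertices.
  pass : ∀ {z} → R z → C z ≡ 1 → (∀ C' → (∀ a → R a → C' a ≡ C a) → P C') → Tr R C P [ z ] [ z ] []
  pass {R} {C} {z = z} Rz Cz p = record
    { F = [] ; legal = λ () ; hit = λ ()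
    ; supp = λ a ¬R → off ¬R , off ¬R
    ; cap = capacity
    ; tgt = λ C' e → p C' (λ a Ra → +-cancelʳ-≡ (δ z a + 0 + 0) _ _ (e a Ra)) }
    where
    off : ∀ {a} → ¬ R a → δ z a + 0 + 0 ≡ 0
    off {a} ¬Ra = cong (λ k → k + 0 + 0) (δ-≢ {u = z} {a} (λ { refl → ¬Ra Rz }))
    capacity : ∀ a → R a → δ z a + 0 + 0 ≤ C a
    capacity a _ with z ≟ a
    ... | yes refl = ≤-reflexive (≡sym Cz)
    ... | no _ = z≤n

  _[_≔_] : Config n → V → ℕ → Config n
  (C [ y ≔ k ]) a = if ⌊ a ≟ y ⌋ then k else C a

  ≔-same : ∀ (C : Config n) y k → (C [ y ≔ k ]) y ≡ k
  ≔-same C y k with y ≟ y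
  ... | yes _ = refl
  ... | no y≢y = contradiction refl y≢y

  ≔-other : ∀ (C : Config n) {y a} k → a ≢ y → (C [ y ≔ k ]) a ≡ C a
  ≔-other C {y} {a} k a≢y with a ≟ y
  ... | yes a≡y = contradiction a≡y a≢y
  ... | no _ = refl

  At : (V → Bool) → V → V → Set
  At K y a = T (K a) ⊎ a ≡ y

  -- A strategy for the part K of the graph hanging at y, with a guard kept on y: configurations in A
  -- have p guards on K, those in B have p + 1.  From A an attack may be answered with the guard of y
  -- moving into K for good, which leads to B; from B the additional guard can be handed over to an empty y.
  record Piece (K : V → Bool) (y : V) (p : ℕ) : Set₁ where
    field
      A B : Config n → Set
      respA : ∀ {C C'} → (∀ a → T (K a) → C' a ≡ C a) → A C → A C'
      respB : ∀ {C C'} → (∀ a → T (K a) → C' a ≡ C a) → B C → B C'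
      bitA : ∀ {C} → A C → ∀ {a} → T (K a) → C a ≤ 1
      bitB : ∀ {C} → B C → ∀ {a} → T (K a) → C a ≤ 1
      stepA : ∀ {C u v} → A C → C y ≡ 1 → Adj G u v → T (K u) → At K y v →
        Tr (At K y) C (λ C' → C' y ≡ 1 × A C') [] [] [ u , v ] ⊎
        Tr (At K y) C (λ C' → C' y ≡ 0 × B C') [] [] [ u , v ]
      stepB : ∀ {C u v} → B C → C y ≡ 1 → Adj G u v → T (K u) → At K y v →
        Tr (At K y) C (λ C' → C' y ≡ 1 × B C') [] [] [ u , v ]
      giveB : ∀ {C} → B C → C y ≡ 0 → Tr (At K y) C (λ C' → C' y ≡ 1 × A C') [] [] []
      init : ∃ λ C → A C × ∑[ K ] C ≡ p

-- Combining strategies at a common vertex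

module Pieces {n : ℕ} (G : Graph n) where
  open Flows G

  private variable
    R : V → Set
    C : Config n
    P Q Q₁ Q₂ : Config n → Set
    O I : List V
    X : List (V × V)
    K K₁ K₂ : V → Bool
    y z : V
    p₁ p₂ : ℕ

  module Outcome (t : Tr R C P O I X) where
    open Tr t
    outcome : Config n
    outcome a = C a + ins a ∸ outs a

    outcome-eq : ∀ a → R a → outcome a + outs a ≡ C a + ins a
    outcome-eq a Ra = m∸n+n≡m (≤-trans (cap a Ra) (m≤m+n _ _))

    outcome-P : P outcome
    outcome-P = tgt outcome outcome-eq

    outcome-unique : ∀ {k} a → R a → k + outs a ≡ C a + ins a → k ≡ outcome a
    outcome-unique a Ra e = +-cancelʳ-≡ (outs a) _ _ (trans e (≡sym (outcome-eq a Ra)))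

  -- `t` acts as if the guard of `z` were already gone. Putting that guard back and letting it leave
  -- by an open half-edge changes both sides of the balance equation at `z` by one.
  release : R z → C z ≡ 1 → Tr R (C [ z ≔ 0 ]) P [] [] X → Tr R C P [ z ] [] X
  release {R} {z} {C} Rz Cz t = record
    { F = F ; legal = legal ; hit = hit
    ; supp = λ a ¬Ra → cong₂ _+_ (cong (_+ 0) (δ-≢ (λ e → ¬Ra (subst R e Rz)))) (proj₁ (supp a ¬Ra)) , proj₂ (supp a ¬Ra)
    ; cap = λ a Ra → subst (count proj₁ [ z ] F a ≤_) (value a) (+-mono-≤ (≤-reflexive (+-identityʳ (δ z a))) (cap a Ra))
    ; tgt = λ C' e → tgt C' (λ a Ra → +-cancelˡ-≡ (δ z a) _ _ (begin
        δ z a + (C' a + outs a)                  ≡⟨ x∙yz≈y∙xz (δ z a) (C' a) _ ⟩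
        C' a + (δ z a + outs a)                  ≡⟨ cong (λ k → C' a + (k + outs a)) (≡sym (+-identityʳ (δ z a))) ⟩
        C' a + (δ z a + 0 + outs a)              ≡⟨ e a Ra ⟩
        C a + ins a                              ≡⟨ cong (_+ ins a) (≡sym (value a)) ⟩
        δ z a + (C [ z ≔ 0 ]) a + ins a          ≡⟨ +-assoc (δ z a) _ _ ⟩
        δ z a + ((C [ z ≔ 0 ]) a + ins a)        ∎)) }
    where
    open Tr t
    open ≡-Reasoning
    open import Algebra.Properties.CommutativeSemigroup +-commutativeSemigroup using (x∙yz≈y∙xz)
    value : ∀ a → δ z a + (C [ z ≔ 0 ]) a ≡ C a
    value a with z ≟ a
    ... | yes refl = trans (cong (1 +_) (≔-same C z 0)) (≡sym Cz)
    ... | no z≢a = ≔-other C 0 (z≢a ∘ ≡sym)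

  -- The guard that arrives at `z` changes its final value from 0 to 1; `respQ` is needed because
  -- `Q` was established for the configuration with `z` empty.
  refill : R z → (∀ {C₁ C₂} → (∀ a → a ≢ z → C₂ a ≡ C₁ a) → Q C₁ → Q C₂) →
    Tr R C (λ C' → C' z ≡ 0 × Q C') [] [] X → Tr R C (λ C' → C' z ≡ 1 × Q C') [] [ z ] X
  refill {R} {z} {Q} {C} Rz respQ t = record
    { F = F ; legal = legal ; hit = hit ; cap = cap
    ; supp = λ a ¬Ra → proj₁ (supp a ¬Ra) , cong₂ _+_ (cong (_+ 0) (δ-≢ (λ e → ¬Ra (subst R e Rz)))) (proj₂ (supp a ¬Ra))
    ; tgt = λ C' e →
        +-cancelʳ-≡ (outs z) _ _ (trans (e z Rz) (trans (cong (λ k → C z + (k + 0 + ins z)) (δ-refl z))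
          (trans (+-suc (C z) (ins z)) (cong suc (trans (≡sym (outcome-eq z Rz)) (cong (_+ outs z) (proj₁ outcome-P))))))) ,
        respQ (λ a a≢z → ≡sym (≔-other C' 0 a≢z)) (proj₂ (tgt (C' [ z ≔ 0 ]) (balance C' e))) }
    where
    open Tr t
    open Outcome t
    balance : ∀ C' → (∀ a → R a → C' a + outs a ≡ C a + count proj₂ [ z ] F a) →
      ∀ a → R a → (C' [ z ≔ 0 ]) a + outs a ≡ C a + ins a
    balance C' e a Ra with a ≟ z
    ... | yes refl = trans (cong (_+ outs a) (≡sym (proj₁ outcome-P))) (outcome-eq a Ra)
    ... | no a≢z = trans (e a Ra) (cong (λ k → C a + (k + 0 + ins a)) (δ-≢ (a≢z ∘ ≡sym)))

  -- The regions overlap in `y`, so `compose` does not apply. In one round `s` draws the guard of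
  -- `y` into `K₁` and `t` sends a guard from `K₂` to `y`, starting from the configuration in which
  -- `y` is already vacated.
  merge : Split K K₁ K₂ → ¬ T (K y) → C y ≡ 1 →
    (∀ {C₁ C₂} → (∀ a → T (K₁ a) → C₂ a ≡ C₁ a) → Q₁ C₁ → Q₁ C₂) →
    (∀ {C₁ C₂} → (∀ a → T (K₂ a) → C₂ a ≡ C₁ a) → Q₂ C₁ → Q₂ C₂) →
    Tr (At K₁ y) C (λ C' → C' y ≡ 0 × Q₁ C') [] [] X →
    Tr (At K₂ y) (C [ y ≔ 0 ]) (λ C' → C' y ≡ 1 × Q₂ C') [] [] [] →
    Tr (At K y) C (λ C' → C' y ≡ 1 × Q₁ C' × Q₂ C') [] [] X
  merge {K} {K₁} {K₂} {y} {C} {Q₁} {Q₂} split y∉K Cy resp₁ resp₂ s t = record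
    { F = S.F ++ T'.F
    ; legal = λ e∈ → [ S.legal , T'.legal ]′ (∈-++⁻ S.F e∈)
    ; supp = λ a ¬R → let (so , si) = S.supp a (¬R ∘ from₁ a) ; (to , ti) = T'.supp a (¬R ∘ from₂ a) in
        trans (os a) (cong₂ _+_ so to) , trans (is a) (cong₂ _+_ si ti)
    ; cap = capacity
    ; hit = λ e∈ → [ inj₁ ∘ ∈-++⁺ˡ , inj₂ ∘ ∈-++⁺ˡ ]′ (S.hit e∈)
    ; tgt = λ C' e →
        +-cancelʳ-≡ 1 _ _ (begin
          C' y + 1                       ≡⟨ cong (C' y +_) (≡sym (cong₂ _+_ outs-y outt-y)) ⟩
          C' y + (S.outs y + T'.outs y)  ≡⟨ cong (C' y +_) (≡sym (os y)) ⟩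
          C' y + _                       ≡⟨ e y (inj₂ refl) ⟩
          C y + _                        ≡⟨ cong₂ _+_ Cy (trans (is y) (cong₂ _+_ ins-y int-y)) ⟩
          1 + 1                          ∎) ,
        resp₁ (λ a Ka → SO.outcome-unique a (inj₁ Ka) (trans (cong (C' a +_) (≡sym (only₁ (os a) (proj₁ (off₂ a Ka)))))
          (trans (e a (from₁ a (inj₁ Ka))) (cong (C a +_) (only₁ (is a) (proj₂ (off₂ a Ka))))))) (proj₂ SO.outcome-P) ,
        resp₂ (λ a Ka → TO.outcome-unique a (inj₁ Ka) (trans (cong (C' a +_) (≡sym (only₂ (os a) (proj₁ (off₁ a Ka)))))
          (trans (e a (from₂ a (inj₁ Ka))) (cong₂ _+_ (≡sym (same a Ka)) (only₂ (is a) (proj₂ (off₁ a Ka))))))) (proj₂ TO.outcome-P)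
    }
    where
    open ≡-Reasoning
    open Split split
    module S = Tr s
    module T' = Tr t
    module SO = Outcome s
    module TO = Outcome t
    os : ∀ a → count proj₁ [] (S.F ++ T'.F) a ≡ S.outs a + T'.outs a
    os a = count-++ proj₁ a [] S.F {[]} {T'.F}
    is : ∀ a → count proj₂ [] (S.F ++ T'.F) a ≡ S.ins a + T'.ins a
    is a = count-++ proj₂ a [] S.F {[]} {T'.F}
    only₁ : ∀ {h f g : ℕ} → h ≡ f + g → g ≡ 0 → h ≡ f
    only₁ eq refl = trans eq (+-identityʳ _)
    only₂ : ∀ {h f g : ℕ} → h ≡ f + g → f ≡ 0 → h ≡ g
    only₂ eq refl = eq
    from₁ : ∀ a → At K₁ y a → At K y a
    from₁ a = [ inj₁ ∘ left a , inj₂ ]′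
    from₂ : ∀ a → At K₂ y a → At K y a
    from₂ a = [ inj₁ ∘ right a , inj₂ ]′
    off₁ : ∀ a → T (K₂ a) → S.outs a ≡ 0 × S.ins a ≡ 0
    off₁ a K₂a = S.supp a [ (λ K₁a → apart a K₁a K₂a) , (λ { refl → y∉K (right a K₂a) }) ]′
    off₂ : ∀ a → T (K₁ a) → T'.outs a ≡ 0 × T'.ins a ≡ 0
    off₂ a K₁a = T'.supp a [ apart a K₁a , (λ { refl → y∉K (left a K₁a) }) ]′
    same : ∀ a → T (K₂ a) → (C [ y ≔ 0 ]) a ≡ C a
    same a K₂a = ≔-other C 0 (λ { refl → y∉K (right a K₂a) })
    -- At `y` the initial and final values determine the traffic: `t` goes from 0 to 1 with nothing
    -- to send away, and `s` goes from 1 to 0 with only one guard to send.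
    outt-y : T'.outs y ≡ 0
    outt-y = n≤0⇒n≡0 (≤-trans (T'.cap y (inj₂ refl)) (≤-reflexive (≔-same C y 0)))
    int-y : T'.ins y ≡ 1
    int-y = ≡sym (trans (≡sym (cong₂ _+_ (proj₁ TO.outcome-P) outt-y))
      (trans (TO.outcome-eq y (inj₂ refl)) (cong (_+ T'.ins y) (≔-same C y 0))))
    out≡ : S.outs y ≡ 1 + S.ins y
    out≡ = trans (cong (_+ S.outs y) (≡sym (proj₁ SO.outcome-P))) (trans (SO.outcome-eq y (inj₂ refl)) (cong (_+ S.ins y) Cy))
    ins-y : S.ins y ≡ 0
    ins-y = n≤0⇒n≡0 (≤-pred (≤-trans (≤-reflexive (≡sym out≡)) (≤-trans (S.cap y (inj₂ refl)) (≤-reflexive Cy))))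
    outs-y : S.outs y ≡ 1
    outs-y = trans out≡ (cong suc ins-y)
    capacity : ∀ a → At K y a → count proj₁ [] (S.F ++ T'.F) a ≤ C a
    capacity a (inj₂ refl) = ≤-reflexive (trans (os a) (trans (cong₂ _+_ outs-y outt-y) (≡sym Cy)))
    capacity a (inj₁ Ka) with into a Ka
    ... | inj₁ K₁a = ≤-trans (≤-reflexive (only₁ (os a) (proj₁ (off₂ a K₁a)))) (S.cap a (inj₁ K₁a))
    ... | inj₂ K₂a = ≤-trans (≤-reflexive (only₂ (os a) (proj₁ (off₁ a K₂a))))
      (≤-trans (T'.cap a (inj₁ K₂a)) (≤-reflexive (same a K₂a)))

  empty-piece : (∀ a → ¬ T (K a)) → Piece K y 0
  empty-piece {K} empty = record
    { A = λ _ → ⊤ ; B = λ _ → ⊥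
    ; respA = λ _ _ → tt ; respB = λ _ ()
    ; bitA = λ _ Ka → contradiction Ka (empty _) ; bitB = λ ()
    ; stepA = λ _ _ _ Ku → contradiction Ku (empty _) ; stepB = λ ()
    ; giveB = λ ()
    ; init = (λ _ → 0) , tt , ∑[]-empty K _ empty }

  swap-sides : ∀ {u v} → Tr R C P O I [ v , u ] → Tr R C P O I [ u , v ]
  swap-sides t = record { Tr t ; hit = λ { (here refl) → [ inj₂ , inj₁ ]′ (Tr.hit t (here refl)) } }


  Split-sym : Split K K₁ K₂ → Split K K₂ K₁
  Split-sym s = record
    { into = λ a Ka → [ inj₂ , inj₁ ]′ (into a Ka) ; left = right ; right = left
    ; apart = λ a K₂a K₁a → apart a K₁a K₂a }
    where open Split s

  module Side {K K₁ K₂ y p₁ p₂} (split : Split K K₁ K₂) (y∉K : ¬ T (K y))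
    (sep : ∀ {u v} → Adj G u v → T (K₁ u) → T (K v) → T (K₁ v))
    (S : Piece K₁ y p₁) (U : Piece K₂ y p₂) where
    private
      module S = Piece S
      module U = Piece U
      open Split split

    beside : ∀ {k} → (∀ {C₁ C₂} → (∀ a → T (K₂ a) → C₂ a ≡ C₁ a) → Q₂ C₁ → Q₂ C₂) → Q₂ C →
      Tr (At K₁ y) C (λ C' → C' y ≡ k × Q₁ C') [] [] X →
      Tr (At K y) C (λ C' → C' y ≡ k × Q₁ C' × Q₂ C') [] [] X
    beside resp q t = map-hit ∈-++⁺ˡ (map-tgt (λ { C' ((e , q₁) , q₂) → e , q₁ , q₂ })
      (map-region
        (λ { a (inj₁ (inj₁ K₁a)) → inj₁ (left a K₁a) ; a (inj₁ (inj₂ e)) → inj₂ e ; a (inj₂ K₂a) → inj₁ (right a K₂a) })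
        (λ { a (inj₁ Ka) → [ inj₁ ∘ inj₁ , inj₂ ]′ (into a Ka) ; a (inj₂ e) → inj₁ (inj₂ e) })
        (compose (λ { a (inj₁ K₁a) K₂a → apart a K₁a K₂a ; a (inj₂ refl) K₂a → y∉K (right a K₂a) })
          t (idle {R = T ∘ K₂} (λ C' e → resp e q)))))

    inside : ∀ {u v} → Adj G u v → T (K₁ u) → At K y v → At K₁ y v
    inside uv K₁u = [ inj₁ ∘ sep uv K₁u , inj₂ ]′

    stepAA : ∀ {C u v} → S.A C → U.A C → C y ≡ 1 → Adj G u v → T (K₁ u) → At K y v →
      Tr (At K y) C (λ C' → C' y ≡ 1 × S.A C' × U.A C') [] [] [ u , v ] ⊎
      Tr (At K y) C (λ C' → C' y ≡ 0 × S.B C' × U.A C') [] [] [ u , v ]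
    stepAA a₁ a₂ Cy uv K₁u v∈ with S.stepA a₁ Cy uv K₁u (inside uv K₁u v∈)
    ... | inj₁ t = inj₁ (beside U.respA a₂ t)
    ... | inj₂ t = inj₂ (beside U.respA a₂ t)

    -- If the first part draws the guard of `y` while the second holds the additional one, the
    -- second refills `y` in the same round: the additional guard changes sides and `y` stays
    -- occupied.
    stepAB : ∀ {C u v} → S.A C → U.B C → C y ≡ 1 → Adj G u v → T (K₁ u) → At K y v →
      Tr (At K y) C (λ C' → C' y ≡ 1 × S.A C' × U.B C') [] [] [ u , v ] ⊎
      Tr (At K y) C (λ C' → C' y ≡ 1 × S.B C' × U.A C') [] [] [ u , v ]
    stepAB {C} a₁ b₂ Cy uv K₁u v∈ with S.stepA a₁ Cy uv K₁u (inside uv K₁u v∈)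
    ... | inj₁ t = inj₁ (beside U.respB b₂ t)
    ... | inj₂ t = inj₂ (merge split y∉K Cy S.respB U.respA t
      (U.giveB (U.respB (λ a K₂a → ≔-other C {y} 0 (λ { refl → y∉K (right a K₂a) })) b₂) (≔-same C y 0)))

    stepBA : ∀ {C u v} → S.B C → U.A C → C y ≡ 1 → Adj G u v → T (K₁ u) → At K y v →
      Tr (At K y) C (λ C' → C' y ≡ 1 × S.B C' × U.A C') [] [] [ u , v ]
    stepBA b₁ a₂ Cy uv K₁u v∈ = beside U.respA a₂ (S.stepB b₁ Cy uv K₁u (inside uv K₁u v∈))

  -- One additional guard serves both parts, because by `stepAB` it goes to whichever part calls for
  -- it. Hence in `B` exactly one of the two parts is in its state `B`, and the numbers of guards
  -- add up.
  product : Split K K₁ K₂ → ¬ T (K y) → (∀ {u v} → Adj G u v → T (K₁ u) → T (K v) → T (K₁ v)) →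
    Piece K₁ y p₁ → Piece K₂ y p₂ → Piece K y (p₁ + p₂)
  product {K} {K₁} {K₂} {y} split y∉K sep S U = record
    { A = λ C → S.A C × U.A C
    ; B = λ C → (S.B C × U.A C) ⊎ (U.B C × S.A C)
    ; respA = λ e (a₁ , a₂) → S.respA (on₁ e) a₁ , U.respA (on₂ e) a₂
    ; respB = λ e → [ (λ (b₁ , a₂) → inj₁ (S.respB (on₁ e) b₁ , U.respA (on₂ e) a₂))
                    , (λ (b₂ , a₁) → inj₂ (U.respB (on₂ e) b₂ , S.respA (on₁ e) a₁)) ]′
    ; bitA = λ (a₁ , a₂) Ka → [ S.bitA a₁ , U.bitA a₂ ]′ (into _ Ka)
    ; bitB = λ b Ka → [ (λ (b₁ , a₂) → [ S.bitB b₁ , U.bitA a₂ ]′ (into _ Ka))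
                      , (λ (b₂ , a₁) → [ S.bitA a₁ , U.bitB b₂ ]′ (into _ Ka)) ]′ b
    ; stepA = stepA
    ; stepB = stepB
    ; giveB = giveB
    ; init = init }
    where
    module S = Piece S
    module U = Piece U
    open Split split
    sep' : ∀ {u v} → Adj G u v → T (K₂ u) → T (K v) → T (K₂ v)
    sep' uv K₂u Kv with into _ Kv
    ... | inj₂ K₂v = K₂v
    ... | inj₁ K₁v = ⊥-elim (apart _ (sep (Adj-sym uv) K₁v (right _ K₂u)) K₂u)
    module L = Side split y∉K sep S U
    module R = Side (Split-sym split) y∉K sep' U S
    on₁ : ∀ {C C' : Config n} → (∀ a → T (K a) → C' a ≡ C a) → ∀ a → T (K₁ a) → C' a ≡ C a
    on₁ e a = e a ∘ left a
    on₂ : ∀ {C C' : Config n} → (∀ a → T (K a) → C' a ≡ C a) → ∀ a → T (K₂ a) → C' a ≡ C a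
    on₂ e a = e a ∘ right a

    stepA : ∀ {C u v} → S.A C × U.A C → C y ≡ 1 → Adj G u v → T (K u) → At K y v → _
    stepA (a₁ , a₂) Cy uv Ku v∈ with into _ Ku
    ... | inj₁ K₁u with L.stepAA a₁ a₂ Cy uv K₁u v∈
    ...   | inj₁ t = inj₁ t
    ...   | inj₂ t = inj₂ (map-tgt (λ { _ (e , q) → e , inj₁ q }) t)
    stepA (a₁ , a₂) Cy uv Ku v∈ | inj₂ K₂u with R.stepAA a₂ a₁ Cy uv K₂u v∈
    ...   | inj₁ t = inj₁ (map-tgt (λ { _ (e , q₂ , q₁) → e , q₁ , q₂ }) t)
    ...   | inj₂ t = inj₂ (map-tgt (λ { _ (e , q) → e , inj₂ q }) t)

    stepB : ∀ {C u v} → (S.B C × U.A C) ⊎ (U.B C × S.A C) → C y ≡ 1 → Adj G u v → T (K u) → At K y v →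
      Tr (At K y) C (λ C' → C' y ≡ 1 × ((S.B C' × U.A C') ⊎ (U.B C' × S.A C'))) [] [] [ u , v ]
    stepB b Cy uv Ku v∈ with into _ Ku
    stepB (inj₁ (b₁ , a₂)) Cy uv Ku v∈ | inj₁ K₁u =
      map-tgt (λ { _ (e , q) → e , inj₁ q }) (L.stepBA b₁ a₂ Cy uv K₁u v∈)
    stepB (inj₂ (b₂ , a₁)) Cy uv Ku v∈ | inj₂ K₂u =
      map-tgt (λ { _ (e , q) → e , inj₂ q }) (R.stepBA b₂ a₁ Cy uv K₂u v∈)
    stepB (inj₂ (b₂ , a₁)) Cy uv Ku v∈ | inj₁ K₁u with L.stepAB a₁ b₂ Cy uv K₁u v∈
    ... | inj₁ t = map-tgt (λ { _ (e , q₁ , q₂) → e , inj₂ (q₂ , q₁) }) t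
    ... | inj₂ t = map-tgt (λ { _ (e , q) → e , inj₁ q }) t
    stepB (inj₁ (b₁ , a₂)) Cy uv Ku v∈ | inj₂ K₂u with R.stepAB a₂ b₁ Cy uv K₂u v∈
    ... | inj₁ t = map-tgt (λ { _ (e , q₂ , q₁) → e , inj₁ (q₁ , q₂) }) t
    ... | inj₂ t = map-tgt (λ { _ (e , q) → e , inj₂ q }) t

    giveB : ∀ {C} → (S.B C × U.A C) ⊎ (U.B C × S.A C) → C y ≡ 0 →
      Tr (At K y) C (λ C' → C' y ≡ 1 × S.A C' × U.A C') [] [] []
    giveB (inj₁ (b₁ , a₂)) Cy = L.beside U.respA a₂ (S.giveB b₁ Cy)
    giveB (inj₂ (b₂ , a₁)) Cy = map-tgt (λ { _ (e , q₂ , q₁) → e , q₁ , q₂ }) (R.beside S.respA a₁ (U.giveB b₂ Cy))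

    init : ∃ λ C → (S.A C × U.A C) × ∑[ K ] C ≡ _
    init with S.init | U.init
    ... | C₁ , a₁ , refl | C₂ , a₂ , refl =
      C₀ , (S.respA same₁ a₁ , U.respA same₂ a₂) ,
      trans (∑[]-split split C₀) (cong₂ _+_ (∑[]-cong K₁ same₁) (∑[]-cong K₂ same₂))
      where
      C₀ : Config n
      C₀ a = if K₁ a then C₁ a else C₂ a
      same₁ : ∀ a → T (K₁ a) → C₀ a ≡ C₁ a
      same₁ a K₁a with K₁ a
      ... | true = refl
      same₂ : ∀ a → T (K₂ a) → C₀ a ≡ C₂ a
      same₂ a K₂a with K₁ a in eq
      ... | true = contradiction K₂a (apart a (subst T (≡sym eq) tt))
      ... | false = refl

-- Alternating configurations along a block

bit : Bool → ℕ
bit true = 1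
bit false = 0

module Block {n : ℕ} (G : Graph n) (K : Fin n → Bool) (y : Fin n) (y∉K : ¬ T (K y)) (own : Fin n → Fin n) where
  open Flows G
  open Pieces G

  -- N z a : the vertex a belongs to the vertex z of the block.
  N : V → V → Set
  N z a = own a ≡ z × At K y a

  -- `root` is meant for `y`: further parts hanging at `y` are added later by `product`, so within
  -- the block only the guard on `y` itself matters.
  data Kind (z : V) : Set₁ where
    root light : (∀ a → N z a → a ≡ z) → Kind z
    heavy : ∀ {Kz p} → Piece Kz z p → ¬ T (Kz z) →
      (∀ a → N z a → At Kz z a) → (∀ a → At Kz z a → N z a) → Kind z

  act : ∀ {z} → Kind z → Bool
  act (light _) = true
  act _ = false

  Now : ∀ {z} → Kind z → Bool → Config n → Set
  Now {z} (root _) c C = C z ≡ 1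
  Now {z} (light _) c C = C z ≡ bit c
  Now {z} (heavy P _ _ _) c C = C z ≡ 1 × Piece.A P C

  Hub : ∀ {z} → Kind z → Config n → Set
  Hub (root _) C = ⊥
  Hub (light _) C = ⊥
  Hub {z} (heavy P _ _ _) C = C z ≡ 1 × Piece.B P C

  module Cyclic (kd : ∀ z → Kind z) where

    private variable
      C : Config n
      P P' Q : Config n → Set
      X X' : List (V × V)
      c d m : Bool
      z : V
      r s ts zs : List V

    -- This is `c` xor the parity of the number of light vertices in the list, whence the laws
    -- below. It is applied to the occupation of the next light vertex and also to the flag that
    -- says whether a guard crosses a gap.
    nxt : List V → Bool → Bool
    nxt [] c = c
    nxt (z ∷ zs) c = nxt zs (act (kd z) xor c)

    -- The light vertices of the list carry c, not c, c, … guards; the other ones are occupied.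
    Alt : Bool → List V → Config n → Set
    Alt c [] C = ⊤
    Alt c (z ∷ zs) C = Now (kd z) c C × Alt (act (kd z) xor c) zs C

    xor-not : ∀ b c → b xor not c ≡ not (b xor c)
    xor-not false c = refl
    xor-not true c = refl

    nxt-not : ∀ r c → nxt r (not c) ≡ not (nxt r c)
    nxt-not [] c = refl
    nxt-not (z ∷ r) c rewrite xor-not (act (kd z)) c = nxt-not r _

    nxt-++ : ∀ r s c → nxt (r ++ s) c ≡ nxt s (nxt r c)
    nxt-++ [] s c = refl
    nxt-++ (z ∷ r) s c = nxt-++ r s _

    nxt-nxt : ∀ r c → nxt r (nxt r c) ≡ c
    nxt-nxt r c with nxt r false in e
    nxt-nxt r false | false rewrite e = e
    nxt-nxt r false | true rewrite e = trans (nxt-not r false) (cong not e)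
    nxt-nxt r true | false rewrite nxt-not r false | e = trans (nxt-not r false) (cong not e)
    nxt-nxt r true | true rewrite nxt-not r false | e = e

    nxt-comm : ∀ r s c → nxt r (nxt s c) ≡ nxt s (nxt r c)
    nxt-comm [] s c = refl
    nxt-comm (z ∷ r) s c with act (kd z)
    ... | false = nxt-comm r s c
    ... | true rewrite ≡sym (nxt-not s c) = nxt-comm r s (not c)

    nxt-reverse : ∀ r c → nxt (reverse r) c ≡ nxt r c
    nxt-reverse [] c = refl
    nxt-reverse (z ∷ r) c rewrite unfold-reverse z r | nxt-++ (reverse r) [ z ] c | nxt-reverse r c =
      nxt-comm [ z ] r c

    Alt-++⁻ : ∀ r → Alt c (r ++ s) C → Alt c r C × Alt (nxt r c) s C
    Alt-++⁻ [] a = tt , a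
    Alt-++⁻ (z ∷ r) (n , a) = (n , proj₁ (Alt-++⁻ r a)) , proj₂ (Alt-++⁻ r a)

    Alt-++⁺ : ∀ r → Alt c r C → Alt (nxt r c) s C → Alt c (r ++ s) C
    Alt-++⁺ [] _ a = a
    Alt-++⁺ (z ∷ r) (n , a) b = n , Alt-++⁺ r a b

    Now-back : ∀ {z} (k : Kind z) → Now k c C → Now k (not (act k xor c)) C
    Now-back (root _) e = e
    Now-back {c = true} (light _) e = e
    Now-back {c = false} (light _) e = e
    Now-back (heavy _ _ _ _) e = e

    -- The last light vertex, if there is one, carries `not (nxt r c)`, which is therefore the
    -- initial value for reading the list backwards.
    Alt-reverse : ∀ r → Alt c r C → Alt (not (nxt r c)) (reverse r) C
    Alt-reverse [] _ = tt
    Alt-reverse {c} {C} (z ∷ r) (n , a) rewrite unfold-reverse z r =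
      Alt-++⁺ (reverse r) (Alt-reverse r a)
        (subst (λ b → Now (kd z) b C) (≡sym back) (Now-back (kd z) n) , tt)
      where
      c' = act (kd z) xor c
      back : nxt (reverse r) (not (nxt r c')) ≡ not c'
      back = trans (nxt-reverse r _) (trans (nxt-not r _) (cong not (nxt-nxt r c')))

    Now-resp : ∀ {z C C'} (k : Kind z) → N z z → (∀ a → N z a → C' a ≡ C a) → Now k c C → Now k c C'
    Now-resp (root _) zz e n = trans (e _ zz) n
    Now-resp (light _) zz e n = trans (e _ zz) n
    Now-resp (heavy P _ _ from) zz e (n , a) =
      trans (e _ zz) n , Piece.respA P (λ a Ka → e a (from a (inj₁ Ka))) a

    Hub-resp : ∀ {z C C'} (k : Kind z) → N z z → (∀ a → N z a → C' a ≡ C a) → Hub k C → Hub k C'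
    Hub-resp (heavy P _ _ from) zz e (n , b) =
      trans (e _ zz) n , Piece.respB P (λ a Ka → e a (from a (inj₁ Ka))) b

    Alt-resp : ∀ {C C'} r → (∀ {z} → z ∈ r → N z z) → (∀ {z a} → z ∈ r → N z a → C' a ≡ C a) → Alt c r C → Alt c r C'
    Alt-resp [] self e a = tt
    Alt-resp (z ∷ r) self e (n , a) =
      Now-resp (kd z) (self (here refl)) (λ b → e (here refl)) n , Alt-resp r (self ∘ there) (e ∘ there) a

    Alt-∈ : z ∈ r → Alt c r C → ∃ λ c' → Now (kd z) c' C
    Alt-∈ (here refl) (n , _) = _ , n
    Alt-∈ (there z∈) (_ , a) = Alt-∈ z∈ a

    RL : List V → V → Set
    RL [] a = ⊥
    RL (z ∷ zs) a = RL zs a ⊎ N z a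

    RL⇒∈ : RL zs z → own z ∈ zs × At K y z
    RL⇒∈ {zs = _ ∷ _} (inj₁ r) = there (proj₁ (RL⇒∈ r)) , proj₂ (RL⇒∈ r)
    RL⇒∈ {zs = _ ∷ _} (inj₂ (refl , a)) = here refl , a

    ∈⇒RL : own z ∈ zs → At K y z → RL zs z
    ∈⇒RL (here e) a = inj₂ (e , a)
    ∈⇒RL (there e) a = inj₁ (∈⇒RL e a)

    bO bI : Bool → Bool → V → List V
    bO true true z = [ z ]
    bO _ _ z = []
    bI false true z = [ z ]
    bI _ _ z = []

    -- A partial reconfiguration of the vertices in the list, with no traffic at its right end.  If m
    -- holds, then a guard enters (c = false) or leaves (c = true) through its left end.
    Tail : Config n → List V → Bool → Bool → (Config n → Set) → List (V × V) → Set
    Tail C [] c true P X = ⊥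
    Tail C [] c false P X = Tr (RL []) C P [] [] X
    Tail C (t ∷ ts) c m P X = Tr (RL (t ∷ ts)) C P (bO c m t) (bI c m t) X

    map-Tail : ∀ ts {c m} → (∀ C' → P C' → P' C') → Tail C ts c m P X → Tail C ts c m P' X
    map-Tail [] {m = false} f t = map-tgt f t
    map-Tail (_ ∷ _) f t = map-tgt f t

    nil : Tr (RL []) C (λ _ → ⊤) [] [] []
    nil = idle (λ _ _ → tt)

    Seq : List V → Set
    Seq zs = Unique zs × (∀ {u v} → Consec zs u v → Adj G u v) × (∀ {z} → z ∈ zs → N z z)

    Seq-tail : Seq (z ∷ zs) → Seq zs
    Seq-tail ((_ ∷ un) , p , self) = un , p ∘ there , self ∘ there

    Seq-++ˡ : ∀ r → Seq (r ++ s) → Seq r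
    Seq-++ˡ r (un , p , self) = Unique-++ˡ r un , p ∘ Consec-++ˡ , self ∘ ∈-++⁺ˡ

    Seq-++ʳ : ∀ r → Seq (r ++ s) → Seq s
    Seq-++ʳ r (un , p , self) = Unique-++ʳ r un , p ∘ Consec-++ʳ r , self ∘ ∈-++⁺ʳ r

    apart : z ∉ zs → ∀ a → RL zs a → ¬ N z a
    apart z∉ a ra (e , _) = z∉ (subst (_∈ _) e (proj₁ (RL⇒∈ ra)))

    -- A flipped vertex has a single half-edge. With `m` it is the traffic at the left end and
    -- nothing crosses the gap to the right; without `m` it is joined to the traffic at the left end
    -- of `ts`. Either way the flag is negated, so flipped vertices are matched in consecutive
    -- pairs.
    active : ∀ ts → Seq (z ∷ ts) → Tr (N z) C Q (bO c true z) (bI c true z) X' →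
      Tail C ts (not c) (not m) P X → Tail C (z ∷ ts) c m (P ⊗ Q) (X ++ X')
    active {c = true} {m = true} [] (z∉ ∷ _ , _) l t = compose (λ _ ()) t l
    active {c = false} {m = true} [] (z∉ ∷ _ , _) l t = compose (λ _ ()) t l
    active {c = true} {m = true} (t' ∷ ts) (un , _) l t = compose (apart (Unique-head un)) t l
    active {c = false} {m = true} (t' ∷ ts) (un , _) l t = compose (apart (Unique-head un)) t l
    active {c = true} {m = false} (t' ∷ ts) (un , path , _) l t =
      map-hit there (absorb (path here) (compose (apart (Unique-head un)) t l))
    active {c = false} {m = false} (t' ∷ ts) (un , path , _) l t =
      map-hit there (absorb (Adj-sym (path here)) (compose (apart (Unique-head un)) t l))

    -- The empty `z` is filled from the right and `z'` comes next, so the guard that fills it moves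
    -- along the attacked edge itself.
    active-hit : ∀ {z'} ts → Seq (z ∷ z' ∷ ts) → Tr (N z) C Q [] [ z ] X' →
      Tail C (z' ∷ ts) true true P X → Tail C (z ∷ z' ∷ ts) false false (P ⊗ Q) [ z , z' ]
    active-hit ts (un , path , _) l t = swap-sides
      (map-hit (λ { (here refl) → here refl }) (absorb (Adj-sym (path here)) (compose (apart (Unique-head un)) t l)))

    -- A vertex that is not flipped relays the traffic by `pass`, so flag and direction are the same
    -- on both of its sides.
    passive : ∀ ts → Seq (z ∷ ts) → C z ≡ 1 → (∀ C' → (∀ a → N z a → C' a ≡ C a) → Q C') →
      Tail C ts c m P X → Tail C (z ∷ ts) c m (P ⊗ Q) X
    passive {c = true} {m = false} [] (un , _) Cz q t = map-hit ∈-++⁺ˡ (compose (λ _ ()) t (idle q))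
    passive {c = false} {m = false} [] (un , _) Cz q t = map-hit ∈-++⁺ˡ (compose (λ _ ()) t (idle q))
    passive {c = true} {m = false} (t' ∷ ts) (un , _) Cz q t =
      map-hit ∈-++⁺ˡ (compose (apart (Unique-head un)) t (idle q))
    passive {c = false} {m = false} (t' ∷ ts) (un , _) Cz q t =
      map-hit ∈-++⁺ˡ (compose (apart (Unique-head un)) t (idle q))
    passive {c = true} {m = true} (t' ∷ ts) (un , path , self) Cz q t =
      map-hit (there ∘ ∈-++⁺ˡ) (absorb (Adj-sym (path here)) (compose (apart (Unique-head un)) t (pass (self (here refl)) Cz q)))
    passive {c = false} {m = true} (t' ∷ ts) (un , path , self) Cz q t =
      map-hit (there ∘ ∈-++⁺ˡ) (absorb (path here) (compose (apart (Unique-head un)) t (pass (self (here refl)) Cz q)))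

    flip-light : N z z → (∀ a → N z a → a ≡ z) → C z ≡ bit c →
      Tr (N z) C (λ C' → C' z ≡ bit (not c)) (bO c true z) (bI c true z) []
    flip-light {z} {C} {true} zz only Cz = record
      { F = [] ; legal = λ () ; hit = λ ()
      ; supp = λ a ¬N → cong (λ k → k + 0 + 0) (δ-≢ {u = z} {a} (λ { refl → ¬N zz })) , refl
      ; cap = λ { a Na → subst (λ a → δ z a + 0 + 0 ≤ C a) (≡sym (only a Na))
          (≤-reflexive (trans (cong (λ k → k + 0 + 0) (δ-refl z)) (≡sym Cz))) }
      ; tgt = λ C' e → +-cancelʳ-≡ 1 _ _ (trans (cong (λ k → C' z + (k + 0 + 0)) (≡sym (δ-refl z)))
          (trans (e z zz) (trans (+-identityʳ _) Cz))) }
    flip-light {z} {C} {false} zz only Cz = record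
      { F = [] ; legal = λ () ; hit = λ ()
      ; supp = λ a ¬N → refl , cong (λ k → k + 0 + 0) (δ-≢ {u = z} {a} (λ { refl → ¬N zz }))
      ; cap = λ _ _ → z≤n
      ; tgt = λ C' e → trans (≡sym (+-identityʳ _)) (trans (e z zz)
          (cong₂ _+_ Cz (cong (λ k → k + 0 + 0) (δ-refl z)))) }

    prepend₁ : ∀ ts (k : Kind z) → Seq (z ∷ ts) → Now k c C →
      Tail C ts (act k xor c) (act k xor m) P X → Tail C (z ∷ ts) c m (P ⊗ Now k (not c)) X
    prepend₁ ts k@(root _) sq Cz t =
      passive ts sq Cz (λ C' e → Now-resp {c = false} k (proj₂ (proj₂ sq) (here refl)) e Cz) t
    prepend₁ {m = m} ts (light only) sq Cz t =
      map-hit ∈-++⁺ˡ (active {m = m} ts sq (flip-light (proj₂ (proj₂ sq) (here refl)) only Cz) t)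
    prepend₁ {c = c} ts k@(heavy P _ _ _) sq q@(Cz , _) t =
      passive ts sq Cz (λ C' e → Now-resp {c = c} k (proj₂ (proj₂ sq) (here refl)) e q) t

    -- Occupation and flag are both negated at the light vertices and nowhere else, so `nxt r` of
    -- each is what the remainder `ts` has to provide.
    prepend : ∀ r {ts} → Seq (r ++ ts) → Alt c r C →
      Tail C ts (nxt r c) (nxt r m) P X → Tail C (r ++ ts) c m (P ⊗ Alt (not c) r) X
    prepend [] {ts} sq a t = map-Tail ts (λ _ p → p , tt) t
    prepend {c} {C} (z ∷ r) {ts} sq (n , a) t = map-Tail (z ∷ r ++ ts)
      (λ { C' ((p , b) , k) → p , k , subst (λ d → Alt d r C') (≡sym (xor-not (act (kd z)) c)) b })
      (prepend₁ (r ++ ts) (kd z) sq n (prepend r (Seq-tail sq) a t))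

-- Moving guards along the cyclic order of a block

module BlockMoves {n : ℕ} (G : Graph n) (K : Fin n → Bool) (y : Fin n) (y∉K : ¬ T (K y)) (own : Fin n → Fin n)
  (kd : ∀ z → Block.Kind G K y y∉K own z) (base : List (Fin n))
  (E : Fin n → Fin n → Set) (own∈ : ∀ a → Flows.At G K y a → own a ∈ base) where
  open Flows G
  open Pieces G
  open Block G K y y∉K own
  open Cyclic kd

  private variable
    C : Config n
    P Q Same Rel Tak : Config n → Set
    X X' : List (V × V)
    c d m m' q₁ q₂ : Bool
    z z' h h' : V
    r s ts zs r₁ r₂ : List V

  -- A cyclic order of the block, cut open at some vertex. The cut and the direction are not fixed:
  -- a state may need any vertex in front and either orientation, which `rotate` and `reflect`
  -- supply.
  record Arr (zs : List V) : Set where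
    field
      path : ∀ {u v} → Consec (cl zs) u v → Adj G u v
      covers : ∀ {u v} → E u v → Consec (cl zs) u v ⊎ Consec (cl zs) v u
      unique : Unique zs
      self : ∀ {z} → z ∈ zs → N z z
      all : ∀ {z} → z ∈ base → z ∈ zs

  Unique-↭ : ∀ {xs ys : List V} → xs ↭ ys → Unique xs → Unique ys
  Unique-↭ p = Unique-resp-↭ (↭⇒↭ₛ p)
    where
    open import Data.List.Relation.Binary.Permutation.Setoid.Properties (≡.setoid V) using (Unique-resp-↭)
    open import Data.List.Relation.Binary.Permutation.Propositional using (↭⇒↭ₛ)

  rotate₁ : Arr (z ∷ zs) → Arr (zs ++ [ z ])
  rotate₁ {z} {zs} arr = record
    { path = path ∘ Consec-unrotate z zs
    ; covers = λ e → [ inj₁ ∘ Consec-rotate z zs , inj₂ ∘ Consec-rotate z zs ]′ (covers e)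
    ; unique = Unique-↭ (++-comm [ z ] zs) unique
    ; self = λ z∈ → self (∈-resp-↭ (++-comm zs [ z ]) z∈)
    ; all = λ z∈ → ∈-resp-↭ (++-comm [ z ] zs) (all z∈) }
    where
    open Arr arr

  rotate : ∀ r → Arr (r ++ s) → Arr (s ++ r)
  rotate {s} [] arr = subst Arr (≡sym (++-identityʳ s)) arr
  rotate {s} (x ∷ r) arr = subst Arr (++-assoc s [ x ] r)
    (rotate r (subst Arr (++-assoc r s [ x ]) (rotate₁ arr)))

  reflect : Arr (z ∷ zs) → Arr (z ∷ reverse zs)
  reflect {z} {zs} arr = record
    { path = λ c → Adj-sym (path (subst (λ l → Consec l _ _) back (Consec-reverse c)))
    ; covers = λ e → [ inj₂ ∘ Consec-cl-reverse z zs , inj₁ ∘ Consec-cl-reverse z zs ]′ (covers e)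
    ; unique = Unique-↭ (prep z (↭-sym (↭-reverse zs))) unique
    ; self = λ z∈ → self (∈-resp-↭ (prep z (↭-reverse zs)) z∈)
    ; all = λ z∈ → ∈-resp-↭ (prep z (↭-sym (↭-reverse zs))) (all z∈) }
    where
    open Arr arr
    back : reverse (cl (z ∷ reverse zs)) ≡ cl (z ∷ zs)
    back = trans (cl-reverse z (reverse zs)) (cong (λ l → z ∷ l ++ [ z ]) (reverse-involutive zs))

  Arr⇒Seq : Arr zs → Seq zs
  Arr⇒Seq {[]} arr = [] , (λ ()) , λ ()
  Arr⇒Seq {x ∷ xs} arr = unique , path ∘ Consec-++ˡ , self
    where open Arr arr

  whole : (∀ {z} → z ∈ base → z ∈ zs) → Tr (RL zs) C P [] [] X → Tr (At K y) C P [] [] X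
  whole all = map-region (λ a → proj₂ ∘ RL⇒∈) (λ a a∈ → ∈⇒RL (all (own∈ a a∈)) a∈)

  join : (∀ {z} → z ∈ r → z ∉ s) → (∀ {z} → z ∈ base → z ∈ r ⊎ z ∈ s) →
    Tr (RL r) C P [] [] X → Tr (RL s) C Q [] [] X' → Tr (At K y) C (P ⊗ Q) [] [] (X ++ X')
  join disj all t u = map-region
    (λ a → [ proj₂ ∘ RL⇒∈ , proj₂ ∘ RL⇒∈ ]′)
    (λ a a∈ → [ (λ z∈ → inj₁ (∈⇒RL z∈ a∈)) , (λ z∈ → inj₂ (∈⇒RL z∈ a∈)) ]′ (all (own∈ a a∈)))
    (compose (λ a ra sa → disj (proj₁ (RL⇒∈ ra)) (proj₁ (RL⇒∈ sa))) t u)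

  join-Arr : ∀ r → Arr (r ++ s) → Tr (RL r) C P [] [] X → Tr (RL s) C Q [] [] X' →
    Tr (At K y) C (P ⊗ Q) [] [] (X ++ X')
  join-Arr r arr = join (Unique-++ r unique) (∈-++⁻ r ∘ all)
    where open Arr arr

  stay : ∀ r → Seq r → Alt c r C → Tr (RL r) C (Alt c r) [] [] []
  stay r (_ , _ , self) a = idle (λ C' e → Alt-resp r self (λ { z∈ (refl , Na) → e _ (∈⇒RL z∈ Na) }) a)

  Tail⇒Tr : ∀ r → Tail C r c false P X → Tr (RL r) C P [] [] X
  Tail⇒Tr [] t = t
  Tail⇒Tr {c = false} (_ ∷ _) t = t
  Tail⇒Tr {c = true} (_ ∷ _) t = t

  nil′ : m ≡ false → Tail C [] d m (λ _ → ⊤) []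
  nil′ refl = nil

  at : ∀ z ts → c ≡ d → m ≡ m' → Tail C (z ∷ ts) d m' P X → Tail C (z ∷ ts) c m P X
  at z ts refl refl t = t

  nxt-true : ∀ r {q} → nxt r false ≡ q → nxt r true ≡ not q
  nxt-true r e = trans (nxt-not r false) (cong not e)

  nxt-false : ∀ r {q} → nxt r true ≡ q → nxt r false ≡ not q
  nxt-false r e = trans (nxt-not r true) (cong not e)

  sink : Seq [ z ] → Tr (N z) C P [] [ z ] X → Tail C [ z ] false true P X
  sink sq snk = map-tgt (λ _ → proj₂) (active {c = false} {m = true} [] sq snk nil)

  source : Seq [ z ] → Tr (N z) C P [ z ] [] X → Tail C [ z ] true true P X
  source sq src = map-tgt (λ _ → proj₂) (active {c = true} {m = true} [] sq src nil)

  prepend-nil : ∀ r → Seq r → Alt c r C → nxt r m ≡ false → Tail C r c m (Alt (not c) r) []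
  prepend-nil {c} {C} {m} r sq a e = subst (λ l → Tail C l c m (Alt (not c) r) []) (++-identityʳ r)
    (map-Tail (r ++ []) (λ _ → proj₂) (prepend r (subst Seq (≡sym (++-identityʳ r)) sq) a (nil′ e)))

  flip-all : ∀ r → Seq r → Alt c r C → nxt r false ≡ false → Tr (RL r) C (Alt (not c) r) [] [] []
  flip-all r sq a e = Tail⇒Tr r (prepend-nil r sq a e)

  -- The additional guard moves from h to h'.  Which of the two arcs between h and h' is flipped depends on
  -- the parities of their numbers of light vertices; if both are flipped, the alternation may be reversed.
  transfer : ∀ r₁ r₂ → Arr (h ∷ r₁ ++ h' ∷ r₂) →
    Tr (N h) C Rel [ h ] [] [] → Tr (N h') C Tak [] [ h' ] X →
    nxt r₁ false ≡ q₁ → nxt r₂ false ≡ q₂ → Alt false r₁ C → Alt q₁ r₂ C →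
    Tr (At K y) C (Rel ⊗ Tak ⊗ λ C' → ∃ λ d → (Alt d r₂ C' × Alt (nxt r₂ d) r₁ C') × (d ≡ false ⊎ nxt r₂ (nxt r₁ false) ≡ false)) [] [] X
  transfer {h} {h'} {C} {Rel} {Tak} {X} {q₁ = q₁} {q₂} r₁ r₂ arr src snk e₁ e₂ a₁ a₂ = go q₁ q₂ e₁ e₂ a₂
    where
    arr₁ : Arr ((h ∷ r₁ ++ [ h' ]) ++ r₂)
    arr₁ = subst (Arr ∘ (h ∷_)) (≡sym (++-assoc r₁ [ h' ] r₂)) arr
    arr₂ : Arr ((h' ∷ r₂) ++ h ∷ r₁)
    arr₂ = rotate (h ∷ r₁) arr
    arr₃ : Arr ((h' ∷ r₂ ++ [ h ]) ++ r₁)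
    arr₃ = subst (Arr ∘ (h' ∷_)) (≡sym (++-assoc r₂ [ h ] r₁)) arr₂
    hr₁h' = Seq-++ˡ (h ∷ r₁ ++ [ h' ]) (Arr⇒Seq arr₁)
    h'r₂h = Seq-++ˡ (h' ∷ r₂ ++ [ h ]) (Arr⇒Seq arr₃)
    hr₁ = Seq-++ˡ (h ∷ r₁) (Arr⇒Seq arr)
    h'r₂ = Seq-++ˡ (h' ∷ r₂) (Arr⇒Seq arr₂)
    go : ∀ q₁ q₂ → nxt r₁ false ≡ q₁ → nxt r₂ false ≡ q₂ → Alt q₁ r₂ C → Tr (At K y) C (Rel ⊗ Tak ⊗ λ C' →
      ∃ λ d → (Alt d r₂ C' × Alt (nxt r₂ d) r₁ C') × (d ≡ false ⊎ nxt r₂ (nxt r₁ false) ≡ false)) [] [] X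
    -- The light vertices of `r₁`, even in number, are paired off together with `h` and `h'`, so the
    -- guard is passed on along this arc.
    go false true e₁ e₂ a₂ = map-hit (∈-++⁺ˡ ∘ ∈-++⁺ˡ) (map-tgt
      (λ { C' (((tak , b₁) , rel) , b₂) → rel , tak , false , (b₂ , subst (λ c → Alt c r₁ C') (≡sym e₂) b₁) , inj₁ refl })
      (join-Arr (h ∷ r₁ ++ [ h' ]) arr₁
        (active {c = true} {m = false} (r₁ ++ [ h' ]) hr₁h' src (prepend r₁ (Seq-tail hr₁h') a₁
          (at h' [] e₁ (nxt-true r₁ e₁) (sink (Seq-++ʳ (h ∷ r₁) hr₁h') snk))))
        (stay r₂ (Seq-tail h'r₂) a₂)))
    -- With `r₂` even too, it must be flipped to agree with `r₁`. The alternation then starts with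
    -- `true`, which is tolerated because the total is even.
    go false false e₁ e₂ a₂ = map-hit (∈-++⁺ˡ ∘ ∈-++⁺ˡ) (map-tgt
      (λ { C' (((tak , b₁) , rel) , b₂) → rel , tak , true ,
        (b₂ , subst (λ c → Alt c r₁ C') (≡sym (nxt-true r₂ e₂)) b₁) , inj₂ (trans (cong (nxt r₂) e₁) e₂) })
      (join-Arr (h ∷ r₁ ++ [ h' ]) arr₁
        (active {c = true} {m = false} (r₁ ++ [ h' ]) hr₁h' src (prepend r₁ (Seq-tail hr₁h') a₁
          (at h' [] e₁ (nxt-true r₁ e₁) (sink (Seq-++ʳ (h ∷ r₁) hr₁h') snk))))
        (flip-all r₂ (Seq-tail h'r₂) a₂ e₂)))
    -- Only `r₂` is even, so the guard is passed on along this arc, read from `h'` to `h`.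
    go true false e₁ e₂ a₂ = map-hit ∈-++⁺ˡ (map-tgt
      (λ { C' (((rel , b₂) , tak) , b₁) → rel , tak , false , (b₂ , subst (λ c → Alt c r₁ C') (≡sym e₂) b₁) , inj₁ refl })
      (join-Arr (h' ∷ r₂ ++ [ h ]) arr₃
        (active {c = false} {m = false} (r₂ ++ [ h ]) h'r₂h snk (prepend r₂ (Seq-tail h'r₂h) a₂
          (at h [] (nxt-true r₂ e₂) (nxt-true r₂ e₂) (source (Seq-++ʳ (h' ∷ r₂) h'r₂h) src))))
        (stay r₁ (Seq-tail hr₁) a₁)))
    -- Both arcs are odd: `h` is paired off with the light vertices of `r₁` and `h'` with those of
    -- `r₂`, and no guard crosses a whole arc.
    go true true e₁ e₂ a₂ = map-tgt
      (λ { C' ((b₁ , rel) , (b₂ , tak)) → rel , tak , false , (b₂ , subst (λ c → Alt c r₁ C') (≡sym e₂) b₁) , inj₁ refl })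
      (join-Arr (h ∷ r₁) arr
        (active {c = true} {m = false} r₁ hr₁ src
          (prepend-nil {m = true} r₁ (Seq-tail hr₁) a₁ (nxt-true r₁ e₁)))
        (active {c = false} {m = false} r₂ h'r₂ snk
          (prepend-nil {m = true} r₂ (Seq-tail h'r₂) a₂ (nxt-true r₂ e₂))))

  -- The total being odd, exactly one arc has an odd number of light vertices. That arc is paired
  -- off together with `h'` and flipped, while the other one stays; this removes the two
  -- neighbouring guards at the cut.
  transfer′ : ∀ r₁ r₂ → Arr (r₁ ++ h' ∷ r₂) → Tr (N h') C Tak [] [ h' ] X →
    nxt r₁ false ≡ q₁ → nxt r₂ q₁ ≡ true → Alt true r₁ C → Alt (not q₁) r₂ C →
    Tr (At K y) C (Tak ⊗ λ C' → Alt false r₂ C' × Alt (nxt r₂ false) r₁ C') [] [] X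
  transfer′ {h'} {C} {Tak} {X} {q₁} r₁ r₂ arr snk e₁ e₂ a₁ a₂ = go q₁ e₁ e₂ a₂
    where
    arr₁ : Arr ((r₁ ++ [ h' ]) ++ r₂)
    arr₁ = subst Arr (≡sym (++-assoc r₁ [ h' ] r₂)) arr
    arr₂ : Arr ((h' ∷ r₂) ++ r₁)
    arr₂ = rotate r₁ arr
    r₁h' = Seq-++ˡ (r₁ ++ [ h' ]) (Arr⇒Seq arr₁)
    h'r₂ = Seq-++ˡ (h' ∷ r₂) (Arr⇒Seq arr₂)
    go : ∀ q₁ → nxt r₁ false ≡ q₁ → nxt r₂ q₁ ≡ true → Alt (not q₁) r₂ C →
      Tr (At K y) C (Tak ⊗ λ C' → Alt false r₂ C' × Alt (nxt r₂ false) r₁ C') [] [] X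
    go true e₁ e₂ a₂ = map-hit ∈-++⁺ˡ (map-tgt
      (λ { C' ((tak , b₁) , b₂) → tak , b₂ , subst (λ c → Alt c r₁ C') (≡sym (nxt-false r₂ e₂)) b₁ })
      (join-Arr (r₁ ++ [ h' ]) arr₁
        (Tail⇒Tr (r₁ ++ [ h' ]) (prepend r₁ r₁h' a₁ (at h' [] (nxt-true r₁ e₁) e₁ (sink (Seq-++ʳ r₁ r₁h') snk))))
        (stay r₂ (Seq-tail h'r₂) a₂)))
    go false e₁ e₂ a₂ = map-hit ∈-++⁺ˡ (map-tgt
      (λ { C' ((b₂ , tak) , b₁) → tak , b₂ , subst (λ c → Alt c r₁ C') (≡sym e₂) b₁ })
      (join-Arr (h' ∷ r₂) arr₂
        (active {c = false} {m = false} r₂ h'r₂ snk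
          (prepend-nil {m = true} r₂ (Seq-tail h'r₂) a₂ (nxt-true r₂ e₂)))
        (stay r₁ (Seq-++ˡ r₁ (Arr⇒Seq arr)) a₁)))

  -- An empty light vertex determines the phase of the alternation on both sides of it, and hence
  -- `c`.
  module Empty {C : Config n} {z} {c} r₁ r₂ {only} (kz : kd z ≡ light only) (Cz : C z ≡ 0)
    (a : Alt c (r₁ ++ z ∷ r₂) C) where

    act-z : act (kd z) ≡ true
    act-z rewrite kz = refl

    before : nxt r₁ c ≡ false
    before with proj₁ (proj₂ (Alt-++⁻ r₁ a))
    ... | now rewrite kz | Cz with nxt r₁ c
    ...   | false = refl
    ...   | true = contradiction now λ ()

    a₁ : Alt c r₁ C
    a₁ = proj₁ (Alt-++⁻ r₁ a)

    a₂ : Alt true r₂ C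
    a₂ = subst (λ c → Alt c r₂ C) (trans (cong₂ _xor_ act-z before) refl) (proj₂ (proj₂ (Alt-++⁻ r₁ a)))

    flip-z : N z z → Tr (N z) C (λ C' → C' z ≡ 1) [] [ z ] []
    flip-z zz = flip-light {c = false} zz only Cz

    nxt-mid : ∀ {d} → nxt (r₁ ++ z ∷ r₂) d ≡ nxt r₂ (not (nxt r₁ d))
    nxt-mid {d} = trans (nxt-++ r₁ (z ∷ r₂) d) (cong (λ b → nxt r₂ (b xor nxt r₁ d)) act-z)

    c≡ : c ≡ nxt r₁ false
    c≡ = trans (≡sym (nxt-nxt r₁ c)) (cong (nxt r₁) before)

    reassemble : ∀ {C'} → Alt (not c) r₁ C' → C' z ≡ 1 → Alt false r₂ C' → Alt (not c) (r₁ ++ z ∷ r₂) C'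
    reassemble {C'} b₁ one b₂ = Alt-++⁺ r₁ b₁ (now , subst (λ c → Alt c r₂ C') (≡sym (cong₂ _xor_ act-z after)) b₂)
      where
      after : nxt r₁ (not c) ≡ true
      after = trans (nxt-not r₁ c) (cong not before)
      now : Now (kd z) (nxt r₁ (not c)) C'
      now rewrite kz | after = one

  active-first : ∀ {l} → l ≡ z' ∷ ts → Seq (z ∷ l) → Tr (N z) C Q [] [ z ] X' → Tail C l true true P X →
    Tail C (z ∷ l) false false (P ⊗ Q) [ z , z' ]
  active-first {ts = ts} refl = active-hit ts

  next-first : ∀ {x b} r₁ r₂ → r₂ ++ [ x ] ≡ z' ∷ b → r₂ ++ x ∷ r₁ ≡ z' ∷ (b ++ r₁)
  next-first {x = x} r₁ r₂ e = trans (≡sym (++-assoc r₂ [ x ] r₁)) (cong (_++ r₁) e)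

  -- Here `r₁` and `r₂` are both even. Starting from `z` in the direction of the attacked edge, the
  -- light vertices of `r₂` are paired off with `z` and `h` at the ends, and those of `r₁` among
  -- themselves. So `h` spends its guard, and the alternation then begins and ends occupied.
  attack-odd : ∀ {b only} r₁ r₂ → Arr (h ∷ r₁ ++ z ∷ r₂) → Tr (N h) C Rel [ h ] [] [] →
    kd z ≡ light only → C z ≡ 0 → Alt false (r₁ ++ z ∷ r₂) C → nxt (r₁ ++ z ∷ r₂) false ≡ true →
    r₂ ++ [ h ] ≡ z' ∷ b →
    Tr (At K y) C (Rel ⊗ Alt true (r₁ ++ z ∷ r₂)) [] [] [ z , z' ]
  attack-odd {h} {z} {C} {Rel} r₁ r₂ arr src kz Cz a odd eq = whole (Arr.all arr')
    (map-tgt (λ { C' (((b₁ , rel) , b₂) , one) → rel , reassemble b₁ one b₂ })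
      (active-first (next-first r₁ r₂ eq) sq (flip-z (proj₂ (proj₂ sq) (here refl)))
        (prepend r₂ (Seq-tail sq) a₂ (at h r₁ even₂ even₂
          (active {c = true} {m = true} r₁ hr₁ src (prepend-nil {m = false} r₁ (Seq-tail hr₁) a₁ before))))))
    where
    open Empty r₁ r₂ kz Cz a
    arr' = rotate (h ∷ r₁) arr
    sq = Arr⇒Seq arr'
    hr₁ = Seq-++ʳ (z ∷ r₂) sq
    even₂ : nxt r₂ true ≡ true
    even₂ = trans (cong (nxt r₂ ∘ not) (≡sym before)) (trans (≡sym nxt-mid) odd)

  -- With an even total, the light vertices are paired off around the whole block, starting from `z`
  -- towards `z'`. The vertex `h` keeps its guard and at most relays others, so either phase `c` is
  -- admissible.
  attack-even : ∀ {b only} r₁ r₂ → Arr (h ∷ r₁ ++ z ∷ r₂) →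
    C h ≡ 1 → (∀ C' → (∀ a → N h a → C' a ≡ C a) → Same C') →
    kd z ≡ light only → C z ≡ 0 → Alt c (r₁ ++ z ∷ r₂) C → nxt (r₁ ++ z ∷ r₂) false ≡ false →
    r₂ ++ [ h ] ≡ z' ∷ b →
    Tr (At K y) C (Same ⊗ Alt (not c) (r₁ ++ z ∷ r₂)) [] [] [ z , z' ]
  attack-even {h} {z} {C} {Same} {c} r₁ r₂ arr Ch same kz Cz a even eq = whole (Arr.all arr')
    (map-tgt (λ { C' (((b₁ , s) , b₂) , one) → s , reassemble b₁ one b₂ })
      (active-first (next-first r₁ r₂ eq) sq (flip-z (proj₂ (proj₂ sq) (here refl)))
        (prepend r₂ (Seq-tail sq) a₂ (at h r₁ e₂ e₂
          (passive r₁ hr₁ Ch same (prepend-nil {m = c} r₁ (Seq-tail hr₁) a₁ before))))))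
    where
    open Empty r₁ r₂ kz Cz a
    arr' = rotate (h ∷ r₁) arr
    sq = Arr⇒Seq arr'
    hr₁ = Seq-++ʳ (z ∷ r₂) sq
    e₂ : nxt r₂ true ≡ c
    e₂ = begin
      nxt r₂ true          ≡⟨ nxt-not r₂ false ⟩
      not (nxt r₂ false)   ≡⟨ cong (not ∘ nxt r₂) (≡sym (trans (≡sym nxt-mid) even)) ⟩
      not (nxt r₂ (nxt r₂ (not (nxt r₁ false)))) ≡⟨ cong not (nxt-nxt r₂ _) ⟩
      not (not (nxt r₁ false)) ≡⟨ not-involutive _ ⟩
      nxt r₁ false         ≡⟨ ≡sym c≡ ⟩
      c                    ∎
      where open ≡-Reasoning

  -- Both `r₁` and `z' ∷ r₂` are odd. Flipping the even list `z ∷ z' ∷ r₂` alone fills `z`; the list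
  -- `r₁` ends occupied, so the two neighbouring guards are now found at the cut before `z`.
  attack-double : ∀ {only} r₁ r₂ → Arr (r₁ ++ z ∷ z' ∷ r₂) → kd z ≡ light only → C z ≡ 0 →
    Alt true (r₁ ++ z ∷ z' ∷ r₂) C → nxt (r₁ ++ z ∷ z' ∷ r₂) false ≡ true →
    Tr (At K y) C (Alt true ((z ∷ z' ∷ r₂) ++ r₁)) [] [] [ z , z' ]
  attack-double {z} {z'} {C} r₁ r₂ arr kz Cz a odd = map-tgt
    (λ { C' ((b₂ , one) , b₁) → now one ,
      Alt-++⁺ (z' ∷ r₂) (subst (λ c → Alt c (z' ∷ r₂) C') (≡sym (cong (_xor true) act-z)) b₂)
        (subst (λ c → Alt c r₁ C') (≡sym (trans (cong (nxt (z' ∷ r₂)) (cong (_xor true) act-z)) e₂)) b₁) })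
    (join-Arr (z ∷ z' ∷ r₂) arr'
      (active-first refl zr₂ (flip-z (proj₂ (proj₂ zr₂) (here refl)))
        (prepend-nil {m = true} (z' ∷ r₂) (Seq-tail zr₂) a₂ (nxt-true (z' ∷ r₂) e₂)))
      (stay r₁ (Seq-++ʳ (z ∷ z' ∷ r₂) (Arr⇒Seq arr')) a₁))
    where
    open Empty r₁ (z' ∷ r₂) kz Cz a
    arr' = rotate r₁ arr
    zr₂ = Seq-++ˡ (z ∷ z' ∷ r₂) (Arr⇒Seq arr')
    e₂ : nxt (z' ∷ r₂) false ≡ true
    e₂ = trans (cong (nxt (z' ∷ r₂) ∘ not) c≡) (trans (≡sym nxt-mid) odd)
    now : ∀ {C'} → C' z ≡ 1 → Now (kd z) true C'
    now one rewrite kz = one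

-- Regions given by owners

∧⁺ : ∀ {a b} → T a → T b → T (a ∧ b)
∧⁺ {true} _ b = b

∧⁻ : ∀ {a b} → T (a ∧ b) → T a × T b
∧⁻ {true} b = tt , b

module Owner {n} (K : Fin n → Bool) (own : Fin n → Fin n) where

  Zone : List (Fin n) → Fin n → Bool
  Zone zs a = K a ∧ ⌊ own a ∈? zs ⌋
    where open import Data.List.Membership.DecPropositional (_≟_ {n}) using (_∈?_)

  Zone⁺ : ∀ {zs a} → T (K a) → own a ∈ zs → T (Zone zs a)
  Zone⁺ Ka o∈ = ∧⁺ Ka (fromWitness o∈)

  Zone⁻ : ∀ {zs a} → T (Zone zs a) → T (K a) × own a ∈ zs
  Zone⁻ {zs} {a} t with ∧⁻ {K a} t
  ... | Ka , o = Ka , toWitness o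

  Zone-split : ∀ {z zs} → z ∉ zs → Split (Zone (z ∷ zs)) (Zone [ z ]) (Zone zs)
  Zone-split {z} {zs} z∉ = record
    { into = λ a t → case Zone⁻ t of λ { (Ka , here e) → inj₁ (Zone⁺ Ka (here e)) ; (Ka , there o) → inj₂ (Zone⁺ Ka o) }
    ; left = λ a t → case Zone⁻ t of λ { (Ka , here e) → Zone⁺ Ka (here e) }
    ; right = λ a t → case Zone⁻ t of λ { (Ka , o) → Zone⁺ Ka (there o) }
    ; apart = λ a t u → case Zone⁻ {[ z ]} t of λ { (_ , here e) → z∉ (subst (_∈ zs) e (proj₂ (Zone⁻ u))) } }

  Zone-singleton-split : ∀ {z Kz} → T (K z) → own z ≡ z → (∀ a → T (Kz a) → T (K a) × own a ≡ z × a ≢ z) →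
    (∀ a → T (K a) → own a ≡ z → a ≢ z → T (Kz a)) → Split (Zone [ z ]) (λ a → ⌊ a ≟ z ⌋) Kz
  Zone-singleton-split {z} {Kz} K-z own-z out into' = record
    { into = λ a t → case Zone⁻ t of λ { (Ka , here e) → case a ≟ z of λ
        { (yes a≡z) → inj₁ (fromWitness a≡z) ; (no a≢z) → inj₂ (into' a Ka e a≢z) } }
    ; left = λ a t → case toWitness {a? = a ≟ z} t of λ { refl → Zone⁺ K-z (here own-z) }
    ; right = λ a t → case out a t of λ { (Ka , e , _) → Zone⁺ Ka (here e) }
    ; apart = λ a t u → proj₂ (proj₂ (out a u)) (toWitness t) }

-- The strategy on one block

module BlockPiece {n : ℕ} (G : Graph n) (K : Fin n → Bool) (y : Fin n) (y∉K : ¬ T (K y)) (own : Fin n → Fin n)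
  (kd : ∀ z → Block.Kind G K y y∉K own z) (base : List (Fin n))
  (E : Fin n → Fin n → Set) (own∈ : ∀ a → Flows.At G K y a → own a ∈ base)
  (y∈base : y ∈ base) (own-y : own y ≡ y)
  (y-only : ∀ a → Block.N G K y y∉K own y a → a ≡ y) (kd-y : kd y ≡ Block.root y-only)
  (sep : ∀ {u v} → Adj G u v → T (K u) → Flows.At G K y v → own u ≡ own v ⊎ E u v) where
  open Flows G
  open Pieces G
  open Block G K y y∉K own
  open Cyclic kd
  open BlockMoves G K y y∉K own kd base E own∈

  private variable
    C C' : Config n
    P Q : Config n → Set
    X : List (V × V)
    c d : Bool
    z z' h h' u v : V
    r s zs rest r₁ r₂ : List V

  -- The additional guard is either kept in the part hanging at h, or it makes two light vertices
  -- occupied that are next to each other in the cyclic order.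
  data BState (C : Config n) : Set where
    hub : ∀ h rest → Arr (h ∷ rest) → Hub (kd h) C → Alt false rest C → BState C
    double : ∀ zs → Arr zs → nxt zs false ≡ true → Alt true zs C → BState C

  Agree : Config n → Config n → Set
  Agree C' C = ∀ a → At K y a → C' a ≡ C a

  Alt-respArr : Arr zs → (∀ {z} → z ∈ r → z ∈ zs) → (∀ {z a} → z ∈ r → N z a → C' a ≡ C a) → Alt c r C → Alt c r C'
  Alt-respArr {r = r} arr sub = Alt-resp r (Arr.self arr ∘ sub)

  Alt-agree : Arr zs → (∀ {z} → z ∈ r → z ∈ zs) → Agree C' C → Alt c r C → Alt c r C'
  Alt-agree arr sub e = Alt-respArr arr sub (λ _ (_ , a∈) → e _ a∈)

  BState-resp : Agree C' C → BState C → BState C'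
  BState-resp e (hub h rest arr H a) =
    hub h rest arr (Hub-resp (kd h) (Arr.self arr (here refl)) (λ b (_ , b∈) → e b b∈) H) (Alt-agree arr there e a)
  BState-resp e (double zs arr odd a) = double zs arr odd (Alt-agree arr id e a)

  Now-y : Now (kd y) c C → C y ≡ 1
  Now-y now rewrite kd-y = now

  Now-y⁺ : C y ≡ 1 → ∀ c → Now (kd y) c C
  Now-y⁺ e c rewrite kd-y = e

  act-y : act (kd y) ≡ false
  act-y rewrite kd-y = refl

  ¬Hub-y : ¬ Hub (kd y) C
  ¬Hub-y H rewrite kd-y = H

  BState-y : BState C → C y ≡ 1
  BState-y (hub h rest arr H a) with Arr.all arr y∈base
  ... | here refl = ⊥-elim (¬Hub-y H)
  ... | there y∈ = Now-y (proj₂ (Alt-∈ y∈ a))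
  BState-y (double zs arr _ a) = Now-y (proj₂ (Alt-∈ (Arr.all arr y∈base) a))

  Passive : ∀ {z} → Kind z → Config n → Set
  Passive k C = act k ≡ false × ∀ c → Now k c C

  Alt-mid : Passive (kd h) C → Alt c r C → Alt (nxt r c) s C → Alt c (r ++ h ∷ s) C
  Alt-mid {h} {C} {c} {r} {s} (inactive , now) a b = Alt-++⁺ r a (now _ , subst (λ k → Alt (k xor nxt r c) s C) (≡sym inactive) b)

  Alt-mid⁻ : ∀ r → act (kd h) ≡ false → Alt c (r ++ h ∷ s) C → Alt c r C × Alt (nxt r c) s C
  Alt-mid⁻ {c = c} {s} {C} r inactive a with Alt-++⁻ r a
  ... | a₁ , _ , a₂ = a₁ , subst (λ k → Alt (k xor nxt r c) s C) inactive a₂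

  nxt-mid : ∀ r → act (kd h) ≡ false → nxt (r ++ h ∷ s) c ≡ nxt s (nxt r c)
  nxt-mid {h} {s} {c} r inactive = trans (nxt-++ r (h ∷ s) c) (cong (λ k → nxt s (k xor nxt r c)) inactive)

  -- With an even number of light vertices, an alternation that starts occupied ends empty, so the
  -- reversed order starts empty.
  normalise : Arr (h ∷ rest) → Alt d rest C → d ≡ false ⊎ nxt rest false ≡ false →
    ∃ λ rest' → Arr (h ∷ rest') × Alt false rest' C
  normalise {rest = rest} {false} arr a _ = rest , arr , a
  normalise {rest = rest} {true} {C} arr a (inj₂ even) = reverse rest , reflect arr ,
    subst (λ c → Alt c (reverse rest) C) (cong not (nxt-true rest even)) (Alt-reverse rest a)

  -- The situation after `h` has spent a guard. Nothing is said about `h` itself: the root `y` is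
  -- left empty, whereas a heavy `h` is occupied again at once. `settle` applies to both.
  data After (h : V) (C : Config n) : Set where
    spread : ∀ rest → Arr (h ∷ rest) → nxt rest false ≡ true → Alt true rest C → After h C
    moved : ∀ h' r₁ r₂ d → Arr (h' ∷ r₂ ++ h ∷ r₁) → Hub (kd h') C → Alt d r₂ C → Alt (nxt r₂ d) r₁ C →
      d ≡ false ⊎ nxt r₂ (nxt r₁ false) ≡ false → After h C

  settle : After h C → (∀ a → own a ≢ h → C' a ≡ C a) → Passive (kd h) C' → BState C'
  settle {h} {C} {C'} after e p@(inactive , now) = go after
    where
    off : (∀ {z} → z ∈ r → z ≢ h) → ∀ {z a} → z ∈ r → N z a → C' a ≡ C a
    off ne z∈ (o , _) = e _ (λ o≡h → ne z∈ (trans (≡sym o) o≡h))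
    go : After h C → BState C'
    go (spread rest arr odd a) = double (h ∷ rest) arr
      (trans (cong (λ k → nxt rest (k xor false)) inactive) odd)
      (now true , subst (λ k → Alt (k xor true) rest C') (≡sym inactive)
        (Alt-respArr arr there (off (λ { z∈ refl → Unique-head (Arr.unique arr) z∈ })) a))
    go (moved h' r₁ r₂ d arr H a₂ a₁ bal) = hub h' rest' arr'
      (Hub-resp (kd h') (Arr.self arr' (here refl)) (λ a → off h'≢h (here refl)) H) a'
      where
      un = Arr.unique arr
      h'≢h : ∀ {z} → z ∈ [ h' ] → z ≢ h
      h'≢h (here refl) refl = Unique-head un (∈-++⁺ʳ r₂ (here refl))
      h∉r₂ : ∀ {z} → z ∈ r₂ → z ≢ h
      h∉r₂ z∈ refl = Unique-++ (h' ∷ r₂) un (there z∈) (here refl)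
      h∉r₁ : ∀ {z} → z ∈ r₁ → z ≢ h
      h∉r₁ z∈ refl = Unique-head (Unique-++ʳ (h' ∷ r₂) un) z∈
      norm = normalise arr
        (Alt-mid p (Alt-respArr arr (there ∘ ∈-++⁺ˡ) (off h∉r₂) a₂)
                   (Alt-respArr arr (there ∘ ∈-++⁺ʳ r₂ ∘ there) (off h∉r₁) a₁))
        ([ inj₁ , (λ even → inj₂ (trans (nxt-mid r₂ inactive) (trans (nxt-comm r₁ r₂ false) even))) ]′ bal)
      rest' = proj₁ norm
      arr' = proj₁ (proj₂ norm)
      a' = proj₂ (proj₂ norm)

  -- The local responses of the hub h holding the additional guard.
  record HubOps (h : V) (C : Config n) : Set₁ where
    field
      Rel Same : Config n → Set
      occupied : C h ≡ 1
      src : Tr (N h) C Rel [ h ] [] []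
      same : ∀ C' → (∀ a → N h a → C' a ≡ C a) → Same C'

  only-at : ∀ {others} → Arr (z ∷ others) → Tr (N z) C Q [] [] X →
    Tr (At K y) C (λ C' → Q C' × (∀ a → own a ∈ others → At K y a → C' a ≡ C a)) [] [] X
  only-at {z} {others = others} arr t = whole {zs = z ∷ others} (Arr.all arr)
    (map-tgt (λ { C' (f , q) → q , λ a o a∈ → f a (∈⇒RL o a∈) })
      (compose (apart (Unique-head (Arr.unique arr))) (idle (λ C' e → e)) t))

  pieceA : ∀ {Kz p} (P : Piece Kz z p) → Piece.A P C → C z ≡ 1 → Adj G u v → At Kz z u → At Kz z v →
    Tr (At Kz z) C (λ C' → C' z ≡ 1 × Piece.A P C') [] [] [ u , v ] ⊎
    Tr (At Kz z) C (λ C' → C' z ≡ 0 × Piece.B P C') [] [] [ u , v ]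
  pieceA P a Cz uv (inj₁ Ku) v∈ = Piece.stepA P a Cz uv Ku v∈
  pieceA P a Cz uv u∈ (inj₁ Kv) with Piece.stepA P a Cz (Adj-sym uv) Kv u∈
  ... | inj₁ t = inj₁ (swap-sides t)
  ... | inj₂ t = inj₂ (swap-sides t)
  pieceA P a Cz uv (inj₂ refl) (inj₂ refl) = contradiction refl (Adj-≢ uv)

  pieceB : ∀ {Kz p} (P : Piece Kz z p) → Piece.B P C → C z ≡ 1 → Adj G u v → At Kz z u → At Kz z v →
    Tr (At Kz z) C (λ C' → C' z ≡ 1 × Piece.B P C') [] [] [ u , v ]
  pieceB P b Cz uv (inj₁ Ku) v∈ = Piece.stepB P b Cz uv Ku v∈
  pieceB P b Cz uv u∈ (inj₁ Kv) = swap-sides (Piece.stepB P b Cz (Adj-sym uv) Kv u∈)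
  pieceB P b Cz uv (inj₂ refl) (inj₂ refl) = contradiction refl (Adj-≢ uv)

  inside-site : (k : Kind z) → Now k c C → Adj G u v → N z u → N z v →
    Tr (N z) C (λ C' → Now k c C') [] [] [ u , v ] ⊎
    (act k ≡ false × Tr (N z) C (Hub k) [] [ z ] [ u , v ])
  inside-site (root only) _ uv Nu Nv = contradiction (trans (only _ Nu) (≡sym (only _ Nv))) (Adj-≢ uv)
  inside-site (light only) _ uv Nu Nv = contradiction (trans (only _ Nu) (≡sym (only _ Nv))) (Adj-≢ uv)
  inside-site {z} {C = C} (heavy P z∉ to from) (Cz , a) uv Nu Nv with pieceA P a Cz uv (to _ Nu) (to _ Nv)
  ... | inj₁ t = inj₁ (map-region from to t)
  ... | inj₂ t = inj₂ (refl , map-region from to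
    (refill (inj₂ refl) (λ e → Piece.respB P (λ a Ka → e a (λ { refl → z∉ Ka }))) t))

  inside-hub : (k : Kind z) → Hub k C → Adj G u v → N z u → N z v → Tr (N z) C (Hub k) [] [] [ u , v ]
  inside-hub (heavy P _ to from) (Cz , b) uv Nu Nv = map-region from to (pieceB P b Cz uv (to _ Nu) (to _ Nv))

  swap-all : Adj G u v → At K y u → At K y v → 1 ≤ C u → 1 ≤ C v → Tr (At K y) C (λ C' → Agree C' C) [] [] [ u , v ]
  swap-all uv u∈ v∈ Cu Cv = swap uv u∈ v∈ Cu Cv (λ C' e → e)

  light-of : (k : Kind z) → Now k c C → C z ≡ 0 → ∃ λ only → k ≡ light only
  light-of (root _) n Cz = contradiction (trans (≡sym n) Cz) λ ()
  light-of (light only) _ _ = only , refl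
  light-of (heavy _ _ _ _) (n , _) Cz = contradiction (trans (≡sym n) Cz) λ ()

  module HubAttack {h C} (ops : HubOps h C) (inactive : act (kd h) ≡ false) where
    open HubOps ops

    Stays Leaves : Config n → Set
    Stays C' = Same C' × ∃ λ rest' → Arr (h ∷ rest') × Alt false rest' C'
    Leaves C' = Rel C' × After h C'

    Outcomes : V → V → Set
    Outcomes u v = Tr (At K y) C Stays [] [] [ u , v ] ⊎ Tr (At K y) C Leaves [] [] [ u , v ]

    swap-outcomes : Outcomes v u → Outcomes u v
    swap-outcomes = [ inj₁ ∘ swap-sides , inj₂ ∘ swap-sides ]′

    at-vertex : Arr (h ∷ rest) → Alt false rest C → Adj G u v → z ≢ h → z ∈ h ∷ rest → N z u → N z v → Outcomes u v
    at-vertex arr a uv z≢h (here z≡h) Nu Nv = contradiction z≡h z≢h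
    at-vertex {rest} {u} {v} {z} arr a uv z≢h (there z∈) Nu Nv with ∈-∃++ z∈
    ... | r₁ , r₂ , refl with Alt-++⁻ r₁ a
    ...   | a₁ , now , a₂ with inside-site (kd z) now uv Nu Nv
    ...     | inj₁ t = inj₁ (map-tgt (λ { C' (now' , e) →
                same C' (λ { b (refl , b∈) → e b (∈-++⁺ʳ r₂ (here refl)) b∈ }) ,
                r₁ ++ z ∷ r₂ , arr ,
                Alt-++⁺ r₁ (Alt-respArr arr (there ∘ ∈-++⁺ˡ) (λ { z∈ (refl , b∈) → e _ (∈-++⁺ʳ r₂ (there z∈)) b∈ }) a₁)
                  (now' , Alt-respArr arr (there ∘ ∈-++⁺ʳ r₁ ∘ there) (λ { z∈ (refl , b∈) → e _ (∈-++⁺ˡ z∈) b∈ }) a₂) })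
              (only-at (rotate (h ∷ r₁) arr) t))
    ...     | inj₂ (inactive-z , t) = inj₂ (map-tgt
                (λ { C' (rel , H , d , (b₂ , b₁) , bal) → rel , moved z r₁ r₂ d (rotate (h ∷ r₁) arr) H b₂ b₁ bal })
                (transfer r₁ r₂ arr src t refl refl a₁ (proj₂ (Alt-mid⁻ r₁ inactive-z a))))

    -- An even number of light vertices is shifted without the help of `h` in either phase; an odd
    -- number costs `h` its guard and requires the phase `false`. Hence the disjunction.
    from-empty : Arr (h ∷ rest) → Alt c rest C → c ≡ false ⊎ nxt rest false ≡ false →
      Consec (cl (h ∷ rest)) z z' → C z ≡ 0 → Outcomes z z'
    from-empty {rest} {c} {z} {z'} arr a bal con Cz = locate (Consec-∃++ con)
      where
      respond : ∀ {c} r₁ r₂ {b} → Arr (h ∷ r₁ ++ z ∷ r₂) → Alt c (r₁ ++ z ∷ r₂) C → ∀ parity →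
        nxt (r₁ ++ z ∷ r₂) false ≡ parity → c ≡ false ⊎ parity ≡ false → r₂ ++ [ h ] ≡ z' ∷ b → Outcomes z z'
      respond r₁ r₂ arr a parity e bal eq with light-of (kd z) (proj₁ (proj₂ (Alt-++⁻ r₁ a))) Cz
      respond r₁ r₂ arr a false e bal eq | only , kz =
        inj₁ (map-tgt (λ { C' (s , b) → s , normalise arr b (inj₂ e) })
          (attack-even r₁ r₂ arr occupied same kz Cz a e eq))
      respond r₁ r₂ arr a true e (inj₁ refl) eq | only , kz =
        inj₂ (map-tgt (λ { C' (r , b) → r , spread (r₁ ++ z ∷ r₂) arr e b })
          (attack-odd r₁ r₂ arr src kz Cz a e eq))
      go : ∀ r₁ r₂ {b} → rest ≡ r₁ ++ z ∷ r₂ → r₂ ++ [ h ] ≡ z' ∷ b → Outcomes z z'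
      go r₁ r₂ e = respond r₁ r₂ (subst (Arr ∘ (h ∷_)) e arr) (subst (λ l → Alt c l C) e a)
        (nxt rest false) (cong (λ l → nxt l false) (≡sym e)) bal
      locate : (∃ λ ys → ∃ λ b → h ∷ rest ++ [ h ] ≡ ys ++ z ∷ z' ∷ b) → Outcomes z z'
      locate ([] , b , eq) with ∷-injective eq
      ... | refl , _ = contradiction (trans (≡sym occupied) Cz) λ ()
      locate (_ ∷ r₁ , b , eq) with snoc-split rest (proj₂ (∷-injective eq))
      ... | r₂ , eq' , eq'' = go r₁ r₂ eq' eq''

    from-empty′ : Arr (h ∷ rest) → Alt false rest C →
      Consec (cl (h ∷ rest)) z z' ⊎ Consec (cl (h ∷ rest)) z' z → C z ≡ 0 → Outcomes z z'
    from-empty′ arr a (inj₁ con) Cz = from-empty arr a (inj₁ refl) con Cz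
    from-empty′ {rest} arr a (inj₂ con) Cz = from-empty (reflect arr) (Alt-reverse rest a) balanced
      (Consec-cl-reverse h rest con) Cz
      where
      -- Reversal makes the phase the negation of the parity, so it differs from `false` only if the
      -- number of light vertices is even.
      balanced : not (nxt rest false) ≡ false ⊎ nxt (reverse rest) false ≡ false
      balanced with nxt rest false in e
      ... | true = inj₁ refl
      ... | false = inj₂ (trans (nxt-reverse rest false) e)

    attack : Arr (h ∷ rest) → Alt false rest C → Adj G u v → T (K u) → At K y v →
      (own u ≡ own v → own u ≢ h) → Outcomes u v
    attack {rest} {u} {v} arr a uv Ku v∈ elsewhere with sep uv Ku v∈
    ... | inj₁ same-own = at-vertex arr a uv (elsewhere same-own) (Arr.all arr (own∈ u (inj₁ Ku)))
            (refl , inj₁ Ku) (≡sym same-own , v∈)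
    ... | inj₂ e with zero-or-positive (C u) | zero-or-positive (C v) | Arr.covers arr e
    ...   | inj₁ Cu | _ | con = from-empty′ arr a con Cu
    ...   | inj₂ _ | inj₁ Cv | con = swap-outcomes (from-empty′ arr a ([ inj₂ , inj₁ ]′ con) Cv)
    ...   | inj₂ Cu | inj₂ Cv | _ = inj₁ (map-tgt
              (λ C' f → same C' (λ { b (_ , b∈) → f b b∈ }) , rest , arr , Alt-agree arr there f a)
              (swap-all uv (inj₁ Ku) v∈ Cu Cv))

  module Double {C : Config n} where

    at-vertex : Arr zs → nxt zs false ≡ true → Alt true zs C → Adj G u v → z ∈ zs → N z u → N z v →
      Tr (At K y) C BState [] [] [ u , v ]
    at-vertex {z = z} arr odd a uv z∈ Nu Nv with ∈-∃++ z∈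
    ... | r₁ , r₂ , refl with Alt-++⁻ r₁ a
    ...   | a₁ , now , a₂ with inside-site (kd z) now uv Nu Nv
    ...     | inj₁ t = map-tgt (λ { C' (now' , e) → double (r₁ ++ z ∷ r₂) arr odd
                (Alt-++⁺ r₁ (Alt-respArr arr ∈-++⁺ˡ (λ { z∈ (refl , b∈) → e _ (∈-++⁺ʳ r₂ z∈) b∈ }) a₁)
                  (now' , Alt-respArr arr (∈-++⁺ʳ r₁ ∘ there) (λ { z∈ (refl , b∈) → e _ (∈-++⁺ˡ z∈) b∈ }) a₂)) })
              (only-at (rotate r₁ arr) t)
    ...     | inj₂ (inactive-z , t) = map-tgt
                (λ { C' (H , b₂ , b₁) → hub z (r₂ ++ r₁) (rotate r₁ arr) H (Alt-++⁺ r₂ b₂ b₁) })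
                (transfer′ r₁ r₂ arr t refl (trans (≡sym (nxt-mid r₁ inactive-z)) odd) a₁
                  (subst (λ c → Alt c r₂ C) (nxt-true r₁ refl) (proj₂ (Alt-mid⁻ r₁ inactive-z a))))

    from-empty : Arr zs → nxt zs false ≡ true → Alt true zs C → Consec (cl zs) z z' → C z ≡ 0 →
      Tr (At K y) C BState [] [] [ z , z' ]
    from-empty {x ∷ xs} {z} {z'} arr odd a con Cz with Consec-∃++ con
    ... | r₁ , b , eq with snoc-split (x ∷ xs) eq
    ...   | r₂ , eq' , eq'' = go r₁ r₂ eq' eq''
      where
      go : ∀ r₁ r₂ → x ∷ xs ≡ r₁ ++ z ∷ r₂ → r₂ ++ [ x ] ≡ z' ∷ b → Tr (At K y) C BState [] [] [ z , z' ]
      go r₁ r₂ eq eq' with subst Arr eq arr | subst (λ l → nxt l false ≡ true) eq odd | subst (λ l → Alt true l C) eq a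
      ... | arr' | odd' | a' with light-of (kd z) (proj₁ (proj₂ (Alt-++⁻ r₁ a'))) Cz
      -- The empty `z` cannot come last: an odd alternation that starts occupied also ends with an
      -- occupied light vertex.
      go r₁ [] eq eq' | arr' | odd' | a' | only , kz =
        contradiction (trans (≡sym odd') (trans (nxt-mid-z {false}) (cong not (≡sym c≡)))) λ ()
        where open Empty r₁ [] kz Cz a' renaming (nxt-mid to nxt-mid-z)
      go r₁ (z'' ∷ r₂) eq eq' | arr' | odd' | a' | only , kz with ∷-injective eq'
      ... | refl , _ = map-tgt
        (λ C' b → double ((z ∷ z' ∷ r₂) ++ r₁) (rotate r₁ arr')
          (trans (nxt-++ (z ∷ z' ∷ r₂) r₁ false) (trans (nxt-comm r₁ (z ∷ z' ∷ r₂) false)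
            (trans (≡sym (nxt-++ r₁ (z ∷ z' ∷ r₂) false)) odd'))) b)
        (attack-double r₁ r₂ arr' kz Cz a' odd')

    from-empty′ : Arr zs → nxt zs false ≡ true → Alt true zs C →
      Consec (cl zs) z z' ⊎ Consec (cl zs) z' z → C z ≡ 0 → Tr (At K y) C BState [] [] [ z , z' ]
    from-empty′ arr odd a (inj₁ con) Cz = from-empty arr odd a con Cz
    from-empty′ {x ∷ xs} arr odd a (inj₂ con) Cz =
      from-empty (subst Arr (≡sym (unfold-reverse x xs)) (rotate [ x ] (reflect arr)))
        (trans (nxt-reverse (x ∷ xs) false) odd)
        (subst (λ c → Alt c (reverse (x ∷ xs)) C) (cong not (nxt-true (x ∷ xs) odd)) (Alt-reverse (x ∷ xs) a))
        (subst (λ l → Consec (cl l) _ _) (≡sym (unfold-reverse x xs))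
          (Consec-rotate x (reverse xs) (Consec-cl-reverse x xs con))) Cz

    attack : Arr zs → nxt zs false ≡ true → Alt true zs C → Adj G u v → T (K u) → At K y v →
      Tr (At K y) C BState [] [] [ u , v ]
    attack {zs} {u} {v} arr odd a uv Ku v∈ with sep uv Ku v∈
    ... | inj₁ same-own = at-vertex arr odd a uv (Arr.all arr (own∈ u (inj₁ Ku)))
            (refl , inj₁ Ku) (≡sym same-own , v∈)
    ... | inj₂ e with zero-or-positive (C u) | zero-or-positive (C v) | Arr.covers arr e
    ...   | inj₁ Cu | _ | con = from-empty′ arr odd a con Cu
    ...   | inj₂ _ | inj₁ Cv | con = swap-sides (from-empty′ arr odd a ([ inj₂ , inj₁ ]′ con) Cv)
    ...   | inj₂ Cu | inj₂ Cv | _ = map-tgt (λ C' f → double zs arr odd (Alt-agree arr id f a))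
              (swap-all uv (inj₁ Ku) v∈ Cu Cv)

  hub-inactive : (k : Kind z) → Hub k C → act k ≡ false
  hub-inactive (heavy _ _ _ _) _ = refl

  hub-occupied : (k : Kind z) → Hub k C → C z ≡ 1
  hub-occupied (heavy _ _ _ _) (Cz , _) = Cz

  -- While the guard of `z` leaves, the additional guard of the hanging part replaces it by `giveB`,
  -- so `z` is never vacated.
  hub-release : (k : Kind z) → Hub k C → Tr (N z) C (λ C' → ∀ c → Now k c C') [ z ] [] []
  hub-release {z} {C} (heavy P z∉ to from) (Cz , b) = map-region from to (map-tgt (λ _ now _ → now)
    (release (inj₂ refl) Cz (Piece.giveB P (Piece.respB P (λ a Ka → ≔-other C {z} 0 λ { refl → z∉ Ka }) b) (≔-same C z 0))))

  hubOps : N h h → Hub (kd h) C → HubOps h C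
  hubOps {h} {C} hh H = record
    { Rel = λ C' → ∀ c → Now (kd h) c C' ; Same = Hub (kd h)
    ; occupied = hub-occupied (kd h) H ; src = hub-release (kd h) H
    ; same = λ C' e → Hub-resp (kd h) hh e H }

  yy : N y y
  yy = own-y , inj₂ refl

  -- In state `A` the guard of `y` itself plays the additional guard, so an attack is analysed as if
  -- `y` were a hub; spending it leaves `y` empty, as the second outcome of `stepA` demands.
  rootOps : C y ≡ 1 → HubOps y C
  rootOps Cy = record
    { Rel = λ C' → C' y ≡ 0 ; Same = λ C' → C' y ≡ 1
    ; occupied = Cy ; src = flip-light {c = true} yy y-only Cy
    ; same = λ C' e → trans (e y yy) Cy }

  -- `B` has to hold both when `y` has just been vacated and when it is occupied again, while
  -- `BState` speaks of an occupied `y`; resetting the value at `y` makes `B` independent of it.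
  A B : Config n → Set
  A C = ∃ λ rest → Arr (y ∷ rest) × Alt false rest C
  B C = BState (C [ y ≔ 1 ])

  ≢y : T (K u) → u ≢ y
  ≢y Ku refl = y∉K Ku

  N-K : z ≢ y → N z u → T (K u)
  N-K z≢y (_ , inj₁ Ku) = Ku
  N-K z≢y (o , inj₂ refl) = contradiction (trans (≡sym o) own-y) z≢y

  B⁺ : BState C → C y ≡ 1 × B C
  B⁺ {C} b = BState-y b , BState-resp (λ a _ → reset a) b
    where
    reset : ∀ a → (C [ y ≔ 1 ]) a ≡ C a
    reset a with a ≟ y
    ... | yes refl = ≡sym (BState-y b)
    ... | no _ = refl

  B⁻ : C y ≡ 1 → B C → BState C
  B⁻ {C} Cy = BState-resp (λ a _ → reset a)
    where
    reset : ∀ a → C a ≡ (C [ y ≔ 1 ]) a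
    reset a with a ≟ y
    ... | yes refl = Cy
    ... | no _ = refl

  stepA : A C → C y ≡ 1 → Adj G u v → T (K u) → At K y v →
    Tr (At K y) C (λ C' → C' y ≡ 1 × A C') [] [] [ u , v ] ⊎
    Tr (At K y) C (λ C' → C' y ≡ 0 × B C') [] [] [ u , v ]
  stepA {C} {u} (rest , arr , a) Cy uv Ku v∈
    with HubAttack.attack (rootOps Cy) act-y arr a uv Ku v∈ (λ _ o → ≢y Ku (y-only u (o , inj₁ Ku)))
  ... | inj₁ t = inj₁ t
  ... | inj₂ t = inj₂ (map-tgt (λ { C' (e , after) → e ,
    settle after (λ a o≢y → ≔-other C' {y} 1 (λ { refl → o≢y own-y })) (act-y , Now-y⁺ (≔-same C' y 1)) }) t)

  stepHub : Arr (h ∷ rest) → Hub (kd h) C → Alt false rest C → Adj G u v → T (K u) → At K y v →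
    (own u ≡ own v → own u ≢ h) → Tr (At K y) C BState [] [] [ u , v ]
  stepHub {h} arr H a uv Ku v∈ elsewhere
    with HubAttack.attack (hubOps (Arr.self arr (here refl)) H) (hub-inactive (kd h) H) arr a uv Ku v∈ elsewhere
  ... | inj₁ t = map-tgt (λ { C' (H' , rest' , arr' , a') → hub h rest' arr' H' a' }) t
  ... | inj₂ t = map-tgt (λ { C' (now , after) → settle after (λ _ _ → refl) (hub-inactive (kd h) H , now) }) t

  stepBState : BState C → Adj G u v → T (K u) → At K y v → Tr (At K y) C BState [] [] [ u , v ]
  stepBState (double zs arr odd a) uv Ku v∈ = Double.attack arr odd a uv Ku v∈
  stepBState {C} {u} {v} (hub h rest arr H a) uv Ku v∈ with own u ≟ h | own v ≟ h
  ... | yes ou | yes ov = map-tgt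
    (λ { C' (H' , e) → hub h rest arr H' (Alt-respArr arr there (λ { z∈ (refl , b∈) → e _ z∈ b∈ }) a) })
    (only-at arr (inside-hub (kd h) H uv (ou , inj₁ Ku) (ov , v∈)))
  ... | yes ou | no ov = stepHub arr H a uv Ku v∈ (λ eq ou' → ov (trans (≡sym eq) ou'))
  ... | no ou | _ = stepHub arr H a uv Ku v∈ (λ _ → ou)

  -- Handing over the guard is a transfer with the empty `y` as its destination. The phases are read
  -- off with `y` reset to 1, which does not change the other vertices.
  giveB : B C → C y ≡ 0 → Tr (At K y) C (λ C' → C' y ≡ 1 × A C') [] [] []
  giveB {C} (double zs arr odd a) Cy = go (∈-∃++ (Arr.all arr y∈base))
    where
    go : (∃ λ r₁ → ∃ λ r₂ → zs ≡ r₁ ++ y ∷ r₂) → Tr (At K y) C (λ C' → C' y ≡ 1 × A C') [] [] []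
    go (r₁ , r₂ , refl) = map-tgt
      (λ { C' (e , b₂ , b₁) → e , r₂ ++ r₁ , rotate r₁ arr , Alt-++⁺ r₂ b₂ b₁ })
      (transfer′ r₁ r₂ arr (flip-light {c = false} yy y-only Cy) refl (trans (≡sym (nxt-mid r₁ act-y)) odd)
        (Alt-respArr arr ∈-++⁺ˡ (off λ { z∈ refl → Unique-++ r₁ (Arr.unique arr) z∈ (here refl) }) (proj₁ parts))
        (subst (λ c → Alt c r₂ C) (nxt-true r₁ refl)
          (Alt-respArr arr (∈-++⁺ʳ r₁ ∘ there)
            (off λ { z∈ refl → Unique-head (Unique-++ʳ r₁ (Arr.unique arr)) z∈ }) (proj₂ parts))))
      where
      parts = Alt-mid⁻ r₁ act-y a
      off : ∀ {r} → (∀ {z} → z ∈ r → z ≢ y) → ∀ {z a} → z ∈ r → N z a → C a ≡ (C [ y ≔ 1 ]) a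
      off ne z∈ Na = ≡sym (≔-other C 1 (≢y (N-K (ne z∈) Na)))
  giveB {C} (hub h rest arr H a) Cy = go (Arr.all arr y∈base)
    where
    h≢y : h ≢ y
    h≢y refl = ¬Hub-y H
    go : y ∈ h ∷ rest → Tr (At K y) C (λ C' → C' y ≡ 1 × A C') [] [] []
    go (here y≡h) = contradiction (≡sym y≡h) h≢y
    go (there y∈) with ∈-∃++ y∈
    ... | r₁ , r₂ , refl = map-tgt
      (λ { C' (now , e , d , (b₂ , b₁) , bal) → e , normalise (rotate (h ∷ r₁) arr)
        (Alt-mid (hub-inactive (kd h) H , now) b₂ b₁)
        ([ inj₁ , (λ even → inj₂ (trans (nxt-mid r₂ (hub-inactive (kd h) H)) (trans (nxt-comm r₁ r₂ false) even))) ]′ bal) })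
      (transfer r₁ r₂ arr (hub-release (kd h) H')
        (flip-light {c = false} yy y-only Cy) refl refl
        (Alt-respArr arr (there ∘ ∈-++⁺ˡ) (off λ { z∈ refl → Unique-++ r₁ un z∈ (here refl) }) (proj₁ parts))
        (Alt-respArr arr (there ∘ ∈-++⁺ʳ r₁ ∘ there)
            (off λ { z∈ refl → Unique-head (Unique-++ʳ r₁ un) z∈ }) (proj₂ parts)))
      where
      un : Unique (r₁ ++ y ∷ r₂)
      un = Unique-++ʳ [ h ] (Arr.unique arr)
      parts = Alt-mid⁻ r₁ act-y a
      off : ∀ {r} → (∀ {z} → z ∈ r → z ≢ y) → ∀ {z a} → z ∈ r → N z a → C a ≡ (C [ y ≔ 1 ]) a
      off ne z∈ Na = ≡sym (≔-other C 1 (≢y (N-K (ne z∈) Na)))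
      H' : Hub (kd h) C
      H' = Hub-resp (kd h) (Arr.self arr (here refl)) (λ a → off {[ h ]} (λ { (here refl) → h≢y }) (here refl)) H

  bit≤1 : ∀ c → bit c ≤ 1
  bit≤1 true = s≤s z≤n
  bit≤1 false = z≤n

  Now-bit : (k : Kind z) → Now k c C → N z u → C u ≤ 1
  Now-bit (root only) Cz Nu rewrite only _ Nu = ≤-reflexive Cz
  Now-bit {c = c} (light only) Cz Nu rewrite only _ Nu = ≤-trans (≤-reflexive Cz) (bit≤1 c)
  Now-bit (heavy P _ to _) (Cz , a) Nu with to _ Nu
  ... | inj₁ Ku = Piece.bitA P a Ku
  ... | inj₂ refl = ≤-reflexive Cz

  Hub-bit : (k : Kind z) → Hub k C → N z u → C u ≤ 1
  Hub-bit (heavy P _ to _) (Cz , b) Nu with to _ Nu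
  ... | inj₁ Ku = Piece.bitB P b Ku
  ... | inj₂ refl = ≤-reflexive Cz

  Alt-bit : Alt c r C → own u ∈ r → At K y u → C u ≤ 1
  Alt-bit a o∈ u∈ with Alt-∈ o∈ a
  ... | c , now = Now-bit (kd _) now (refl , u∈)

  bitA : A C → T (K u) → C u ≤ 1
  bitA {u = u} (rest , arr , a) Ku with Arr.all arr (own∈ u (inj₁ Ku))
  ... | here o = contradiction (y-only u (o , inj₁ Ku)) (≢y Ku)
  ... | there o∈ = Alt-bit a o∈ (inj₁ Ku)

  bitB : B C → T (K u) → C u ≤ 1
  bitB {C} {u} b Ku = subst (_≤ 1) (≔-other C 1 (≢y Ku)) (go b)
    where
    go : BState (C [ y ≔ 1 ]) → (C [ y ≔ 1 ]) u ≤ 1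
    go (double zs arr _ a) = Alt-bit a (Arr.all arr (own∈ u (inj₁ Ku))) (inj₁ Ku)
    go (hub h rest arr H a) with Arr.all arr (own∈ u (inj₁ Ku))
    ... | here o = Hub-bit (kd h) H (o , inj₁ Ku)
    ... | there o∈ = Alt-bit a o∈ (inj₁ Ku)

  block-piece : ∀ {p} → (∃ λ C → A C × ∑[ K ] C ≡ p) → Piece K y p
  block-piece init = record
    { A = A ; B = B
    ; respA = λ { e (rest , arr , a) → rest , arr , Alt-respArr arr there
        (λ z∈ Na → e _ (N-K (λ { refl → Unique-head (Arr.unique arr) z∈ }) Na)) a }
    ; respB = λ {C} {C'} e → BState-resp (agree {C} {C'} e)
    ; bitA = λ a → bitA a ; bitB = λ b → bitB b
    ; stepA = stepA
    ; stepB = λ b Cy uv Ku v∈ → map-tgt (λ _ → B⁺) (stepBState (B⁻ Cy b) uv Ku v∈)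
    ; giveB = giveB
    ; init = init }
    where
    agree : ∀ {C C'} → (∀ a → T (K a) → C' a ≡ C a) → Agree (C' [ y ≔ 1 ]) (C [ y ≔ 1 ])
    agree e a a∈ with a ≟ y | a∈
    ... | yes _ | _ = refl
    ... | no a≢y | inj₁ Ka = e a Ka
    ... | no a≢y | inj₂ a≡y = contradiction a≡y a≢y

-- Block decompositions and the lower bound

module Decomposition {n : ℕ} (G : Graph n) where
  open Flows G
  open Pieces G

  Closed : (V → Bool) → V → Set
  Closed K y = ∀ {a b} → Adj G a b → T (K a) → At K y b

  Neighbours : List V → V → V → Set
  Neighbours zs a b = Consec (cl zs) a b ⊎ Consec (cl zs) b a

  -- A block (an edge or a cycle) through y and the vertices of vs; own sends the other vertices of K
  -- to the vertex of the block at which they hang.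
  record IsBlock (K : V → Bool) (y : V) (vs : List V) (own : V → V) : Set where
    field
      unique : Unique (y ∷ vs)
      path : ∀ {a b} → Consec (cl (y ∷ vs)) a b → Adj G a b
      own-y : own y ≡ y
      own∈ : ∀ a → At K y a → own a ∈ y ∷ vs
      fixed : ∀ {z} → z ∈ vs → T (K z) × own z ≡ z
      sep : ∀ {a b} → Adj G a b → T (K a) → At K y b → own a ≡ own b ⊎ Neighbours (y ∷ vs) a b

  Sub : (V → Bool) → (V → V) → V → V → Bool
  Sub K own z a = K a ∧ (⌊ own a ≟ z ⌋ ∧ not ⌊ a ≟ z ⌋)

  Sub⁺ : ∀ {K own z a} → T (K a) → own a ≡ z → a ≢ z → T (Sub K own z a)
  Sub⁺ {z = z} {a} Ka o a≢z = ∧⁺ Ka (∧⁺ (fromWitness o) (go (a ≟ z)))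
    where
    go : (d : Dec (a ≡ z)) → T (not ⌊ d ⌋)
    go (yes a≡z) = contradiction a≡z a≢z
    go (no _) = tt

  Sub⁻ : ∀ {K own z a} → T (Sub K own z a) → T (K a) × own a ≡ z × a ≢ z
  Sub⁻ {K} {own} {z} {a} t with ∧⁻ {K a} t
  ... | Ka , t' with ∧⁻ {⌊ own a ≟ z ⌋} t'
  ...   | o , a≢ = Ka , toWitness o , go (a ≟ z) a≢
    where
    go : (d : Dec (a ≡ z)) → T (not ⌊ d ⌋) → a ≢ z
    go (no a≢z) _ = a≢z

  z∉Sub : ∀ {K own z} → ¬ T (Sub K own z z)
  z∉Sub {K} {own} t = proj₂ (proj₂ (Sub⁻ {K} {own} t)) refl

  At-Sub : ∀ {K own z a} → T (K a) → own a ≡ z → At (Sub K own z) z a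
  At-Sub {K} {own} {z} {a} Ka o = case a ≟ z of λ
    { (yes a≡z) → inj₂ a≡z ; (no a≢z) → inj₁ (Sub⁺ {K} {own} Ka o a≢z) }

  -- An edge between different owners joins two vertices of the block, and those own themselves; so
  -- a vertex other than `z` that hangs at `z` has no such edge.
  closed-Sub : ∀ {K y vs own z} → IsBlock K y vs own → ¬ T (K y) → Closed K y → z ∈ y ∷ vs → Closed (Sub K own z) z
  closed-Sub {K} {y} {vs} {own} {z} isBlock y∉K closed z∈ {a} {b} ab t with Sub⁻ {K} {own} t
  ... | Ka , o , a≢z with IsBlock.sep isBlock ab Ka (closed ab Ka)
  ...   | inj₁ same with closed ab Ka
  ...     | inj₁ Kb = At-Sub {K} {own} Kb (trans (≡sym same) o)
  ...     | inj₂ refl = inj₂ (trans (≡sym (IsBlock.own-y isBlock)) (trans (≡sym same) o))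
  closed-Sub {K} {y} {vs} {own} {z} isBlock y∉K closed z∈ {a} {b} ab t | Ka , o , a≢z | inj₂ near =
    contradiction (trans (≡sym (on-block ([ proj₁ ∘ Consec-∈ , proj₂ ∘ Consec-∈ ]′ near))) o) a≢z
    where
    on-block : a ∈ cl (y ∷ vs) → own a ≡ a
    on-block (here refl) = IsBlock.own-y isBlock
    on-block (there a∈) with ∈-++⁻ vs a∈
    ... | inj₁ a∈vs = proj₂ (IsBlock.fixed isBlock a∈vs)
    ... | inj₂ (here refl) = IsBlock.own-y isBlock

  -- The case `z = y` is included: the part hanging there consists of what is left at `y` outside
  -- the chosen block.
  data Bundle (K : V → Bool) (y : V) : Set where
    none : (∀ a → ¬ T (K a)) → Bundle K y
    some : ∀ v vs own → IsBlock K y (v ∷ vs) own → (∀ z → z ∈ y ∷ v ∷ vs → Bundle (Sub K own z) z) → Bundle K y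

  -- A move of a class on a supergraph in which x is the only vertex of G with further neighbours.
  OpenMove : V → Config n → Config n → V → V → Set
  OpenMove x C C' u v = Σ (V → V → ℕ) λ f →
      (∀ a b → 1 ≤ f a b → a ≡ b ⊎ Adj G a b)
    × (∀ a → ∑ (f a) ≤ C a)
    × (∀ b → b ≢ x → C' b ≤ ∑ (λ a → f a b))
    × (1 ≤ f u v ⊎ 1 ≤ f v u)

  module LowerBound (x : V) (Cls : Config n → Set)
    (respond : ∀ C → Cls C → ∀ u v → Adj G u v → ∃ λ C' → Cls C' × OpenMove x C C' u v) where

    private variable
      K Z : V → Bool
      C : Config n
      u v y z : V
      p : ℕ

    covered : Cls C → Adj G u v → C u ≡ 0 → C v ≡ 0 → ⊥
    covered {u = u} {v} c uv Cu Cv with respond _ c u v uv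
    ... | _ , _ , f , _ , rows , _ , inj₁ hit =
      contradiction (≤-trans hit (≤-trans (term≤∑ (f u) v) (≤-trans (rows u) (≤-reflexive Cu)))) λ ()
    ... | _ , _ , f , _ , rows , _ , inj₂ hit =
      contradiction (≤-trans hit (≤-trans (term≤∑ (f v) u) (≤-trans (rows v) (≤-reflexive Cv)))) λ ()

    -- If all neighbours of Z are empty, then an attack on an edge leaving Z costs Z a guard.
    escape : Cls C → ¬ T (Z x) → ¬ T (Z u) → T (Z v) → Adj G u v →
      (∀ {a b} → Adj G a b → T (Z a) → ¬ T (Z b) → C b ≡ 0) →
      ∃ λ C' → Cls C' × suc (∑[ Z ] C') ≤ ∑[ Z ] C
    escape {C} {Z} {u} {v} c x∉Z u∉Z v∈Z uv empty with respond C c u v uv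
    ... | C' , c' , f , legal , rows , cols , hit = C' , c' , (begin
        suc (∑[ Z ] C')                                      ≤⟨ s≤s (∑-mono col) ⟩
        suc (∑ (λ b → ∑ (λ a → within a b)))                 ≡⟨ +-comm 1 _ ⟩
        ∑ (λ b → ∑ (λ a → within a b)) + 1                   ≡⟨ cong₂ _+_ (∑-swap (λ b a → within a b)) (≡sym one) ⟩
        ∑ (λ a → ∑ (within a)) + ∑ (λ a → ∑ (leaving a))     ≡⟨ ≡sym (∑-+ (λ a → ∑ (within a)) (λ a → ∑ (leaving a))) ⟩
        ∑ (λ a → ∑ (within a) + ∑ (leaving a))               ≤⟨ ∑-mono row ⟩
        ∑[ Z ] C                                             ∎)
      where
      open ≤-Reasoning
      zero-row : ∀ {a b} → C a ≡ 0 → f a b ≡ 0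
      zero-row {a} {b} Ca = n≤0⇒n≡0 (≤-trans (term≤∑ (f a) b) (≤-trans (rows a) (≤-reflexive Ca)))
      -- `u` is empty, so the attacked edge can be traversed only out of `Z`.
      leave : 1 ≤ f v u
      leave = [ (λ h → contradiction (≤-trans h (≤-reflexive (zero-row (empty (Adj-sym uv) v∈Z u∉Z)))) λ ()) , id ]′ hit
      within leaving : V → V → ℕ
      within a b = if Z b then (if Z a then f a b else 0) else 0
      leaving a b = δ v a * δ u b
      one : ∑ (λ a → ∑ (leaving a)) ≡ 1
      one = trans (∑-supported v λ a a≢v → trans (∑-cong λ b → cong (_* δ u b) (δ-≢ (a≢v ∘ ≡sym))) (∑-zero n))
        (trans (∑-cong λ b → trans (cong (_* δ u b) (δ-refl v)) (*-identityˡ _)) (∑-δ u))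
      col : ∀ b → (if Z b then C' b else 0) ≤ ∑ (λ a → within a b)
      col b with Z b in eq
      ... | false = z≤n
      ... | true = ≤-trans (cols b λ { refl → x∉Z (subst T (≡sym eq) tt) }) (∑-mono inside)
        where
        inside : ∀ a → f a b ≤ (if Z a then f a b else 0)
        inside a with Z a in eqa
        ... | true = ≤-refl
        ... | false with f a b in fab
        ...   | zero = z≤n
        ...   | suc k with legal a b (subst (1 ≤_) (≡sym fab) (s≤s z≤n))
        ...     | inj₁ refl = contradiction (trans (≡sym eq) eqa) λ ()
        ...     | inj₂ ab = contradiction (trans (≡sym fab) (zero-row
                    (empty (Adj-sym ab) (subst T (≡sym eq) tt) (λ t → subst T eqa t)))) λ ()
      row : ∀ a → ∑ (within a) + ∑ (leaving a) ≤ (if Z a then C a else 0)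
      row a with Z a in eqa
      ... | false = ≤-reflexive (trans (cong₂ _+_
              (trans (∑-cong λ b → off b) (∑-zero n))
              (trans (∑-cong λ b → cong (_* δ u b) (δ-≢ λ v≡a → subst T (trans (cong Z v≡a) eqa) v∈Z)) (∑-zero n))) refl)
        where
        off : ∀ b → (if Z b then 0 else 0) ≡ 0
        off b with Z b
        ... | true = refl
        ... | false = refl
      ... | true = ≤-trans (≤-trans (≤-reflexive (≡sym (∑-+ (λ b → if Z b then f a b else 0) (leaving a)))) (∑-mono entry)) (rows a)
        where
        entry : ∀ b → (if Z b then f a b else 0) + δ v a * δ u b ≤ f a b
        entry b with Z b in eqb
        ... | true = ≤-reflexive (trans (cong (f a b +_) (trans (cong (δ v a *_)
                (δ-≢ λ u≡b → u∉Z (subst T (≡sym (trans (cong Z u≡b) eqb)) tt))) (*-zeroʳ (δ v a)))) (+-identityʳ _))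
        ... | false with v ≟ a | u ≟ b
        ...   | yes refl | yes refl = leave
        ...   | yes refl | no _ = z≤n
        ...   | no _ | _ = z≤n

    Least : (V → Bool) → ℕ → Set
    Least K p = ∀ {C} → Cls C → p ≤ ∑[ K ] C

    -- With `y` empty no guard can enter `K`, and an attack on `yv` drives one out; the next
    -- configuration still has `p` guards on `K`. This is why a heavy vertex counts one more than
    -- its part, whether or not it is occupied.
    Least-root : Least K p → Closed K y → ¬ T (K y) → ¬ T (K x) → Adj G y v → T (K v) →
      Cls C → C y ≡ 0 → suc p ≤ ∑[ K ] C
    Least-root {K} {y = y} {C = C} least closed y∉K x∉K yv Kv c Cy with escape {Z = K} c x∉K y∉K Kv yv outside
      where
      outside : ∀ {a b} → Adj G a b → T (K a) → ¬ T (K b) → C b ≡ 0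
      outside ab Ka ¬Kb with closed ab Ka
      ... | inj₁ Kb = contradiction Kb ¬Kb
      ... | inj₂ refl = Cy
    ... | C' , c' , less = ≤-trans (s≤s (least c')) less

    -- The same `p` is a lower bound for the class and enough for a strategy. The edge into `K` is
    -- the one attacked in `Least-root`.
    data Solved (K : V → Bool) (y : V) : Set₁ where
      empty : (∀ a → ¬ T (K a)) → Solved K y
      solved : ∀ p → ∃ (λ v → T (K v) × Adj G y v) → Least K p → Piece K y p → Solved K y

  -- Optimal number of guards on one block

  module SolveBlock (x : V) (Cls : Config n → Set)
    (respond : ∀ C → Cls C → ∀ u v → Adj G u v → ∃ λ C' → Cls C' × OpenMove x C C' u v)
    {K : V → Bool} {y v : V} {vs' : List V} {own : V → V} (isBlock : IsBlock K y (v ∷ vs') own)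
    (y∉K : ¬ T (K y)) (closed : Closed K y) (x∉K : ¬ T (K x))
    (subs : ∀ z → z ∈ y ∷ v ∷ vs' → LowerBound.Solved x Cls respond (Sub K own z) z) where
    open LowerBound x Cls respond
    open IsBlock isBlock
    open Owner K own

    vs base : List V
    vs = v ∷ vs'
    base = y ∷ vs

    K₁ : V → Bool
    K₁ = Zone vs

    y∉vs : y ∉ vs
    y∉vs = Unique-head unique

    y∉K₁ : ¬ T (K₁ y)
    y∉K₁ t = y∉K (proj₁ (Zone⁻ t))

    open Block G K₁ y y∉K₁ own

    y-only : ∀ a → N y a → a ≡ y
    y-only a (o , inj₁ K₁a) = contradiction (subst (_∈ vs) o (proj₂ (Zone⁻ K₁a))) y∉vs
    y-only a (o , inj₂ a≡y) = a≡y

    N-K : ∀ {z a} → z ∈ vs → N z a → T (K a)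
    N-K z∈ (_ , inj₁ K₁a) = proj₁ (Zone⁻ K₁a)
    N-K z∈ (o , inj₂ refl) = contradiction (subst (_∈ vs) (trans (≡sym o) own-y) z∈) y∉vs

    N-Sub : ∀ {z a} → z ∈ vs → N z a → At (Sub K own z) z a
    N-Sub z∈ Na = At-Sub {K} {own} (N-K z∈ Na) (proj₁ Na)

    Sub-N : ∀ {z a} → z ∈ vs → At (Sub K own z) z a → N z a
    Sub-N z∈ (inj₁ t) = let (Ka , o , _) = Sub⁻ {K} {own} t in o , inj₁ (Zone⁺ Ka (subst (_∈ vs) (≡sym o) z∈))
    Sub-N z∈ (inj₂ refl) = let (Kz , o) = fixed z∈ in o , inj₁ (Zone⁺ Kz (subst (_∈ vs) (≡sym o) z∈))

    open import Data.List.Membership.DecPropositional (_≟_ {n}) using (_∈?_)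

    kind-of : ∀ {z} → z ∈ vs → Solved (Sub K own z) z → Kind z
    kind-of z∈ (empty ∄) = light λ a Na → [ (λ t → contradiction t (∄ a)) , id ]′ (N-Sub z∈ Na)
    kind-of z∈ (solved p _ _ P) = heavy P (z∉Sub {K} {own}) (λ a → N-Sub z∈) (λ a → Sub-N z∈)

    kd : ∀ z → Kind z
    kd z with z ≟ y | z ∈? vs
    ... | yes refl | _ = root y-only
    ... | no _ | yes z∈ = kind-of z∈ (subs z (there z∈))
    -- Off the block `N z` is empty, so `root` is a default value.
    ... | no z≢y | no z∉ = root λ { a (refl , inj₁ K₁a) → contradiction (proj₂ (Zone⁻ K₁a)) z∉
                                  ; a (o , inj₂ refl) → contradiction (trans (≡sym o) own-y) z≢y }

    kd-y : kd y ≡ root y-only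
    kd-y with y ≟ y
    ... | yes refl = refl
    ... | no y≢y = contradiction refl y≢y

    kd-vs : ∀ {z} → z ∈ vs → ∃ λ (z∈ : z ∈ vs) → kd z ≡ kind-of z∈ (subs z (there z∈))
    kd-vs {z} z∈ with z ≟ y | z ∈? vs
    ... | yes refl | _ = contradiction z∈ y∉vs
    ... | no _ | yes z∈' = z∈' , refl
    ... | no _ | no z∉ = contradiction z∈ z∉

    open Cyclic kd

    weight : ∀ {z} → Kind z → Bool → ℕ
    weight (root _) c = 0
    weight (light _) c = bit c
    weight (heavy {p = p} _ _ _ _) c = suc p

    -- The number of guards in the alternation with phase `c`. For `false` the first light vertex is
    -- empty, so L light vertices contribute ⌊L / 2⌋, and this is the sum p of the overview.
    W : Bool → List V → ℕ
    W c [] = 0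
    W c (z ∷ zs) = weight (kd z) c + W (act (kd z) xor c) zs

    W-++ : ∀ c xs {ys} → W c (xs ++ ys) ≡ W c xs + W (nxt xs c) ys
    W-++ c [] = refl
    W-++ c (z ∷ xs) = trans (cong (weight (kd z) c +_) (W-++ _ xs)) (≡sym (+-assoc (weight (kd z) c) _ _))

    -- A pair of consecutive light vertices holds one guard in either phase, so only an unpaired
    -- light vertex makes a difference.
    W-true : ∀ xs → W true xs ≡ W false xs + bit (nxt xs false)
    W-true [] = refl
    W-true (z ∷ xs) with kd z
    ... | root _ = W-true xs
    ... | heavy {p = p} _ _ _ _ = trans (cong (suc p +_) (W-true xs)) (≡sym (+-assoc (suc p) _ _))
    ... | light _ rewrite W-true xs | nxt-not xs false | +-assoc (W false xs) (bit (nxt xs false)) (bit (not (nxt xs false))) = trans (+-comm 1 (W false xs)) (cong (W false xs +_) (one (nxt xs false)))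
      where
      one : ∀ b → 1 ≡ bit b + bit (not b)
      one true = refl
      one false = refl

    Zone-++ : ∀ xs {ys} → Unique (xs ++ ys) → ∀ C → ∑[ Zone (xs ++ ys) ] C ≡ ∑[ Zone xs ] C + ∑[ Zone ys ] C
    Zone-++ [] {ys} un C = cong (_+ ∑[ Zone ys ] C) (≡sym (∑[]-empty (Zone []) C λ a t → case proj₂ (Zone⁻ {[]} t) of λ ()))
    Zone-++ (z ∷ xs) {ys} un@(_ ∷ un') C = begin
      ∑[ Zone (z ∷ xs ++ ys) ] C                              ≡⟨ ∑[]-split (Zone-split (Unique-head un)) C ⟩
      ∑[ Zone [ z ] ] C + ∑[ Zone (xs ++ ys) ] C              ≡⟨ cong (_ +_) (Zone-++ xs un' C) ⟩
      ∑[ Zone [ z ] ] C + (∑[ Zone xs ] C + ∑[ Zone ys ] C)   ≡⟨ ≡sym (+-assoc (∑[ Zone [ z ] ] C) _ _) ⟩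
      ∑[ Zone [ z ] ] C + ∑[ Zone xs ] C + ∑[ Zone ys ] C     ≡⟨ cong (_+ _) (≡sym (∑[]-split (Zone-split z∉xs) C)) ⟩
      ∑[ Zone (z ∷ xs) ] C + ∑[ Zone ys ] C                   ∎
      where
      open ≡-Reasoning
      z∉xs : z ∉ xs
      z∉xs = Unique-head un ∘ ∈-++⁺ˡ

    Zone-site : ∀ {z} → z ∈ vs → ∀ C → ∑[ Zone [ z ] ] C ≡ C z + ∑[ Sub K own z ] C
    Zone-site {z} z∈ C = trans
      (∑[]-split (Zone-singleton-split (proj₁ (fixed z∈)) (proj₂ (fixed z∈)) (λ a → Sub⁻ {K} {own}) (λ a → Sub⁺ {K} {own})) C)
      (cong (_+ ∑[ Sub K own z ] C) (∑[]-point {K = λ a → ⌊ a ≟ z ⌋} (fromWitness refl) (λ a → toWitness) C))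

    x∉Zone : ∀ zs → ¬ T (Zone zs x)
    x∉Zone zs t = x∉K (proj₁ (Zone⁻ {zs} t))

    site-light : ∀ {z C} → z ∈ vs → act (kd z) ≡ true → ∑[ Zone [ z ] ] C ≡ C z
    site-light {z} {C} z∈ active with kd-vs z∈
    ... | z∈' , e with subs z (there z∈')
    ...   | empty ∄ = trans (Zone-site z∈ C) (trans (cong (C z +_) (∑[]-empty _ C ∄)) (+-identityʳ _))
    ...   | solved _ _ _ _ = contradiction (trans (≡sym active) (cong act e)) λ ()

    weight-light : ∀ z → act (kd z) ≡ true → ∀ c → weight (kd z) c ≡ bit c
    weight-light z active c with kd z
    ... | light _ = refl

    -- If `z` is occupied, its guard is added to the least number on the part; if it is empty,
    -- `Least-root` finds one more on the part.
    site-heavy : ∀ {z C c} → z ∈ vs → Cls C → act (kd z) ≡ false → weight (kd z) c ≤ ∑[ Zone [ z ] ] C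
    site-heavy {z} {C} {c} z∈ cC inactive with kd-vs z∈
    ... | z∈' , e with subs z (there z∈')
    ...   | empty _ = contradiction (trans (≡sym (cong act e)) inactive) λ ()
    ...   | solved p (w , Sw , zw) least P rewrite e = ≤-trans bound (≤-reflexive (≡sym (Zone-site z∈ C)))
      where
      bound : suc p ≤ C z + ∑[ Sub K own z ] C
      bound with C z in Cz
      ... | suc k = ≤-trans (s≤s (least cC)) (s≤s (m≤n+m _ k))
      ... | zero = Least-root least (closed-Sub isBlock y∉K closed (there z∈)) (z∉Sub {K} {own}) (λ t → x∉K (proj₁ (Sub⁻ {K} {own} t))) zw Sw cC Cz

    -- As an inner vertex, `a` occurs only once in the closed walk, so its neighbours on the block
    -- are the entries beside it.
    inner-neighbour : ∀ {a b l r} P Z S → vs ≡ P ++ l ∷ Z ++ r ∷ S → a ∈ Z → Neighbours base a b → b ∈ l ∷ Z ++ [ r ]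
    inner-neighbour {a} {b} {l} {r} P Z S e a∈ near = [ forward , backward ]′ near
      where
      shape : cl base ≡ (y ∷ P ++ [ l ]) ++ Z ++ r ∷ S ++ [ y ]
      shape = cong (y ∷_) (begin
        vs ++ [ y ]                            ≡⟨ cong (_++ [ y ]) e ⟩
        (P ++ l ∷ Z ++ r ∷ S) ++ [ y ]         ≡⟨ ++-assoc P _ [ y ] ⟩
        P ++ l ∷ (Z ++ r ∷ S) ++ [ y ]         ≡⟨ cong (λ t → P ++ l ∷ t) (++-assoc Z (r ∷ S) [ y ]) ⟩
        P ++ l ∷ Z ++ r ∷ S ++ [ y ]           ≡⟨ ≡sym (++-assoc P [ l ] _) ⟩
        (P ++ [ l ]) ++ Z ++ r ∷ S ++ [ y ]    ∎)
        where open ≡-Reasoning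
      un : Unique (P ++ l ∷ Z ++ r ∷ S)
      un = subst Unique e (Unique-++ʳ [ y ] unique)
      a∈vs : a ∈ vs
      a∈vs = subst (a ∈_) (≡sym e) (∈-++⁺ʳ P (there (∈-++⁺ˡ a∈)))
      a≢y : a ≢ y
      a≢y refl = y∉vs a∈vs
      a∉P : a ∉ P
      a∉P a∈P = Unique-++ P un a∈P (there (∈-++⁺ˡ a∈))
      a≢l : a ≢ l
      a≢l refl = Unique-head (Unique-++ʳ P un) (∈-++⁺ˡ a∈)
      a∉rS : a ∉ r ∷ S ++ [ y ]
      a∉rS a∈' with ∈-++⁻ (r ∷ S) a∈'
      ... | inj₁ a∈rS = Unique-++ Z (Unique-++ʳ (l ∷ []) (Unique-++ʳ P un)) a∈ a∈rS
      ... | inj₂ (here a≡y) = a≢y a≡y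
      forward : Consec (cl base) a b → b ∈ l ∷ Z ++ [ r ]
      forward c = there (Consec-after Z a∉rS (Consec-drop (y ∷ P ++ [ l ])
        (λ { (here a≡y) → a≢y a≡y
           ; (there a∈') → [ a∉P , (λ { (here a≡l) → a≢l a≡l }) ]′ (∈-++⁻ P a∈') })
        (subst (λ t → Consec t a b) shape c)))
      backward : Consec (cl base) b a → b ∈ l ∷ Z ++ [ r ]
      backward c = [ here , there ∘ ∈-++⁺ˡ ]′ (split (Consec-before Z a∉rS (Consec-drop′ (y ∷ P)
        (λ { (here a≡y) → a≢y a≡y ; (there a∈P) → a∉P a∈P }) a≢l
        (subst (λ t → Consec t b a) (trans shape (cong (y ∷_) (++-assoc P [ l ] _))) c))))
        where
        split : b ∈ l ∷ Z → b ≡ l ⊎ b ∈ Z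
        split (here e) = inj₁ e
        split (there e) = inj₂ e

    -- Two empty light vertices cannot enclose a segment Z with the least possible number of guards: an
    -- attack on the edge from the first of them into Z would leave Z with too few guards.
    enclosed : ∀ {C l r k} P Z S → vs ≡ P ++ l ∷ Z ++ r ∷ S → Cls C → C l ≡ 0 → C r ≡ 0 →
      (∀ {C'} → Cls C' → k ≤ ∑[ Zone Z ] C') → suc k ≤ ∑[ Zone Z ] C
    -- With nothing in between, the two empty vertices are adjacent, and an attack on their edge
    -- cannot be answered.
    enclosed {l = l} {r} P [] S e c Cl Cr least = contradiction
      (path {l} {r} (there (Consec-++ˡ (subst (λ t → Consec t l r) (≡sym e) (Consec-++ʳ P here))))) (λ lr → covered c lr Cl Cr)
    enclosed {C} {l} {r} P Z@(z ∷ Z') S e c Cl Cr least with escape {Z = Zone Z} c (x∉Zone Z) l∉ z∈ lz outside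
      where
      un : Unique (l ∷ Z ++ r ∷ S)
      un = Unique-++ʳ P (subst Unique e (Unique-++ʳ [ y ] unique))
      Z⊆vs : ∀ {a} → a ∈ l ∷ Z ++ r ∷ S → a ∈ vs
      Z⊆vs a∈ = subst (_ ∈_) (≡sym e) (∈-++⁺ʳ P a∈)
      l∉ : ¬ T (Zone Z l)
      l∉ t = Unique-head un (∈-++⁺ˡ (subst (_∈ Z) (proj₂ (fixed (Z⊆vs (here refl)))) (proj₂ (Zone⁻ {Z} t))))
      z∈ : T (Zone Z z)
      z∈ = let (Kz , o) = fixed (Z⊆vs (there (here refl))) in Zone⁺ Kz (here o)
      lz : Adj G l z
      lz = path (there (Consec-++ˡ (subst (λ t → Consec t l z) (≡sym e) (Consec-++ʳ P here))))
      outside : ∀ {a b} → Adj G a b → T (Zone Z a) → ¬ T (Zone Z b) → C b ≡ 0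
      outside {a} {b} ab t ¬t with Zone⁻ {Z} t
      ... | Ka , oa with closed ab Ka
      ...   | b∈ with sep ab Ka b∈
      ...     | inj₁ same with b∈
      ...       | inj₁ Kb = contradiction (Zone⁺ Kb (subst (_∈ Z) same oa)) ¬t
      ...       | inj₂ refl = contradiction (Z⊆vs (there (∈-++⁺ˡ (subst (_∈ Z) (trans same own-y) oa)))) y∉vs
      outside {a} {b} ab t ¬t | Ka , oa | b∈ | inj₂ near = at-end (inner-neighbour P Z S e (subst (_∈ Z) own-a oa) near)
        where
        own-a : own a ≡ a
        own-a with ∈-++⁻ vs (drop-y ([ proj₁ ∘ Consec-∈ , proj₂ ∘ Consec-∈ ]′ near))
          where
          drop-y : a ∈ cl base → a ∈ vs ++ [ y ]
          drop-y (here refl) = contradiction Ka y∉K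
          drop-y (there a∈) = a∈
        ... | inj₁ a∈vs = proj₂ (fixed a∈vs)
        ... | inj₂ (here refl) = contradiction Ka y∉K
        at-end : b ∈ l ∷ Z ++ [ r ] → C b ≡ 0
        at-end (here refl) = Cl
        at-end (there b∈') with ∈-++⁻ Z b∈'
        ... | inj₂ (here refl) = Cr
        ... | inj₁ b∈Z = contradiction (Zone⁺ Kb (subst (_∈ Z) (≡sym ob) b∈Z)) ¬t
          where
          Kb = proj₁ (fixed (Z⊆vs (there (∈-++⁺ˡ b∈Z))))
          ob = proj₂ (fixed (Z⊆vs (there (∈-++⁺ˡ b∈Z))))
    ... | C' , c' , less = ≤-trans (s≤s (least c')) less

    init-view : ∀ (xs : List V) → xs ≢ [] → ∃ λ ys → ∃ λ z → xs ≡ ys ++ [ z ]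
    init-view [] ne = contradiction refl ne
    init-view (x ∷ []) ne = [] , x , refl
    init-view (x ∷ x' ∷ xs) ne with init-view (x' ∷ xs) (λ ())
    ... | ys , z , e = x ∷ ys , z , cong (x ∷_) e

    -- By induction on the length, cutting off a vertex at either end.
    segment : ∀ k P R S → length R ≤ k → vs ≡ P ++ R ++ S → ∀ {C} → Cls C → W false R ≤ ∑[ Zone R ] C
    segment k P [] S _ e c = z≤n
    segment (suc k) P (l ∷ R) S (s≤s len) e {C} c = by-kind (act (kd l)) refl
      where
      open ≤-Reasoning
      un : Unique (l ∷ R ++ S)
      un = Unique-++ʳ P (subst Unique e (Unique-++ʳ [ y ] unique))
      unR : Unique (l ∷ R)
      unR = Unique-++ˡ (l ∷ R) un
      in-vs : ∀ {a} → a ∈ l ∷ R → a ∈ vs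
      in-vs a∈ = subst (_ ∈_) (≡sym e) (∈-++⁺ʳ P (∈-++⁺ˡ a∈))
      e-tail : vs ≡ (P ++ [ l ]) ++ R ++ S
      e-tail = trans e (≡sym (++-assoc P [ l ] _))
      rest : W false R ≤ ∑[ Zone R ] C
      rest = segment k (P ++ [ l ]) R S len e-tail c
      cut : ∑[ Zone (l ∷ R) ] C ≡ ∑[ Zone [ l ] ] C + ∑[ Zone R ] C
      cut = Zone-++ [ l ] unR C
      by-kind : ∀ b → act (kd l) ≡ b → W false (l ∷ R) ≤ ∑[ Zone (l ∷ R) ] C
      by-kind false inactive = begin
        weight (kd l) false + W (act (kd l) xor false) R
          ≡⟨ cong (λ b → weight (kd l) false + W (b xor false) R) inactive ⟩
        weight (kd l) false + W false R
          ≤⟨ +-mono-≤ (site-heavy (in-vs (here refl)) c inactive) rest ⟩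
        ∑[ Zone [ l ] ] C + ∑[ Zone R ] C
          ≡⟨ ≡sym cut ⟩
        ∑[ Zone (l ∷ R) ] C ∎
      by-kind true active = begin
        weight (kd l) false + W (act (kd l) xor false) R
          ≡⟨ cong₂ (λ w b → w + W (b xor false) R) (weight-light l active false) active ⟩
        W true R                              ≡⟨ W-true R ⟩
        W false R + bit (nxt R false)         ≤⟨ by-parity (nxt R false) refl ⟩
        ∑[ Zone (l ∷ R) ] C ∎
        where
        by-parity : ∀ b → nxt R false ≡ b → W false R + bit b ≤ ∑[ Zone (l ∷ R) ] C
        -- The light vertices of `R` pair up without `l`, which therefore adds nothing to the bound.
        by-parity false _ = begin
          W false R + 0        ≡⟨ +-identityʳ _ ⟩
          W false R            ≤⟨ rest ⟩
          ∑[ Zone R ] C        ≤⟨ m≤n+m _ (∑[ Zone [ l ] ] C) ⟩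
          ∑[ Zone [ l ] ] C + ∑[ Zone R ] C ≡⟨ ≡sym cut ⟩
          ∑[ Zone (l ∷ R) ] C  ∎
        -- Here `l` completes a pair and the bound for `R` is one short; the last vertex of `R`
        -- decides how to continue.
        by-parity true odd with init-view R (λ { refl → contradiction odd λ () })
        ... | Z , r , refl = by-end (act (kd r)) refl
          where
          r∈ : r ∈ vs
          r∈ = in-vs (there (∈-++⁺ʳ Z (here refl)))
          len-Z : suc (length Z) ≤ k
          len-Z = ≤-trans (≤-reflexive (≡sym (trans (length-++ Z) (+-comm _ 1)))) len
          e-Z : vs ≡ P ++ l ∷ Z ++ r ∷ S
          e-Z = trans e (cong (λ t → P ++ l ∷ t) (++-assoc Z [ r ] S))
          cut-r : ∑[ Zone (l ∷ Z ++ [ r ]) ] C ≡ ∑[ Zone (l ∷ Z) ] C + ∑[ Zone [ r ] ] C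
          cut-r = Zone-++ (l ∷ Z) unR C
          cut-l : ∑[ Zone (l ∷ Z) ] C ≡ ∑[ Zone [ l ] ] C + ∑[ Zone Z ] C
          cut-l = Zone-++ [ l ] (Unique-++ˡ (l ∷ Z) unR) C
          nxt-r : nxt Z false ≡ act (kd r) xor true
          nxt-r = back (act (kd r)) (nxt Z false) (trans (≡sym (nxt-++ Z [ r ] false)) odd)
            where
            back : ∀ a b → a xor b ≡ true → b ≡ a xor true
            back true false _ = refl
            back false true _ = refl
          by-end : ∀ b → act (kd r) ≡ b → W false (Z ++ [ r ]) + 1 ≤ ∑[ Zone (l ∷ Z ++ [ r ]) ] C
          -- A vertex that is not light accounts for its own weight; without it the segment is
          -- shorter and still starts with `l`.
          by-end false inactive = begin
            W false (Z ++ [ r ]) + 1                      ≡⟨ cong (_+ 1) (W-++ false Z) ⟩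
            W false Z + (weight (kd r) b + 0) + 1         ≡⟨ cong (λ w → W false Z + w + 1) (+-identityʳ _) ⟩
            W false Z + weight (kd r) b + 1               ≡⟨ +-assoc (W false Z) _ 1 ⟩
            W false Z + (weight (kd r) b + 1)             ≡⟨ cong (W false Z +_) (+-comm _ 1) ⟩
            W false Z + (1 + weight (kd r) b)             ≡⟨ ≡sym (+-assoc (W false Z) 1 _) ⟩
            W false Z + 1 + weight (kd r) b               ≡⟨ cong (λ d → W false Z + bit d + weight (kd r) b) (≡sym (trans nxt-r (cong (_xor true) inactive))) ⟩
            W false Z + bit (nxt Z false) + weight (kd r) b ≡⟨ cong (_+ weight (kd r) b) (≡sym (W-true Z)) ⟩
            W true Z + weight (kd r) b                    ≡⟨ cong₂ (λ w b' → w + W (b' xor false) Z + weight (kd r) b) (≡sym (weight-light l active false)) (≡sym active) ⟩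
            W false (l ∷ Z) + weight (kd r) b             ≤⟨ +-mono-≤ shorter (site-heavy r∈ c inactive) ⟩
            ∑[ Zone (l ∷ Z) ] C + ∑[ Zone [ r ] ] C       ≡⟨ ≡sym cut-r ⟩
            ∑[ Zone (l ∷ Z ++ [ r ]) ] C                  ∎
            where
            b = nxt Z false
            shorter : W false (l ∷ Z) ≤ ∑[ Zone (l ∷ Z) ] C
            shorter = segment k P (l ∷ Z) (r ∷ S) len-Z e-Z c
          -- Both ends are light. A guard on either one is the guard that is missing; if both are
          -- empty, `enclosed` finds it between them.
          by-end true active-r = begin
            W false (Z ++ [ r ]) + 1                      ≡⟨ cong (_+ 1) (W-++ false Z) ⟩
            W false Z + (weight (kd r) (nxt Z false) + 0) + 1
              ≡⟨ cong (λ w → W false Z + (w + 0) + 1) (trans (weight-light r active-r _) (cong bit even)) ⟩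
            W false Z + 0 + 1                             ≡⟨ trans (cong (_+ 1) (+-identityʳ _)) (+-comm _ 1) ⟩
            suc (W false Z)                               ≤⟨ by-ends (zero-or-positive (C l)) (zero-or-positive (C r)) ⟩
            C l + ∑[ Zone Z ] C + C r                     ≡⟨ ≡sym (cong₂ (λ s t → s + ∑[ Zone Z ] C + t) (site-light (in-vs (here refl)) active) (site-light r∈ active-r)) ⟩
            ∑[ Zone [ l ] ] C + ∑[ Zone Z ] C + ∑[ Zone [ r ] ] C ≡⟨ cong (_+ ∑[ Zone [ r ] ] C) (≡sym cut-l) ⟩
            ∑[ Zone (l ∷ Z) ] C + ∑[ Zone [ r ] ] C       ≡⟨ ≡sym cut-r ⟩
            ∑[ Zone (l ∷ Z ++ [ r ]) ] C                  ∎
            where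
            even : nxt Z false ≡ false
            even = trans nxt-r (cong (_xor true) active-r)
            least : ∀ {C'} → Cls C' → W false Z ≤ ∑[ Zone Z ] C'
            least = segment k (P ++ [ l ]) Z (r ∷ S) (<⇒≤ len-Z)
              (trans e-Z (≡sym (++-assoc P [ l ] _)))
            by-ends : C l ≡ 0 ⊎ 1 ≤ C l → C r ≡ 0 ⊎ 1 ≤ C r → suc (W false Z) ≤ C l + ∑[ Zone Z ] C + C r
            by-ends (inj₂ Cl) _ = ≤-trans (+-mono-≤ Cl (least c)) (m≤m+n _ _)
            by-ends (inj₁ _) (inj₂ Cr) = ≤-trans (≤-reflexive (+-comm 1 _)) (+-mono-≤ (≤-trans (least c) (m≤n+m _ (C l))) Cr)
            by-ends (inj₁ Cl) (inj₁ Cr) = ≤-trans (enclosed P Z S e-Z c Cl Cr least)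
              (≤-trans (m≤n+m _ (C l)) (m≤m+n _ _))

    least-block : Least K₁ (W false vs)
    least-block = segment (length vs) [] vs [] ≤-refl (≡sym (++-identityʳ vs))

    own∈-base : ∀ a → At K₁ y a → own a ∈ base
    own∈-base a (inj₁ K₁a) = there (proj₂ (Zone⁻ K₁a))
    own∈-base a (inj₂ refl) = here own-y

    open BlockMoves G K₁ y y∉K₁ own kd base (Neighbours base) own∈-base using (Arr)

    arr : Arr base
    arr = record
      { path = path ; covers = id ; unique = unique
      ; self = λ { (here refl) → own-y , inj₂ refl ; (there z∈) → Sub-N z∈ (inj₂ refl) }
      ; all = id }

    init-site : ∀ {z} → z ∈ vs → ∀ c → ∃ λ C → Now (kd z) c C × ∑[ Zone [ z ] ] C ≡ weight (kd z) c
    init-site {z} z∈ c with kd-vs z∈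
    ... | z∈' , e with subs z (there z∈')
    ...   | empty ∄ rewrite e = (λ _ → bit c) , refl ,
              trans (Zone-site z∈ _) (trans (cong (bit c +_) (∑[]-empty _ _ ∄)) (+-identityʳ _))
    ...   | solved p _ _ P rewrite e = let (C , a , sum) = Piece.init P in C [ z ≔ 1 ] ,
              (≔-same C z 1 , Piece.respA P (off C) a) ,
              trans (Zone-site z∈ _) (cong₂ _+_ (≔-same C z 1) (trans (∑[]-cong _ (off C)) sum))
      where
      off : ∀ C a → T (Sub K own z a) → (C [ z ≔ 1 ]) a ≡ C a
      off C a t = ≔-other C 1 (proj₂ (proj₂ (Sub⁻ {K} {own} t)))

    init-list : ∀ zs → Unique zs → (∀ {z} → z ∈ zs → z ∈ vs) → ∀ c → ∃ λ C → Alt c zs C × ∑[ Zone zs ] C ≡ W c zs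
    init-list [] _ _ c = (λ _ → 0) , tt , ∑[]-empty (Zone []) _ (λ a t → case proj₂ (Zone⁻ {[]} t) of λ ())
    init-list (z ∷ zs) un@(_ ∷ un') sub c with init-site (sub (here refl)) c | init-list zs un' (sub ∘ there) (act (kd z) xor c)
    ... | C₁ , now , e₁ | C₂ , alt , e₂ = C ,
      (Now-resp (kd z) (self (here refl)) (λ a (o , _) → on o) now ,
       Alt-resp zs (self ∘ there) (λ z'∈ (o , _) → off (λ o' → Unique-head un (subst (_∈ zs) (trans (≡sym o) o') z'∈))) alt) ,
      trans (∑[]-split (Zone-split (Unique-head un)) C) (cong₂ _+_
        (trans (∑[]-cong (Zone [ z ]) (λ a t → on (case proj₂ (Zone⁻ {[ z ]} t) of λ { (here o) → o }))) e₁)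
        (trans (∑[]-cong (Zone zs) (λ a t → off λ o → Unique-head un (subst (_∈ zs) o (proj₂ (Zone⁻ {zs} t))))) e₂))
      where
      self : ∀ {z'} → z' ∈ z ∷ zs → N z' z'
      self z'∈ = Sub-N (sub z'∈) (inj₂ refl)
      C : Config n
      C a = if ⌊ own a ≟ z ⌋ then C₁ a else C₂ a
      on : ∀ {a} → own a ≡ z → C a ≡ C₁ a
      on {a} o with own a ≟ z
      ... | yes _ = refl
      ... | no o≢ = contradiction o o≢
      off : ∀ {a} → own a ≢ z → C a ≡ C₂ a
      off {a} o≢ with own a ≟ z
      ... | yes o = contradiction o o≢
      ... | no _ = refl

    piece : Piece K₁ y (W false vs)
    piece = BlockPiece.block-piece G K₁ y y∉K₁ own kd base (Neighbours base) own∈-base (here refl) own-y y-only kd-y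
      (λ ab t b∈ → sep ab (proj₁ (Zone⁻ t)) ([ inj₁ ∘ proj₁ ∘ Zone⁻ , inj₂ ]′ b∈))
      (let (C , a , e) = init-list vs (Unique-++ʳ [ y ] unique) id false in C , (vs , arr , a) , e)

    split : Split K K₁ (Sub K own y)
    split = record
      { into = λ a Ka → case own∈ a (inj₁ Ka) of λ
          { (here o) → inj₂ (Sub⁺ {K} {own} Ka o (λ { refl → y∉K Ka })) ; (there o) → inj₁ (Zone⁺ Ka o) }
      ; left = λ a → proj₁ ∘ Zone⁻
      ; right = λ a → proj₁ ∘ Sub⁻ {K} {own}
      ; apart = λ a t u → y∉vs (subst (_∈ vs) (proj₁ (proj₂ (Sub⁻ {K} {own} u))) (proj₂ (Zone⁻ t))) }

    separated : ∀ {a b} → Adj G a b → T (K₁ a) → T (K b) → T (K₁ b)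
    separated {a} {b} ab t Kb with Zone⁻ t
    ... | Ka , oa with sep ab Ka (inj₁ Kb)
    ...   | inj₁ same = Zone⁺ Kb (subst (_∈ vs) same oa)
    ...   | inj₂ near with [ proj₂ ∘ Consec-∈ , proj₁ ∘ Consec-∈ ]′ near
    ...     | here refl = contradiction Kb y∉K
    ...     | there b∈ with ∈-++⁻ vs b∈
    ...       | inj₁ b∈vs = Zone⁺ Kb (subst (_∈ vs) (≡sym (proj₂ (fixed b∈vs))) b∈vs)
    ...       | inj₂ (here refl) = contradiction Kb y∉K

    neighbour : ∃ λ w → T (K w) × Adj G y w
    neighbour = v , proj₁ (fixed (here refl)) , path here

    -- `K` consists of what the block vertices other than `y` own and of the part left at `y`. The
    -- lower bounds add up on disjoint regions, and `product` adds the strategies.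
    solve-block : Solved K y
    solve-block with subs y (here refl)
    ... | empty ∄ = solved (W false vs + 0) neighbour
            (λ {C} c → ≤-trans (+-mono-≤ (least-block c) z≤n) (≤-reflexive (≡sym (∑[]-split split C))))
            (product split y∉K separated piece (empty-piece ∄))
    ... | solved p _ least P = solved (W false vs + p) neighbour
            (λ {C} c → ≤-trans (+-mono-≤ (least-block c) (least c)) (≤-reflexive (≡sym (∑[]-split split C))))
            (product split y∉K separated piece P)

  module Solve (x : V) (Cls : Config n → Set)
    (respond : ∀ C → Cls C → ∀ u v → Adj G u v → ∃ λ C' → Cls C' × OpenMove x C C' u v) where
    open LowerBound x Cls respond

    solve : ∀ {K y} → Bundle K y → ¬ T (K y) → Closed K y → ¬ T (K x) → Solved K y
    solve (none ∄) _ _ _ = empty ∄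
    solve {K} (some v vs own isBlock subs) y∉K closed x∉K =
      SolveBlock.solve-block x Cls respond isBlock y∉K closed x∉K λ z z∈ →
        solve (subs z z∈) (z∉Sub {K} {own}) (closed-Sub isBlock y∉K closed z∈) (λ t → x∉K (proj₁ (Sub⁻ {K} {own} t)))

-- Finding the blocks of a cactus

consec-lookup : ∀ {A : Set} (x : A) xs (i : Fin (length xs)) →
  Consec (x ∷ xs) (lookup (x ∷ xs) (inject₁ i)) (lookup xs i)
consec-lookup x (x' ∷ xs) zero = here
consec-lookup x (x' ∷ xs) (suc i) = there (consec-lookup x' xs i)

consec-last : ∀ {A : Set} (x : A) xs {w} → Consec (x ∷ xs ++ [ w ]) (lookup (x ∷ xs) (fromℕ (length xs))) w
consec-last x [] = here
consec-last x (x' ∷ xs) = there (consec-last x' xs)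

consec-index : ∀ {A : Set} (x : A) xs {w a b} → Consec (x ∷ xs ++ [ w ]) a b →
  (∃ λ i → a ≡ lookup (x ∷ xs) (inject₁ i) × b ≡ lookup xs i) ⊎ (a ≡ lookup (x ∷ xs) (fromℕ (length xs)) × b ≡ w)
consec-index x [] here = inj₂ (refl , refl)
consec-index x [] (there (there ()))
consec-index x (x' ∷ xs) here = inj₁ (zero , refl , refl)
consec-index x (x' ∷ xs) (there c) with consec-index x' xs c
... | inj₁ (i , e , e') = inj₁ (suc i , e , e')
... | inj₂ e = inj₂ e

lookup-inj : ∀ {A : Set} {xs : List A} → Unique xs → ∀ i j → lookup xs i ≡ lookup xs j → i ≡ j
lookup-inj (x∉ ∷ un) zero zero e = refl
lookup-inj (x∉ ∷ un) zero (suc j) e = contradiction e (All.lookup x∉ (∈-lookup j))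
lookup-inj (x∉ ∷ un) (suc i) zero e = contradiction (≡sym e) (All.lookup x∉ (∈-lookup i))
lookup-inj (x∉ ∷ un) (suc i) (suc j) e = cong suc (lookup-inj un i j e)

order : ∀ {A : Set} {a b : A} zs → a ≢ b → a ∈ zs → b ∈ zs →
  (∃ λ p → ∃ λ m → ∃ λ s → zs ≡ p ++ a ∷ m ++ b ∷ s) ⊎ (∃ λ p → ∃ λ m → ∃ λ s → zs ≡ p ++ b ∷ m ++ a ∷ s)
order (x ∷ zs) a≢b (here refl) (here refl) = contradiction refl a≢b
order (x ∷ zs) a≢b (here refl) (there b∈) with ∈-∃++ b∈
... | m , s , refl = inj₁ ([] , m , s , refl)
order (x ∷ zs) a≢b (there a∈) (here refl) with ∈-∃++ a∈
... | m , s , refl = inj₂ ([] , m , s , refl)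
order (x ∷ zs) a≢b (there a∈) (there b∈) with order zs a≢b a∈ b∈
... | inj₁ (p , m , s , refl) = inj₁ (x ∷ p , m , s , refl)
... | inj₂ (p , m , s , refl) = inj₂ (x ∷ p , m , s , refl)

module Extraction {n : ℕ} (G : Graph n)
  (no-two : ∀ (c d : Cycle G) → ¬ SameCycle c d → AtMostOneCommon c d) where
  open Flows G
  open Decomposition G
  open import Data.List.Membership.DecPropositional (_≟_ {n}) using (_∈?_)
  open import Data.List.Relation.Unary.Any using (index)
  open import Data.List.Relation.Unary.Any.Properties using (lookup-index)
  open import Relation.Nullary.Decidable using (_×-dec_; _⊎-dec_; ¬?)
  open import Data.Bool.Properties using (T?)

  Loop : List V → Set
  Loop zs = Unique zs × (∀ {a b} → Consec (cl zs) a b → Adj G a b)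

  toCycle : ∀ {p q r l} → Loop (p ∷ q ∷ r ∷ l) → Cycle G
  toCycle {p} {q} {r} {l} (un , path) = record
    { len = length l
    ; vtx = lookup (p ∷ q ∷ r ∷ l)
    ; inj = lookup-inj un
    ; edges = λ i → path (Consec-++ˡ (consec-lookup p (q ∷ r ∷ l) i))
    ; close = path (consec-last p (q ∷ r ∷ l)) }

  edge⇒near : ∀ {p q r l} (lp : Loop (p ∷ q ∷ r ∷ l)) {a b} → CycleEdge (toCycle lp) a b → Neighbours (p ∷ q ∷ r ∷ l) a b
  edge⇒near {p} {q} {r} {l} lp (inj₁ (i , inj₁ (refl , refl))) = inj₁ (Consec-++ˡ (consec-lookup p (q ∷ r ∷ l) i))
  edge⇒near {p} {q} {r} {l} lp (inj₁ (i , inj₂ (refl , refl))) = inj₂ (Consec-++ˡ (consec-lookup p (q ∷ r ∷ l) i))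
  edge⇒near {p} {q} {r} {l} lp (inj₂ (inj₁ (refl , refl))) = inj₁ (consec-last p (q ∷ r ∷ l))
  edge⇒near {p} {q} {r} {l} lp (inj₂ (inj₂ (refl , refl))) = inj₂ (consec-last p (q ∷ r ∷ l))

  consec⇒edge : ∀ {p q r l} (lp : Loop (p ∷ q ∷ r ∷ l)) {a b} → Consec (cl (p ∷ q ∷ r ∷ l)) a b → CycleEdge (toCycle lp) a b
  consec⇒edge {p} {q} {r} {l} lp c with consec-index p (q ∷ r ∷ l) c
  ... | inj₁ (i , e , e') = inj₁ (i , inj₁ (e , e'))
  ... | inj₂ e = inj₂ (inj₁ e)

  -- An edge of `nw` that is not one of `zs` makes the two cycles different, so the cactus condition
  -- identifies any two common vertices.
  clash : ∀ zs nw → 3 ≤ length zs → 3 ≤ length nw → Loop zs → Loop nw → ∀ {a b c d} →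
    Consec (cl nw) a b → ¬ Neighbours zs a b → c ∈ zs → c ∈ nw → d ∈ zs → d ∈ nw → c ≡ d
  clash (_ ∷ _ ∷ _ ∷ _) (_ ∷ _ ∷ _ ∷ _) _ _ lp lp' con far c∈ c∈' d∈ d∈' =
    trans (lookup-index c∈) (trans
      (no-two (toCycle lp) (toCycle lp') different (index c∈) (index c∈') (index d∈) (index d∈')
        (trans (≡sym (lookup-index c∈)) (lookup-index c∈')) (trans (≡sym (lookup-index d∈)) (lookup-index d∈')))
      (≡sym (lookup-index d∈)))
    where
    different : ¬ SameCycle (toCycle lp) (toCycle lp')
    different same = far (edge⇒near lp (Equivalence.from (same _ _) (consec⇒edge lp' con)))
  clash [] _ () _ _ _ _ _ _ _ _ _
  clash (_ ∷ []) _ (s≤s ()) _ _ _ _ _ _ _ _ _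
  clash (_ ∷ _ ∷ []) _ (s≤s (s≤s ())) _ _ _ _ _ _ _ _ _
  clash (_ ∷ _ ∷ _ ∷ _) [] _ () _ _ _ _ _ _ _ _
  clash (_ ∷ _ ∷ _ ∷ _) (_ ∷ []) _ (s≤s ()) _ _ _ _ _ _ _ _
  clash (_ ∷ _ ∷ _ ∷ _) (_ ∷ _ ∷ []) _ (s≤s (s≤s ())) _ _ _ _ _ _ _ _

  in-cl : ∀ (zs : List V) {u v} → Consec zs u v → Consec (cl zs) u v
  in-cl (z ∷ zs) c = Consec-++ˡ c

  -- The arc from `a` to `b` is closed by a path through new vertices. With `us` empty that path is
  -- a chord; otherwise it is an ear.
  shortcut : ∀ p {a m b s} us → Loop (p ++ a ∷ m ++ b ∷ s) → Unique us → (∀ {u} → u ∈ us → u ∉ p ++ a ∷ m ++ b ∷ s) →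
    (∀ {u v} → Consec (b ∷ us ++ [ a ]) u v → Adj G u v) → Loop (a ∷ m ++ b ∷ us)
  shortcut p {a} {m} {b} {s} us (un , path) un-us fresh path-us =
    subst Unique assoc (++⁺ un-arc un-us λ { (z∈arc , z∈us) → fresh z∈us (arc⊆ z∈arc) }) , walk
    where
    open import Data.List.Relation.Unary.Unique.Propositional.Properties using (++⁺)
    assoc : (a ∷ m ++ [ b ]) ++ us ≡ a ∷ m ++ b ∷ us
    assoc = cong (a ∷_) (++-assoc m [ b ] us)
    whole : p ++ a ∷ m ++ b ∷ s ≡ p ++ (a ∷ m ++ [ b ]) ++ s
    whole = cong (λ t → p ++ a ∷ t) (≡sym (++-assoc m [ b ] s))
    un-arc : Unique (a ∷ m ++ [ b ])
    un-arc = Unique-++ˡ (a ∷ m ++ [ b ]) (Unique-++ʳ p (subst Unique whole un))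
    arc⊆ : ∀ {z} → z ∈ a ∷ m ++ [ b ] → z ∈ p ++ a ∷ m ++ b ∷ s
    arc⊆ z∈ = subst (_ ∈_) (≡sym whole) (∈-++⁺ʳ p (∈-++⁺ˡ z∈))
    walk : ∀ {u v} → Consec (cl (a ∷ m ++ b ∷ us)) u v → Adj G u v
    walk c with Consec-split (a ∷ m) (subst (λ t → Consec (a ∷ t) _ _) (++-assoc m (b ∷ us) [ a ]) c)
    ... | inj₁ c' = path (in-cl (p ++ a ∷ m ++ b ∷ s) (subst (λ t → Consec t _ _) (≡sym whole) (Consec-++ʳ p (Consec-++ˡ c'))))
    ... | inj₂ c' = path-us c'

  length-≥ : ∀ {A : Set} (a : A) m b us → m ≢ [] ⊎ us ≢ [] → 3 ≤ length (a ∷ m ++ b ∷ us)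
  length-≥ a [] b [] (inj₁ ne) = contradiction refl ne
  length-≥ a [] b [] (inj₂ ne) = contradiction refl ne
  length-≥ a [] b (_ ∷ _) _ = s≤s (s≤s (s≤s z≤n))
  length-≥ a (_ ∷ []) b _ _ = s≤s (s≤s (s≤s z≤n))
  length-≥ a (_ ∷ _ ∷ _) b _ _ = s≤s (s≤s (s≤s z≤n))

  consec? : ∀ (zs : List V) a b → Dec (Consec zs a b)
  consec? [] a b = no λ ()
  consec? (x ∷ []) a b = no λ { (there ()) }
  consec? (x ∷ x' ∷ zs) a b with x ≟ a | x' ≟ b | consec? (x' ∷ zs) a b
  ... | _ | _ | yes c = yes (there c)
  ... | yes refl | yes refl | _ = yes here
  ... | no x≢a | _ | no ¬c = no λ { here → x≢a refl ; (there c) → ¬c c }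
  ... | yes _ | no x'≢b | no ¬c = no λ { here → x'≢b refl ; (there c) → ¬c c }

  near? : ∀ (zs : List V) a b → Dec (Neighbours zs a b)
  near? zs a b = consec? (cl zs) a b ⊎-dec consec? (cl zs) b a

  Neighbours-sym : ∀ {zs a b} → Neighbours zs a b → Neighbours zs b a
  Neighbours-sym = [ inj₂ , inj₁ ]′

  -- A chord would close the arc between its ends to a second cycle that shares both ends with the
  -- first.
  in-order-chord : ∀ zs → 3 ≤ length zs → Loop zs → ∀ {a b} → Adj G a b →
    (∃ λ p → ∃ λ m → ∃ λ s → zs ≡ p ++ a ∷ m ++ b ∷ s) → Neighbours zs a b
  in-order-chord zs long lp ab (p , [] , s , refl) = inj₁ (in-cl zs (Consec-++ʳ p here))
  in-order-chord zs long lp {a} {b} ab (p , m@(_ ∷ _) , s , refl) = decidable-stable (near? zs a b)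
    (λ far → Adj-≢ ab (clash zs (a ∷ m ++ [ b ]) long (length-≥ a m b [] (inj₁ λ ())) lp
      (shortcut p {a} {m} {b} {s} [] lp [] (λ ()) (λ { here → Adj-sym ab ; (there (there ())) }))
      {b} {a} (subst (λ t → Consec (a ∷ t) b a) (≡sym (++-assoc m [ b ] [ a ])) (Consec-snoc (a ∷ m)))
      (far ∘ Neighbours-sym) (∈-++⁺ʳ p (here refl)) (here refl)
      (∈-++⁺ʳ p (there (∈-++⁺ʳ m (here refl)))) (there (∈-++⁺ʳ m (here refl)))))

  no-chord : ∀ zs → 3 ≤ length zs → Loop zs → ∀ {a b} → a ∈ zs → b ∈ zs → Adj G a b → Neighbours zs a b
  no-chord zs long lp a∈ b∈ ab = [ in-order-chord zs long lp ab , Neighbours-sym ∘ in-order-chord zs long lp (Adj-sym ab) ]′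
    (order zs (Adj-≢ ab) a∈ b∈)

  data Walk (K : V → Bool) (y : V) : V → Set where
    end : Walk K y y
    via : ∀ {a b} → T (K a) → Adj G a b → Walk K y b → Walk K y a

  module Hanging (K : V → Bool) (y : V) (y∉K : ¬ T (K y)) (closed : Closed K y) where

    module Attach (zs : List V) (y∈ : y ∈ zs) where

      -- A walk in K that stops at its first vertex c in zs.
      data Off : V → V → Set where
        hit : ∀ {c} → c ∈ zs → Off c c
        go : ∀ {a b c} → T (K a) → a ∉ zs → Adj G a b → Off b c → Off a c

      off : ∀ {a} → Walk K y a → ∃ λ c → Off a c
      off end = y , hit y∈
      off {a} (via Ka ab w) with a ∈? zs
      ... | yes a∈ = a , hit a∈
      ... | no a∉ = proj₁ (off w) , go Ka a∉ ab (proj₂ (off w))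

      Off-∈ : ∀ {a c} → Off a c → c ∈ zs
      Off-∈ (hit c∈) = c∈
      Off-∈ (go _ _ _ o) = Off-∈ o

      Off-fix : ∀ {a c} → a ∈ zs → Off a c → c ≡ a
      Off-fix _ (hit _) = refl
      Off-fix a∈ (go _ a∉ _ _) = contradiction a∈ a∉

      -- A path in K from h to c avoiding zs, except for its end c.
      record Ear (c h : V) : Set where
        field
          us : List V
          simple : Unique (h ∷ us)
          within : ∀ {u} → u ∈ h ∷ us → T (K u) × u ∉ zs
          path : ∀ {u v} → Consec (h ∷ us ++ [ c ]) u v → Adj G u v

      lone : ∀ {c h} → T (K h) → h ∉ zs → Adj G h c → Ear c h
      lone Kh h∉ hc = record
        { us = [] ; simple = [] ∷ [] ; within = λ { (here refl) → Kh , h∉ }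
        ; path = λ { here → hc ; (there (there ())) } }

      -- If `w` already lies on the ear, the piece before it is cut off, which keeps the path
      -- simple.
      prepend : ∀ {c h w} → T (K w) → w ∉ zs → Adj G w h → Ear c h → Ear c w
      prepend {c} {h} {w} Kw w∉ wh ear with w ∈? h ∷ Ear.us ear
      ... | no w∉' = record
        { us = h ∷ us ; simple = All.tabulate (λ { z∈ refl → w∉' z∈ }) ∷ simple
        ; within = λ { (here refl) → Kw , w∉ ; (there u∈) → within u∈ }
        ; path = λ { here → wh ; (there con) → path con } }
        where open Ear ear
      ... | yes w∈ with ∈-∃++ w∈
      ...   | p , q , e = record
        { us = q ; simple = Unique-++ʳ p (subst Unique e simple)
        ; within = λ u∈ → within (subst (_ ∈_) (≡sym e) (∈-++⁺ʳ p u∈))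
        ; path = λ con → path (subst (λ t → Consec t _ _) (trans (≡sym (++-assoc p (w ∷ q) [ c ])) (cong (_++ [ c ]) (≡sym e))) (Consec-++ʳ p con)) }
        where open Ear ear

      ear-of : ∀ {a c} → Off a c → a ≡ c ⊎ Ear c a
      ear-of (hit _) = inj₁ refl
      ear-of (go Ka a∉ ab o) with ear-of o
      ... | inj₁ refl = inj₂ (lone Ka a∉ ab)
      ... | inj₂ ear = inj₂ (prepend Ka a∉ ab ear)

      -- The start of the ear is pushed along the walk towards `c`, until it is adjacent to `c`.
      extend : ∀ {a c c'} → Off a c → Ear c' a → ∃ λ h → Adj G c h × Ear c' h
      extend (hit c∈) ear = contradiction c∈ (proj₂ (Ear.within ear (here refl)))
      extend (go _ _ ab (hit _)) ear = _ , Adj-sym ab , ear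
      extend (go _ _ ab o@(go Kb b∉ _ _)) ear = extend o (prepend Kb b∉ (Adj-sym ab) ear)

      -- The walk from `a` to `c` read backwards, the edge `ab` and the walk from `b` to `c'` join
      -- two different vertices of the loop through vertices off it; removing repetitions leaves an
      -- ear.
      connect : ∀ {a b c c'} → Adj G a b → Off a c → Off b c' → c ≢ c' → ¬ (a ∈ zs × b ∈ zs) → ∃ λ h → Adj G c h × Ear c' h
      connect ab (hit a∈) (hit b∈) _ ¬both = contradiction (a∈ , b∈) ¬both
      connect ab (hit a∈) o@(go _ b∉ _ _) c≢c' _ with ear-of o
      ... | inj₁ refl = contradiction (Off-∈ o) b∉
      ... | inj₂ ear = _ , ab , ear
      connect ab o@(go Ka a∉ _ _) o' _ _ with ear-of o'
      ... | inj₁ refl = extend o (lone Ka a∉ ab)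
      ... | inj₂ ear = extend o (prepend Ka a∉ ab ear)

      ear-loop : ∀ p {c m c' s} → zs ≡ p ++ c' ∷ m ++ c ∷ s → Loop zs → ∀ {h} → Adj G c h → (ear : Ear c' h) →
        Loop (c' ∷ m ++ c ∷ h ∷ Ear.us ear)
      ear-loop p {c} {m} {c'} {s} refl lp {h} ch ear = shortcut p {c'} {m} {c} {s} (h ∷ us) lp simple (proj₂ ∘ within) λ { here → ch ; (there con) → path con }
        where open Ear ear

      NewLoop : Set
      NewLoop = ∃ λ p → ∃ λ m → ∃ λ s → ∃ λ c → ∃ λ c' → ∃ λ h → ∃ λ us →
        zs ≡ p ++ c' ∷ m ++ c ∷ s × Loop (c' ∷ m ++ c ∷ h ∷ us) × (∀ {u} → u ∈ h ∷ us → T (K u) × u ∉ zs)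

      new-loop : ∀ {a b c c'} → Loop zs → Adj G a b → Off a c → Off b c' → c ≢ c' → ¬ (a ∈ zs × b ∈ zs) → NewLoop
      new-loop {c = c} {c'} lp ab o o' c≢c' ¬both with order zs c≢c' (Off-∈ o) (Off-∈ o')
      ... | inj₂ (p , m , s , e) = let (h , ch , ear) = connect ab o o' c≢c' ¬both in
        p , m , s , c , c' , h , Ear.us ear , e , ear-loop p e lp ch ear , Ear.within ear
      ... | inj₁ (p , m , s , e) = let (h , ch , ear) = connect (Adj-sym ab) o' o (c≢c' ∘ ≡sym) (λ (b∈ , a∈) → ¬both (a∈ , b∈)) in
        p , m , s , c' , c , h , Ear.us ear , e , ear-loop p e lp ch ear , Ear.within ear

      -- The edge from `c` to `h` is not on the old loop because `h` is not, yet both loops contain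
      -- `c` and `c'`.
      no-new-loop : 3 ≤ length zs → Loop zs → ¬ NewLoop
      no-new-loop long lp (p , m , s , c , c' , h , us , refl , lp' , fresh) =
        Unique-head (Unique-++ʳ p (proj₁ lp)) (subst (_∈ m ++ c ∷ s) c≡c' (∈-++⁺ʳ m (here refl)))
        where
        c≡c' : c ≡ c'
        c≡c' = clash zs (c' ∷ m ++ c ∷ h ∷ us) long (length-≥ c' m c (h ∷ us) (inj₂ λ ())) lp lp'
          {c} {h} (there' (Consec-++ʳ m here)) far
          (∈-++⁺ʳ p (there (∈-++⁺ʳ m (here refl)))) (there (∈-++⁺ʳ m (here refl))) (∈-++⁺ʳ p (here refl)) (here refl)
          where
          there' : ∀ {w l u v} → Consec l u v → Consec (cl (w ∷ l)) u v
          there' con = there (Consec-++ˡ con)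
          far : ¬ Neighbours zs c h
          far near = proj₂ (fresh (here refl)) (cl-∈ ([ proj₂ ∘ Consec-∈ , proj₁ ∘ Consec-∈ ]′ near))

    module Decompose (walks : ∀ a → T (K a) → Walk K y a) where

      module _ (vs : List V) (lp : Loop (y ∷ vs)) (inside : ∀ {z} → z ∈ vs → T (K z)) where
        open Attach (y ∷ vs) (here refl)

        -- The owner is where the given walk first meets the block. It might depend on the walk, but
        -- all that is required of owners is the absence of `Bad` edges. Vertices outside `K` and
        -- `y` get themselves as a default.
        own-at : ∀ a → ∃ λ c → At K y a → Off a c
        own-at a with T? (K a)
        ... | yes Ka = proj₁ (off (walks a Ka)) , λ _ → proj₂ (off (walks a Ka))
        ... | no ¬Ka = a , λ { (inj₁ Ka) → contradiction Ka ¬Ka ; (inj₂ refl) → hit (here refl) }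

        own : V → V
        own a = proj₁ (own-at a)

        own-off : ∀ {a} → At K y a → Off a (own a)
        own-off {a} = proj₂ (own-at a)

        -- Such an edge joins parts hanging at different vertices, and so it is what yields an ear.
        Bad : V → V → Set
        Bad a b = Adj G a b × At K y a × At K y b × own a ≢ own b × ¬ (a ∈ y ∷ vs × b ∈ y ∷ vs)

        bad? : Dec (∃ λ a → ∃ λ b → Bad a b)
        bad? = any? λ a → any? λ b → T? (adj G a b) ×-dec (T? (K a) ⊎-dec (a ≟ y)) ×-dec (T? (K b) ⊎-dec (b ≟ y))
          ×-dec ¬? (own a ≟ own b) ×-dec ¬? ((a ∈? y ∷ vs) ×-dec (b ∈? y ∷ vs))

        good : (∀ {a b} → a ∈ y ∷ vs → b ∈ y ∷ vs → Adj G a b → Neighbours (y ∷ vs) a b) →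
          ¬ (∃ λ a → ∃ λ b → Bad a b) → IsBlock K y vs own
        good chordless ∄bad = record
          { unique = proj₁ lp ; path = proj₂ lp
          ; own-y = Off-fix (here refl) (own-off (inj₂ refl))
          ; own∈ = λ a a∈ → Off-∈ (own-off a∈)
          ; fixed = λ z∈ → inside z∈ , Off-fix (there z∈) (own-off (inj₁ (inside z∈)))
          ; sep = separate }
          where
          separate : ∀ {a b} → Adj G a b → T (K a) → At K y b → own a ≡ own b ⊎ Neighbours (y ∷ vs) a b
          separate {a} {b} ab Ka b∈ with own a ≟ own b | (a ∈? y ∷ vs) ×-dec (b ∈? y ∷ vs)
          ... | yes same | _ = inj₁ same
          ... | no _ | yes (a∈ , b∈') = inj₂ (chordless a∈ b∈' ab)
          ... | no differ | no ¬both = contradiction (a , b , ab , inj₁ Ka , b∈ , differ , ¬both) ∄bad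

        from-bad : (∃ λ a → ∃ λ b → Bad a b) → NewLoop
        from-bad (a , b , ab , a∈ , b∈ , differ , ¬both) = new-loop lp ab (own-off a∈) (own-off b∈) differ ¬both

        long-block : 3 ≤ length (y ∷ vs) → IsBlock K y vs own
        long-block long = good (no-chord (y ∷ vs) long lp) (no-new-loop long lp ∘ from-bad)

      Block : Set
      Block = ∃ λ v → ∃ λ vs → ∃ λ own → IsBlock K y (v ∷ vs) own

      -- An edge yv is a block by itself or lies on a cycle.
      block-at : ∀ {v} → T (K v) → Adj G y v → Block
      block-at {v} Kv yv = go (bad? [ v ] lp inside)
        where
        lp : Loop (y ∷ [ v ])
        lp = ((λ { refl → y∉K Kv }) ∷ []) ∷ [] ∷ [] , λ { here → yv ; (there here) → Adj-sym yv ; (there (there (there ()))) }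
        inside : ∀ {z} → z ∈ [ v ] → T (K z)
        inside (here refl) = Kv
        chordless : ∀ {a b} → a ∈ y ∷ [ v ] → b ∈ y ∷ [ v ] → Adj G a b → Neighbours (y ∷ [ v ]) a b
        chordless (here refl) (here refl) e = contradiction refl (Adj-≢ e)
        chordless (here refl) (there (here refl)) _ = inj₁ here
        chordless (there (here refl)) (here refl) _ = inj₂ here
        chordless (there (here refl)) (there (here refl)) e = contradiction refl (Adj-≢ e)
        extended : Attach.NewLoop (y ∷ [ v ]) (here refl) → Block
        -- The ear and the edge `yv` form a cycle of at least three vertices, to which `no-new-loop`
        -- applies, so the cycle is a block.
        extended ([] , [] , s , c , c' , h , us , refl , lp' , fresh) =
          v , h ∷ us , _ , long-block (v ∷ h ∷ us) lp' inside' (s≤s (s≤s (s≤s z≤n)))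
          where
          inside' : ∀ {z} → z ∈ v ∷ h ∷ us → T (K z)
          inside' (here refl) = Kv
          inside' (there z∈) = proj₁ (fresh z∈)
        extended ([] , _ ∷ [] , _ , _ , _ , _ , _ , () , _)
        extended ([] , _ ∷ _ ∷ _ , _ , _ , _ , _ , _ , () , _)
        extended (_ ∷ [] , [] , _ , _ , _ , _ , _ , () , _)
        extended (_ ∷ [] , _ ∷ _ , _ , _ , _ , _ , _ , () , _)
        extended (_ ∷ _ ∷ [] , _ , _ , _ , _ , _ , _ , () , _)
        extended (_ ∷ _ ∷ _ ∷ _ , _ , _ , _ , _ , _ , _ , () , _)
        go : Dec _ → Block
        go (yes bad) = extended (from-bad [ v ] lp inside bad)
        go (no ∄bad) = v , [] , _ , good [ v ] lp inside chordless ∄bad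

      last-step : ∀ {a} → T (K a) → Walk K y a → ∃ λ v → T (K v) × Adj G y v
      last-step Ka end = contradiction Ka y∉K
      last-step _ (via Ka ay end) = _ , Ka , Adj-sym ay
      last-step _ (via _ _ w@(via Kb _ _)) = last-step Kb w


  sub-walk : ∀ {K y vs own z} → IsBlock K y vs own → ¬ T (K y) → Closed (Sub K own z) z → ∀ {a} → T (Sub K own z a) →
    Walk K y a → Walk (Sub K own z) z a
  sub-walk {K} {own = own} isBlock y∉K closed t end = contradiction (proj₁ (Sub⁻ {K} {own} t)) y∉K
  sub-walk {K} {y} {vs} {own} {z} isBlock y∉K closed {a} t (via {b = b} Ka ab w) = via t ab (next (closed ab t))
    where
    next : At (Sub K own z) z b → Walk (Sub K own z) z b
    next (inj₁ t') = sub-walk isBlock y∉K closed t' w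
    next (inj₂ refl) = end

  size : (V → Bool) → ℕ
  size K = ∑[ K ] (λ _ → 1)

  -- A block vertex `z` other than `y` lies in `K` but not in its own part; for `z = y` the vertex
  -- `v` is lost, because it owns itself.
  size-Sub : ∀ {K y v vs own z} → IsBlock K y (v ∷ vs) own → ¬ T (K y) → z ∈ y ∷ v ∷ vs → suc (size (Sub K own z)) ≤ size K
  size-Sub {K} {y} {v} {vs} {own} {z} isBlock y∉K z∈ = ≤-trans
    (≤-reflexive (cong (_+ size (Sub K own z)) (≡sym (∑-δ w))))
    (≤-trans (≤-reflexive (≡sym (∑-+ (δ w) (λ a → if Sub K own z a then 1 else 0)))) (∑-mono pointwise))
    where
    open IsBlock isBlock
    witness : ∀ {z} → z ∈ y ∷ v ∷ vs → ∃ λ w → T (K w) × ¬ T (Sub K own z w)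
    witness (there z∈vs) = _ , proj₁ (fixed z∈vs) , z∉Sub {K} {own}
    witness (here refl) = v , proj₁ (fixed (here refl)) ,
      λ t → Unique-head unique (here (trans (≡sym (proj₁ (proj₂ (Sub⁻ {K} {own} t)))) (proj₂ (fixed (here refl)))))
    w = proj₁ (witness z∈)
    mono : ∀ {b c} → (T b → T c) → (if b then 1 else 0) ≤ (if c then 1 else 0)
    mono {true} {true} _ = ≤-refl
    mono {true} {false} f = ⊥-elim (f tt)
    mono {false} _ = z≤n
    strict : ∀ {b c} → T c → ¬ T b → suc (if b then 1 else 0) ≤ (if c then 1 else 0)
    strict {true} _ ¬b = contradiction tt ¬b
    strict {false} {true} _ _ = ≤-refl
    pointwise : ∀ a → δ w a + (if Sub K own z a then 1 else 0) ≤ (if K a then 1 else 0)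
    pointwise a with w ≟ a
    ... | no _ = mono (proj₁ ∘ Sub⁻ {K} {own})
    ... | yes refl = strict (proj₁ (proj₂ (witness z∈))) (proj₂ (proj₂ (witness z∈)))

  decompose : ∀ k {K y} → size K ≤ k → ¬ T (K y) → Closed K y → (∀ a → T (K a) → Walk K y a) → Bundle K y
  decompose k {K} {y} le y∉K closed walks with any? (λ a → T? (K a))
  ... | no ∄ = none (λ a Ka → ∄ (a , Ka))
  ... | yes (a , Ka) = go k le (Hanging.Decompose.last-step K y y∉K closed walks Ka (walks a Ka))
    where
    go : ∀ k → size K ≤ k → (∃ λ v → T (K v) × Adj G y v) → Bundle K y
    go k le (v , Kv , yv) with Hanging.Decompose.block-at K y y∉K closed walks Kv yv
    ... | v' , vs , own , isBlock = some v' vs own isBlock (sub k le)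
      where
      sub : ∀ k → size K ≤ k → ∀ z → z ∈ y ∷ v' ∷ vs → Bundle (Sub K own z) z
      sub zero le z z∈ = contradiction (≤-trans (size-Sub isBlock y∉K z∈) le) λ ()
      sub (suc k) le z z∈ = decompose k (≤-pred (≤-trans (size-Sub isBlock y∉K z∈) le)) (z∉Sub {K} {own})
        (closed-Sub isBlock y∉K closed z∈)
        (λ a t → sub-walk isBlock y∉K (closed-Sub isBlock y∉K closed z∈) t (walks a (proj₁ (Sub⁻ {K} {own} t))))

-- From lists of moves to reconfigurations

edge# : ∀ {n} → List (Fin n × Fin n) → Fin n → Fin n → ℕ
edge# [] a b = 0
edge# ((u , v) ∷ F) a b = δ v b * δ u a + edge# F a b

edge#-row : ∀ {n} (F : List (Fin n × Fin n)) a → ∑ (edge# F a) ≡ # a (map proj₁ F)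
edge#-row {n} [] a = ∑-zero n
edge#-row ((u , v) ∷ F) a = trans (∑-+ (λ b → δ v b * δ u a) (edge# F a)) (cong₂ _+_
  (trans (∑-* (δ v) (δ u a)) (trans (cong (_* δ u a) (∑-δ v)) (*-identityˡ _))) (edge#-row F a))

edge#-col : ∀ {n} (F : List (Fin n × Fin n)) b → ∑ (λ a → edge# F a b) ≡ # b (map proj₂ F)
edge#-col {n} [] b = ∑-zero n
edge#-col ((u , v) ∷ F) b = trans (∑-+ (λ a → δ v b * δ u a) (λ a → edge# F a b)) (cong₂ _+_
  (trans (∑-cong (λ a → *-comm (δ v b) (δ u a))) (trans (∑-* (δ u) (δ v b)) (trans (cong (_* δ v b) (∑-δ u)) (*-identityˡ _))))
  (edge#-col F b))

edge#-∈ : ∀ {n} {F : List (Fin n × Fin n)} {a b} → (a , b) ∈ F → 1 ≤ edge# F a b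
edge#-∈ {a = a} {b} (here refl) rewrite δ-refl a | δ-refl b = s≤s z≤n
edge#-∈ {F = _ ∷ F} (there e∈) = ≤-trans (edge#-∈ e∈) (m≤n+m _ _)

∈-edge# : ∀ {n} (F : List (Fin n × Fin n)) {a b} → 1 ≤ edge# F a b → (a , b) ∈ F
∈-edge# ((u , v) ∷ F) {a} {b} le with u ≟ a | v ≟ b
... | yes refl | yes refl = here refl
... | yes _ | no _ = there (∈-edge# F le)
... | no _ | yes _ = there (∈-edge# F le)
... | no _ | no _ = there (∈-edge# F le)

-- `F` lists only the guards that move; the remaining ones are put on the diagonal as staying
-- guards.
flow-move : ∀ {n} (H : Graph n) {C C' : Config n} {u v} (F : List (Fin n × Fin n)) →
  (∀ {a b} → (a , b) ∈ F → Adj H a b) → (∀ a → # a (map proj₁ F) ≤ C a) →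
  (∀ a → C' a + # a (map proj₁ F) ≡ C a + # a (map proj₂ F)) → (u , v) ∈ F ⊎ (v , u) ∈ F → Move H C C' u v
flow-move {n} H {C} {C'} F legal cap balance hit = f , allowed , row , col ,
  [ (λ e∈ → inj₁ (≤-trans (edge#-∈ e∈) (m≤m+n _ _))) , (λ e∈ → inj₂ (≤-trans (edge#-∈ e∈) (m≤m+n _ _))) ]′ hit
  where
  left : Fin n → ℕ
  left a = C a ∸ # a (map proj₁ F)
  f : Fin n → Fin n → ℕ
  f a b = edge# F a b + δ a b * left a
  allowed : ∀ a b → 1 ≤ f a b → a ≡ b ⊎ Adj H a b
  allowed a b le with a ≟ b
  ... | yes a≡b = inj₁ a≡b
  ... | no _ = inj₂ (legal (∈-edge# F (subst (1 ≤_) (+-identityʳ _) le)))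
  row : ∀ a → ∑ (f a) ≡ C a
  row a = trans (∑-+ (edge# F a) (λ b → δ a b * left a)) (trans (cong₂ _+_ (edge#-row F a)
    (trans (∑-* (δ a) (left a)) (trans (cong (_* left a) (∑-δ a)) (*-identityˡ _)))) (m+[n∸m]≡n (cap a)))
  col : ∀ b → ∑ (λ a → f a b) ≡ C' b
  col b = trans (∑-+ (λ a → edge# F a b) (λ a → δ a b * left a)) (trans (cong₂ _+_ (edge#-col F b)
    (trans (∑-supported b (λ a a≢b → cong (_* left a) (δ-≢ a≢b))) (trans (cong (_* left b) (δ-refl b)) (*-identityˡ _))))
    (+-cancelʳ-≡ (# b (map proj₁ F)) _ _ (trans (+-assoc (# b (map proj₂ F)) (left b) _)
      (trans (cong (# b (map proj₂ F) +_) (m∸n+n≡m (cap b))) (trans (+-comm (# b (map proj₂ F)) (C b)) (≡sym (balance b)))))))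

Move-∑ : ∀ {n} (H : Graph n) {C C' : Config n} {u v} → Move H C C' u v → ∑ C' ≡ ∑ C
Move-∑ H (f , _ , row , col , _) = trans (∑-cong (λ b → ≡sym (col b))) (trans (≡sym (∑-swap f)) (∑-cong row))

bits⇒valid : ∀ Ver {n} {C : Config n} → (∀ v → C v ≤ 1) → ValidConfig Ver C
bits⇒valid multi _ = tt
bits⇒valid single le = le

-- Strategies on the graph and on the graph with a pendant vertex

module Strategies {n : ℕ} (Ver : Version) (G : Graph n) (x : Fin n) where
  open Flows G
  open Pieces G

  K : V → Bool
  K a = not ⌊ a ≟ x ⌋

  K⁺ : ∀ {a} → a ≢ x → T (K a)
  K⁺ {a} a≢x with a ≟ x
  ... | yes a≡x = contradiction a≡x a≢x
  ... | no _ = tt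

  x∉K : ¬ T (K x)
  x∉K t with x ≟ x
  ... | no x≢x = x≢x refl

  At-all : ∀ a → At K x a
  At-all a = case a ≟ x of λ { (yes a≡x) → inj₂ a≡x ; (no a≢x) → inj₁ (K⁺ a≢x) }

  all-split : Split (λ _ → true) (λ a → ⌊ a ≟ x ⌋) K
  all-split = record
    { into = λ a _ → case a ≟ x of λ { (yes a≡x) → inj₁ (fromWitness a≡x) ; (no a≢x) → inj₂ (K⁺ a≢x) }
    ; left = λ _ _ → tt ; right = λ _ _ → tt
    ; apart = λ a t Ka → x∉K (subst (T ∘ K) (toWitness t) Ka) }

  ∑-at : ∀ (C : Config n) → ∑ C ≡ C x + ∑[ K ] C
  ∑-at C = trans (∑[]-split all-split C)
    (cong (_+ ∑[ K ] C) (∑[]-point {K = λ a → ⌊ a ≟ x ⌋} (fromWitness refl) (λ a → toWitness) C))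

  module _ {p} (P : Piece K x p) where
    open Piece P

    either-end : ∀ {u v C} {Q : Config n → Set} → Adj G u v →
      (∀ {u v} → Adj G u v → T (K u) → Tr (At K x) C Q [] [] [ u , v ]) → Tr (At K x) C Q [] [] [ u , v ]
    either-end {u} {v} uv t with u ≟ x
    ... | no u≢x = t uv (K⁺ u≢x)
    ... | yes refl = swap-sides (t (Adj-sym uv) (K⁺ (Adj-≢ (Adj-sym uv))))

    attackA : ∀ {u v C} → A C → C x ≡ 1 → Adj G u v →
      Tr (At K x) C (λ C' → C' x ≡ 1 × A C') [] [] [ u , v ] ⊎ Tr (At K x) C (λ C' → C' x ≡ 0 × B C') [] [] [ u , v ]
    attackA {u} {v} a Cx uv with u ≟ x
    ... | no u≢x = stepA a Cx uv (K⁺ u≢x) (At-all v)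
    ... | yes refl = [ inj₁ ∘ swap-sides , inj₂ ∘ swap-sides ]′ (stepA a Cx (Adj-sym uv) (K⁺ (Adj-≢ (Adj-sym uv))) (At-all u))

    attackB : ∀ {u v C} → B C → C x ≡ 1 → Adj G u v → Tr (At K x) C (λ C' → C' x ≡ 1 × B C') [] [] [ u , v ]
    attackB b Cx uv = either-end uv λ uv' Ku → stepB b Cx uv' Ku (At-all _)

    bitsA : ∀ {C} → A C → C x ≡ 1 → ∀ v → C v ≤ 1
    bitsA a Cx v = [ bitA a , (λ { refl → ≤-reflexive Cx }) ]′ (At-all v)

    bitsB : ∀ {C} → B C → C x ≡ 1 → ∀ v → C v ≤ 1
    bitsB b Cx v = [ bitB b , (λ { refl → ≤-reflexive Cx }) ]′ (At-all v)

    play : ∀ {C Q u v} (t : Tr (At K x) C Q [] [] [ u , v ]) → Move G C (Outcome.outcome t) u v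
    play t = flow-move G F legal (λ a → cap a (At-all a)) (λ a → outcome-eq a (At-all a)) (hit (here refl))
      where
      open Tr t
      open Outcome t

    start : ∃ λ C → C x ≡ 1 × A C × ∑ C ≡ suc p
    start with init
    ... | C , a , sum = C [ x ≔ 1 ] , ≔-same C x 1 , respA off a ,
      trans (∑-at _) (cong₂ _+_ (≔-same C x 1) (trans (∑[]-cong K off) sum))
      where
      off : ∀ a → T (K a) → (C [ x ≔ 1 ]) a ≡ C a
      off a Ka = ≔-other C {x} 1 λ { refl → x∉K Ka }

    Extra : Set
    Extra = ∃ λ C → C x ≡ 1 × B C × ∑ C ≡ suc (suc p)

    -- If an attack drew the guard of `x` into `K`, all p + 1 guards would be on `K`, and one more
    -- on `x` would give a configuration as in `Extra`. So only the first outcome of `attackA`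
    -- occurs.
    defend-lacking : ¬ Extra → DefenseWithAt Ver G x (suc p)
    defend-lacking ∄extra = (λ C → C x ≡ 1 × A C × ∑ C ≡ suc p) ,
      (start , (λ { C (Cx , a , _) → bits⇒valid Ver (bitsA a Cx) }) , respond) ,
      (λ { C (_ , _ , sum) → sum }) , (λ { C (Cx , _) → ≤-reflexive (≡sym Cx) })
      where
      respond : ∀ C → C x ≡ 1 × A C × ∑ C ≡ suc p → ∀ u v → Adj G u v →
        ∃ λ C' → (C' x ≡ 1 × A C' × ∑ C' ≡ suc p) × Move G C C' u v
      respond C (Cx , a , sum) u v uv with attackA a Cx uv
      ... | inj₁ t = let (C'x , a') = Outcome.outcome-P t in
        Outcome.outcome t , (C'x , a' , trans (Move-∑ G (play t)) sum) , play t
      ... | inj₂ t = contradiction (C' [ x ≔ 1 ] , ≔-same C' x 1 , respB off (proj₂ (Outcome.outcome-P t)) , total) ∄extra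
        where
        C' = Outcome.outcome t
        off : ∀ a → T (K a) → (C' [ x ≔ 1 ]) a ≡ C' a
        off a Ka = ≔-other C' {x} 1 λ { refl → x∉K Ka }
        total : ∑ (C' [ x ≔ 1 ]) ≡ suc (suc p)
        total = trans (∑-at _) (cong₂ _+_ (≔-same C' x 1) (trans (∑[]-cong K off)
          (trans (≡sym (trans (∑-at C') (cong (_+ ∑[ K ] C') (proj₁ (Outcome.outcome-P t)))))
            (trans (Move-∑ G (play t)) sum))))

    defend-extra : Extra → DefenseWithAt Ver G x (suc (suc p))
    defend-extra extra = (λ C → C x ≡ 1 × B C × ∑ C ≡ suc (suc p)) ,
      (extra , (λ { C (Cx , b , _) → bits⇒valid Ver (bitsB b Cx) }) , respond) ,
      (λ { C (_ , _ , sum) → sum }) , (λ { C (Cx , _) → ≤-reflexive (≡sym Cx) })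
      where
      respond : ∀ C → C x ≡ 1 × B C × ∑ C ≡ suc (suc p) → ∀ u v → Adj G u v →
        ∃ λ C' → (C' x ≡ 1 × B C' × ∑ C' ≡ suc (suc p)) × Move G C C' u v
      respond C (Cx , b , sum) u v uv = let t = attackB b Cx uv ; (C'x , b') = Outcome.outcome-P t in
        Outcome.outcome t , (C'x , b' , trans (Move-∑ G (play t)) sum) , play t

    -- The additional guard waits on the pendant vertex `zero` or is in use within `G`; in both
    -- cases the total is p + 2 and `x` is occupied.
    State : Config (suc n) → Set
    State D = (D (suc x) ≡ 1 × (D zero ≡ 1 × A (D ∘ suc) ⊎ D zero ≡ 0 × B (D ∘ suc))) × ∑ D ≡ suc (suc p)

    G⁺ : Graph (suc n)
    G⁺ = plus G x

    x-edge : Adj G⁺ (suc x) zero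
    x-edge = fromWitness refl

    -- The open half-edges, all of them at `x`, become moves to and from the pendant vertex.
    edges⁺ : List V → List V → List (V × V) → List (Fin (suc n) × Fin (suc n))
    edges⁺ [] [] F = map (λ (u , v) → suc u , suc v) F
    edges⁺ [] (i ∷ I) F = (zero , suc i) ∷ edges⁺ [] I F
    edges⁺ (o ∷ O) I F = (suc o , zero) ∷ edges⁺ O I F

    δ-suc : ∀ (u v : V) → δ (Fin.suc u) (suc v) ≡ δ u v
    δ-suc u v with u ≟ v
    ... | yes _ = refl
    ... | no _ = refl

    src⁺ : ∀ O I F a → # (suc a) (map proj₁ (edges⁺ O I F)) ≡ # a O + # a (map proj₁ F)
    src⁺ [] [] [] a = refl
    src⁺ [] [] ((u , v) ∷ F) a = cong₂ _+_ (δ-suc u a) (src⁺ [] [] F a)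
    src⁺ [] (i ∷ I) F a = src⁺ [] I F a
    src⁺ (o ∷ O) I F a = trans (cong₂ _+_ (δ-suc o a) (src⁺ O I F a)) (≡sym (+-assoc (δ o a) _ _))

    dst⁺ : ∀ O I F a → # (suc a) (map proj₂ (edges⁺ O I F)) ≡ # a I + # a (map proj₂ F)
    dst⁺ [] [] [] a = refl
    dst⁺ [] [] ((u , v) ∷ F) a = cong₂ _+_ (δ-suc v a) (dst⁺ [] [] F a)
    dst⁺ [] (i ∷ I) F a = trans (cong₂ _+_ (δ-suc i a) (dst⁺ [] I F a)) (≡sym (+-assoc (δ i a) _ _))
    dst⁺ (o ∷ O) I F a = dst⁺ O I F a

    src⁺-zero : ∀ O I F → # zero (map proj₁ (edges⁺ O I F)) ≡ length I
    src⁺-zero [] [] [] = refl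
    src⁺-zero [] [] (_ ∷ F) = src⁺-zero [] [] F
    src⁺-zero [] (i ∷ I) F = cong suc (src⁺-zero [] I F)
    src⁺-zero (o ∷ O) I F = src⁺-zero O I F

    dst⁺-zero : ∀ O I F → # zero (map proj₂ (edges⁺ O I F)) ≡ length O
    dst⁺-zero [] [] [] = refl
    dst⁺-zero [] [] (_ ∷ F) = dst⁺-zero [] [] F
    dst⁺-zero [] (i ∷ I) F = dst⁺-zero [] I F
    dst⁺-zero (o ∷ O) I F = cong suc (dst⁺-zero O I F)

    legal⁺ : ∀ O I F → All (_≡ x) O → All (_≡ x) I → (∀ {u v} → (u , v) ∈ F → Adj G u v) →
      ∀ {u v} → (u , v) ∈ edges⁺ O I F → Adj G⁺ u v
    legal⁺ [] [] (_ ∷ F) _ _ legal (here refl) = legal (here refl)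
    legal⁺ [] [] (_ ∷ F) o i legal (there e∈) = legal⁺ [] [] F o i (legal ∘ there) e∈
    legal⁺ [] (_ ∷ I) F _ (refl ∷ _) legal (here refl) = x-edge
    legal⁺ [] (_ ∷ I) F o (_ ∷ i) legal (there e∈) = legal⁺ [] I F o i legal e∈
    legal⁺ (_ ∷ O) I F (refl ∷ _) _ legal (here refl) = x-edge
    legal⁺ (_ ∷ O) I F (_ ∷ o) i legal (there e∈) = legal⁺ O I F o i legal e∈

    ∈-edges⁺ : ∀ O I F {u v} → (u , v) ∈ F → (Fin.suc u , Fin.suc v) ∈ edges⁺ O I F
    ∈-edges⁺ [] [] (_ ∷ F) (here refl) = here refl
    ∈-edges⁺ [] [] (_ ∷ F) (there e∈) = there (∈-edges⁺ [] [] F e∈)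
    ∈-edges⁺ [] (_ ∷ I) F e∈ = there (∈-edges⁺ [] I F e∈)
    ∈-edges⁺ (_ ∷ O) I F e∈ = there (∈-edges⁺ O I F e∈)

    play⁺ : ∀ {D Q O I X u v} (t : Tr (At K x) (D ∘ suc) Q O I X) → All (_≡ x) O → All (_≡ x) I → ∀ k →
      k + length I ≡ D zero + length O → length I ≤ D zero →
      (u , v) ∈ edges⁺ O I (Tr.F t) ⊎ (v , u) ∈ edges⁺ O I (Tr.F t) →
      (∀ D' → Q (D' ∘ suc) → D' zero ≡ k → ∑ D' ≡ ∑ D → State D') →
      ∃ λ D' → State D' × Move G⁺ D D' u v
    play⁺ {D} {Q} {O} {I} {u = u} {v} t o i k total enough hits target = D' , target D' outcome-P refl (Move-∑ G⁺ move) , move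
      where
      open Tr t
      open Outcome t
      D' : Config (suc n)
      D' zero = k
      D' (suc a) = outcome a
      move : Move G⁺ D D' u v
      move = flow-move G⁺ (edges⁺ O I F) (legal⁺ O I F o i legal)
        (λ { zero → ≤-trans (≤-reflexive (src⁺-zero O I F)) enough
           ; (suc a) → ≤-trans (≤-reflexive (src⁺ O I F a)) (cap a (At-all a)) })
        (λ { zero → trans (cong (k +_) (src⁺-zero O I F)) (trans total (cong (D zero +_) (≡sym (dst⁺-zero O I F))))
           ; (suc a) → trans (cong (outcome a +_) (src⁺ O I F a)) (trans (outcome-eq a (At-all a)) (cong (D (suc a) +_) (≡sym (dst⁺ O I F a)))) })
        hits

    -- With the pendant vertex occupied, its guard and that of `x` change places. Otherwise the
    -- guard of `x` moves out and the additional guard in `G` takes its place by `giveB`, which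
    -- restores state `A`.
    attack-x : ∀ {D} → State D → ∃ λ D' → State D' × Move G⁺ D D' (suc x) zero
    attack-x {D} ((Dx , inj₁ (D0 , a)) , sum) = play⁺ {D} {Q = λ C' → C' x ≡ 1 × A C'}
      (pass (inj₂ refl) Dx (λ C' e → trans (e x (inj₂ refl)) Dx , respA (λ b Kb → e b (inj₁ Kb)) a))
      (refl ∷ []) (refl ∷ []) 1 (cong (_+ 1) (≡sym D0)) (≤-reflexive (≡sym D0)) (inj₁ (here refl))
      (λ D' (D'x , a') D'0 s → (D'x , inj₁ (D'0 , a')) , trans s sum)
    attack-x {D} ((Dx , inj₂ (D0 , b)) , sum) = play⁺ {D}
      (release (inj₂ refl) Dx (giveB (respB (λ a Ka → ≔-other (D ∘ suc) {x} 0 λ { refl → x∉K Ka }) b) (≔-same (D ∘ suc) x 0)))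
      (refl ∷ []) [] 1 (cong (_+ 1) (≡sym D0)) z≤n (inj₁ (here refl))
      (λ D' (D'x , a') D'0 s → (D'x , inj₁ (D'0 , a')) , trans s sum)

    attack⁺ : ∀ {D} → State D → ∀ {u v} → Adj G u v → ∃ λ D' → State D' × Move G⁺ D D' (suc u) (suc v)
    attack⁺ {D} ((Dx , inj₂ (D0 , b)) , sum) uv = play⁺ {D} t [] [] 0 (cong (_+ 0) (≡sym D0)) z≤n
      ([ inj₁ ∘ ∈-edges⁺ [] [] (Tr.F t) , inj₂ ∘ ∈-edges⁺ [] [] (Tr.F t) ]′ (Tr.hit t (here refl)))
      (λ D' (D'x , b') D'0 s → (D'x , inj₂ (D'0 , b')) , trans s sum)
      where t = attackB b Dx uv
    attack⁺ {D} ((Dx , inj₁ (D0 , a)) , sum) uv with attackA a Dx uv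
    ... | inj₁ t = play⁺ {D} t [] [] 1 (cong (_+ 0) (≡sym D0)) z≤n
      ([ inj₁ ∘ ∈-edges⁺ [] [] (Tr.F t) , inj₂ ∘ ∈-edges⁺ [] [] (Tr.F t) ]′ (Tr.hit t (here refl)))
      (λ D' (D'x , a') D'0 s → (D'x , inj₁ (D'0 , a')) , trans s sum)
    ... | inj₂ t = play⁺ {D} t' [] (refl ∷ []) 0 (trans (≡sym D0) (≡sym (+-identityʳ _))) (≤-reflexive (≡sym D0))
      ([ inj₁ ∘ ∈-edges⁺ [] [ x ] (Tr.F t') , inj₂ ∘ ∈-edges⁺ [] [ x ] (Tr.F t') ]′ (Tr.hit t' (here refl)))
      (λ D' (D'x , b') D'0 s → (D'x , inj₂ (D'0 , b')) , trans s sum)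
      -- The guard drawn from `x` is replaced in the same round by the one waiting on the pendant
      -- vertex.
      where t' = refill (inj₂ refl) (λ e → respB (λ a Ka → e a λ { refl → x∉K Ka })) t

    defend-plus : DefenseWith Ver G⁺ (suc (suc p))
    defend-plus = State , (initial , (λ { D s → bits⇒valid Ver (bits s) }) , respond) , (λ { D (_ , sum) → sum })
      where
      initial : ∃ State
      initial with start
      ... | C , Cx , a , sum = D , (Cx , inj₁ (refl , a)) , cong suc sum
        where
        D : Config (suc n)
        D zero = 1
        D (suc a) = C a
      bits : ∀ {D} → State D → ∀ v → D v ≤ 1
      bits ((_ , inj₁ (D0 , _)) , _) zero = ≤-reflexive D0
      bits ((_ , inj₂ (D0 , _)) , _) zero = ≤-trans (≤-reflexive D0) z≤n
      bits ((Dx , inj₁ (_ , a)) , _) (suc v) = bitsA a Dx v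
      bits ((Dx , inj₂ (_ , b)) , _) (suc v) = bitsB b Dx v
      Move-sym : ∀ {C C' : Config (suc n)} {u v} → Move G⁺ C C' u v → Move G⁺ C C' v u
      Move-sym (f , l , r , c , h) = f , l , r , c , [ inj₂ , inj₁ ]′ h
      respond : ∀ D → State D → ∀ u v → Adj G⁺ u v → ∃ λ D' → State D' × Move G⁺ D D' u v
      respond D s (suc u) (suc v) uv = attack⁺ s uv
      respond D s (suc u) zero e with toWitness {a? = u ≟ x} e
      ... | refl = attack-x s
      respond D s zero (suc v) e with toWitness {a? = v ≟ x} e
      ... | refl = let (D' , s' , m) = attack-x s in D' , s' , Move-sym m

-- Restricting a class of the extension to the graph

module Reduction {n m : ℕ} {Ver : Version} {G : Graph n} {x : Fin n} {G' : Graph m} {φ : Fin n → Fin m}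
  (ext : IsXExtension G x G' φ) {Cls' : Config m → Set} (evc : IsEVCClass Ver G' Cls') where
  open Flows G
  open Decomposition G

  private
    φ-inj : ∀ u v → φ u ≡ φ v → u ≡ v
    φ-inj = proj₁ ext
    φ-adj : ∀ u v → adj G' (φ u) (φ v) ≡ adj G u v
    φ-adj = proj₁ (proj₂ ext)
    component = proj₂ (proj₂ (proj₂ (proj₂ (proj₂ ext))))

    Adj'-sym : ∀ {u v} → Adj G' u v → Adj G' v u
    Adj'-sym {u} {v} = subst T (Defs.sym G' u v)

  Restricted : Config n → Set
  Restricted C = ∃ λ D → Cls' D × (∀ v → C v ≡ D (φ v))

  -- A neighbour of `φ b` other than `φ x` lies in the same component of `G'` without `φ x`, and the
  -- vertices of that component are images.
  onto : ∀ {b w} → b ≢ x → Adj G' (φ b) w → ∃ λ a → φ a ≡ w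
  onto {b} {w} b≢x bw with w ≟ φ x
  ... | yes refl = x , refl
  ... | no w≢ = proj₁ (Equivalence.from (component (φ b) w ((b , refl) , b≢)) (step (here b≢) bw w≢))
    where
    b≢ : φ b ≢ φ x
    b≢ = b≢x ∘ φ-inj b x

  -- Dropping moves out of `G` can only decrease a row sum. By `onto` no guard from outside arrives
  -- at a vertex other than `x`, so the columns there are complete.
  restrict : ∀ C → Restricted C → ∀ u v → Adj G u v → ∃ λ C' → Restricted C' × OpenMove x C C' u v
  restrict C (D , d , e) u v uv with proj₂ (proj₂ evc) D d (φ u) (φ v) (subst T (≡sym (φ-adj u v)) uv)
  ... | D' , d' , f , legal , row , col , hit = (D' ∘ φ) , (D' , d' , λ _ → refl) ,
    (λ a b → f (φ a) (φ b)) ,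
    (λ a b le → [ (λ e → inj₁ (φ-inj a b e)) , (λ ab → inj₂ (subst T (φ-adj a b) ab)) ]′ (legal _ _ le)) ,
    (λ a → ≤-trans (∑-inj-≤ φ φ-inj (f (φ a))) (≤-reflexive (trans (row (φ a)) (≡sym (e a))))) ,
    (λ b b≢x → ≤-reflexive (trans (≡sym (col (φ b))) (≡sym (∑-inj-≡ φ φ-inj (λ w → f w (φ b))
      (λ w le → [ (λ w≡ → b , ≡sym w≡) , onto b≢x ∘ Adj'-sym ]′ (legal w (φ b) le)))))) ,
    hit

  other : ∃ λ v → v ≢ x
  other with proj₁ (proj₂ (proj₂ (proj₂ (proj₂ ext))))
  ... | w , (v , refl) , w≢ = v , λ { refl → w≢ refl }

-- Comparison of the bounds

theorem1 : ∀ (V : Version) (n : ℕ) (G : Graph n) → Cactus G → SubstructureProperty V G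
theorem1 Ver n G (connected , no-two) x _ m G' φ ext a b (_ , a-least) (_ , b-least) = bounds
  where
  open Flows G
  open Decomposition G
  open Extraction G no-two using (Walk; end; via; decompose)
  open Strategies Ver G x

  closed : Closed K x
  closed _ _ = At-all _

  walk : ∀ {v} → Reach G (λ _ → ⊤) x v → Walk K x v
  walk (here _) = end
  walk {v} (step r wv _) = case v ≟ x of λ
    { (yes refl) → end ; (no v≢x) → via (K⁺ v≢x) (Adj-sym wv) (walk r) }

  bundle : Bundle K x
  bundle = decompose _ ≤-refl x∉K closed (λ v _ → walk (connected x v))

  module _ {C' : Config m} {Cls' : Config m → Set} (evc : IsEVCClass Ver G' Cls') (c' : Cls' C') where
    open Reduction {Ver = Ver} {G = G} {φ = φ} ext evc
    open LowerBound x Restricted restrict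

    guards : ℕ
    guards = ∑ (C' ∘ φ)

    restricted : Restricted (C' ∘ φ)
    restricted = C' , c' , λ _ → refl

    conclusion : Solved K x → (a ≤ b → b ∸ 1 ≤ guards) × (b < a → b ≤ guards)
    -- The component is nonempty, so some vertex differs from `x`.
    conclusion (empty ∄) = contradiction (K⁺ (proj₂ other)) (∄ _)
    conclusion (solved p (v , Kv , xv) least P) =
      (λ _ → decidable-stable (b ∸ 1 ≤? guards) (λ k → cases (k ∘ first))) ,
      (λ b<a → decidable-stable (b ≤? guards) (λ k → cases (k ∘ second b<a)))
      where
      -- The guard beyond the least number `p` stands on `x`, or, if `x` is empty, on `K` by
      -- `Least-root`.
      many : suc p ≤ guards
      many with zero-or-positive (C' (φ x))
      ... | inj₁ C'x = ≤-trans (Least-root {K = K} least closed x∉K x∉K xv Kv restricted C'x)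
              (≤-trans (m≤n+m _ _) (≤-reflexive (≡sym (∑-at (C' ∘ φ)))))
      ... | inj₂ C'x = ≤-trans (+-mono-≤ C'x (least restricted)) (≤-reflexive (≡sym (∑-at (C' ∘ φ))))

      Bounds : Set
      Bounds = b ≤ suc p ⊎ (b ≤ suc (suc p) × a ≤ suc (suc p))

      -- `Extra` is a statement about arbitrary configurations and is not decided. Refuting `Bounds`
      -- would refute `Extra`, and then `defend-lacking` gives the first alternative.
      cases : ¬ ¬ Bounds
      cases k = k (inj₁ (b-least _ (defend-lacking P λ extra →
        k (inj₂ (b-least _ (defend-extra P extra) , a-least _ (defend-plus P))))))

      first : Bounds → b ∸ 1 ≤ guards
      first (inj₁ b≤) = ≤-trans (m∸n≤m b 1) (≤-trans b≤ many)
      first (inj₂ (b≤ , _)) = ≤-trans (∸-monoˡ-≤ 1 b≤) many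

      second : b < a → Bounds → b ≤ guards
      second _ (inj₁ b≤) = ≤-trans b≤ many
      second b<a (inj₂ (_ , a≤)) = ≤-trans (≤-pred (≤-trans b<a a≤)) many

    result : (a ≤ b → b ∸ 1 ≤ guards) × (b < a → b ≤ guards)
    result = conclusion (Solve.solve x Restricted restrict bundle x∉K closed x∉K)

  bounds : (a ≤ b → ∀ C' → EternalVC Ver G' C' → b ∸ 1 ≤ ∑ (C' ∘ φ)) × (b < a → ∀ C' → EternalVC Ver G' C' → b ≤ ∑ (C' ∘ φ))
  bounds = (λ le C' (Cls' , evc , c') → proj₁ (result evc c') le) , (λ lt C' (Cls' , evc , c') → proj₂ (result evc c') lt)
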